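{- Let $\varepsilon \in \{ -1,1\}$, let $\lambda = (\lambda_1,\ldots,\lambda_\ell) \in \mathbb{Z}_{>0}^\ell$, $d = \lambda_1+\cdots+\lambda_\ell$, $s(j) = \lambda_1+\cdots+\lambda_{j-1}$, and for $\mathbf{n} = (n_1,\ldots,n_d) \in \mathbb{Z}^d$ let \[ A_{\lambda,\varepsilon}(\mathbf{n}) = \sum_{k \in \mathbb{Z}} \varepsilon^k \prod_{j=1}^{\ell} \binom{n_{s(j)+1} + \cdots + n_{s(j)+\lambda_j} - (\lambda_j - 1)k}{n_{s(j)+1} - k, \ldots, n_{s(j)+\lambda_j} - k, k}. \] Assume $\mathbf{n} \in \mathbb{Z}^d$ is such that $A_{\lambda,\varepsilon}(\mathbf{n})$ is finite. (a) If $\ell \geq 2$, then for all primes $p \geq 3$ and integers $r \geq 1$, \[ A_{\lambda,\varepsilon}(p^r\mathbf{n}) \equiv A_{\lambda,\varepsilon}(p^{r-1}\mathbf{n}) \pmod{p^{2r}}; \] if moreover $\varepsilon = 1$, these congruences also hold for $p = 2$. (b) If $\ell \geq 2$ and $\max(\lambda_1,\ldots,\lambda_\ell) \leq 2$, then for all primes $p \geq 5$ and integers $r \geq 1$, \[ A_{\lambda,\varepsilon}(p^r\mathbf{n}) \equiv A_{\lambda,\varepsilon}(p^{r-1}\mathbf{n}) \pmod{p^{3r}}. \]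
   Context: For arbitrary integers the binomial coefficient is $\binom{n}{k} = \lim_{z\to 0} \frac{\Gamma(z+n+1)}{\Gamma(z+k+1)\Gamma(z+n-k+1)}$ (always a finite integer; e.g. $\binom{ -3}{ -5}=\binom{ -3}{2}=6$), and the multinomial coefficient with integer entries $a_1,\dots,a_m$ and $N=a_1+\cdots+a_m$ is $\binom{N}{a_1,\ldots,a_m} = \lim_{z\to 0}\Gamma(z+N+1)/\prod_i \Gamma(z+a_i+1)$, equivalently the product of binomial coefficients $\prod_{i=2}^m \binom{a_1+\cdots+a_i}{a_i}$. "Finite" means the sum over $k$ has only finitely many nonzero terms (this holds automatically for $\mathbf{n}\in\mathbb{Z}_{\ge0}^d$, and for all $\mathbf{n}\in\mathbb{Z}^d$ when $\max_j\lambda_j\ge 2$). For $\mathbf{n}\in\mathbb{Z}_{\ge0}^d$, $A_{\lambda,\varepsilon}(\mathbf{n})$ is the coefficient of $x_1^{n_1}\cdots x_d^{n_d}$ in $\big(\prod_{j=1}^{\ell}[1 - \sum_{r=1}^{\lambda_j} x_{s(j)+r}] - \varepsilon x_1\cdots x_d\big)^{ -1}$. -}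

module Defs where

open import Data.Nat as ℕ using (ℕ; zero; suc)
open import Data.Nat.Combinatorics using (_C_)
open import Data.Integer using (ℤ; +_; -[1+_]; _+_; _*_; _-_; -_; _^_; ∣_∣)
open import Data.List using (List; []; _∷_; map; foldr; upTo; _++_; [_])
open import Data.Nat.ListAction using (sum)
open import Data.Vec using (Vec; take; drop; toList)
import Data.Nat as N

-- Generalized binomial coefficient for arbitrary integers,
-- binom n k = lim_{z→0} Γ(z+n+1)/(Γ(z+k+1)Γ(z+n-k+1)), written out explicitly:
--   n ≥ 0 : n C k for 0 ≤ k (which is 0 for k > n), and 0 for k < 0;
--   n = -(m+1) < 0, k ≥ 0 : (-1)^k C(m+k, k);
--   n = -(m+1) < 0, k = -(j+1) < 0 : (-1)^(n-k) C(-k-1, n-k) = (-1)^(j+m) C(j, m)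
--     (zero when n < k < 0, i.e. j < m).
binomℤ : ℤ → ℤ → ℤ
binomℤ (+ n)     (+ k)     = + (n C k)
binomℤ (+ n)     -[1+ k ]  = + 0
binomℤ -[1+ m ]  (+ k)     = (- + 1) ^ k * + ((m N.+ k) C k)
binomℤ -[1+ m ]  -[1+ j ]  = (- + 1) ^ (j N.+ m) * + (j C m)

multinomialGo : ℤ → List ℤ → ℤ
multinomialGo acc []       = + 1
multinomialGo acc (a ∷ as) = binomℤ (acc + a) a * multinomialGo (acc + a) as

multinomial : List ℤ → ℤ
multinomial []       = + 1
multinomial (a ∷ as) = multinomialGo a as

blocks : (λs : List ℕ) → Vec ℤ (sum λs) → List (List ℤ)
blocks []       v = []
blocks (l ∷ ls) v = toList (take l v) ∷ blocks ls (drop l v)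

-- Multinomial of block (x₁,…,x_λ) at k:
--   ( x₁+⋯+x_λ − (λ−1)k ; x₁−k, …, x_λ−k, k ).
-- (The top is the sum of the entries, as in the definition.)
blockTerm : ℤ → List ℤ → ℤ
blockTerm k xs = multinomial (map (λ x → x - k) xs ++ [ k ])

-- ε^k for ε ∈ {−1,1} and k ∈ ℤ (ε^k = ε^|k| since ε⁻¹ = ε).
εpow : ℤ → ℤ → ℤ
εpow ε k = ε ^ ∣ k ∣

term : ℤ → (λs : List ℕ) → Vec ℤ (sum λs) → ℤ → ℤ
term ε λs n k = εpow ε k * foldr _*_ (+ 1) (map (blockTerm k) (blocks λs n))

VanishesBeyond : ℤ → (λs : List ℕ) → Vec ℤ (sum λs) → ℕ → Set
VanishesBeyond ε λs n B = (k : ℤ) → B N.< ∣ k ∣ → term ε λs n k ≡ + 0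
  where open import Relation.Binary.PropositionalEquality using (_≡_)

Finite : ℤ → (λs : List ℕ) → Vec ℤ (sum λs) → Set
Finite ε λs n = Σ ℕ (VanishesBeyond ε λs n)
  where open import Data.Product using (Σ)

-- Truncated sum Σ_{k=-B}^{B} term(k); equals A_{λ,ε}(n) whenever
-- VanishesBeyond ε λs n B holds.
Asum : ℤ → (λs : List ℕ) → Vec ℤ (sum λs) → ℕ → ℤ
Asum ε λs n B = foldr _+_ (+ 0)
  (map (λ i → term ε λs n (+ i - + B)) (upTo (suc (B N.+ B))))

scale : ∀ {d} → ℕ → Vec ℤ d → Vec ℤ d
scale c n = Data.Vec.map (λ x → + c * x) n
  where import Data.Vec

{-# OPTIONS --safe #-}
module Submission where

open import Defs
open import Data.Integer.Base using (ℤ; +_; -[1+_]; _+_; _*_; _-_; -_; _^_; ∣_∣; _<_; _≤_; -<+; -≤+; -≤-; +<+; NonZero; Positive; ≢-nonZero)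
open import Data.Integer.DivMod using (_%ℕ_; _/ℕ_; a≡a%ℕn+[a/ℕn]*n; n%ℕd<d)
import Data.Integer.Divisibility as Unsigned
open import Data.Integer.Divisibility.Signed
open import Data.Integer.Properties
open import Data.Integer.Tactic.RingSolver using (solve-∀)
open import Data.List.Base using (List; []; _∷_; [_]; _++_; applyUpTo; foldr; length; map; upTo)
open import Data.List.Properties using (map-∘; map-cong)
open import Data.List.Relation.Unary.All as All using (All; []; _∷_)
open import Data.Nat.Base as ℕ using (ℕ; zero; suc; s≤s; z≤n; _!)
open import Data.Nat.Combinatorics using (_C_; k>n⇒nCk≡0; nCk≡nC[n∸k]; nCk+nC[k+1]≡[n+1]C[k+1])
open import Data.Nat.Coprimality using (Coprime; coprime-Bézout)
import Data.Nat.Divisibility as ℕ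
open import Data.Nat.DivMod using (_%_; _/_; m≡m%n+[m/n]*n; m%n<n)
open import Data.Nat.GCD using (module Bézout)
open import Data.Nat.ListAction using (sum)
open import Data.Nat.Primality using (Prime; prime⇒irreducible; prime⇒nonTrivial; prime⇒nonZero; prime[2]; ¬prime[1])
import Data.Nat.Properties as ℕ
import Data.Nat.Tactic.RingSolver as ℕ-Solver
open import Data.Product.Base using (Σ; ∃; _×_; _,_; proj₁; proj₂)
open import Data.Sum.Base using (_⊎_; inj₁; inj₂)
open import Data.Unit.Base using (⊤; tt)
open import Data.Vec.Base using (Vec; drop; take; toList)
open import Data.Vec.Properties using (drop-map; length-toList; take-map; toList-map)
open import Function.Base using (_∘_)
open import Relation.Binary.PropositionalEquality hiding ([_])
open import Algebra.Structures {A = ℤ} _≡_ using (IsCommutativeMonoid)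
open import Relation.Nullary using (¬_; Dec; yes; no; contradiction)

-- A binomial coefficient with entries p a, p b differs from the one with entries a, b by the factor H(p b, p a) / H(0, p a),
-- where H(B, A) is the product of the integers in (B , B + A] that are prime to p. Pairing y with A - y gives
-- H(B, A)² = ∏ (y (A - y) + B (A + B)) over the y ≤ A prime to p, so this factor is 1 modulo the power of p dividing
-- B (A + B), and for p ≥ 5, since ∑ 1 / y² ≡ 0 over a period p^s dividing A, even modulo p^s times that power. A block term
-- with index k is divisible by p^r / gcd(p^r, k), because it contains the factor binom(p^r n, k). Together these settle the
-- indices divisible by p, and, since there are at least two blocks, the remaining ones modulo p^(2r).
-- For the cube only the case of two blocks is left, where the indices k prime to p contribute
-- p^(2r) ∑ ε^k F_r(k - 1) / k² with F_r(m) ≡ F_(r-1)(⌊m / p⌋) (mod p^r); as the sums of ε^k / k² over periods p^s vanish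
-- modulo p^s, iterating this congruence shows that the sum vanishes modulo p^r.
-- For p = 2 the factor of a binomial coefficient with both entries odd is -1 modulo 4: such signs cancel between two blocks
-- of length at most 2, and otherwise an additional factor 2 compensates them.

-- Congruences

-- The coefficients compared may be zero or divisible by p, so their quotients need not exist as
-- residues; `Ratio` records a quotient of p-adic units, and its relative precision adds to the
-- divisibility of the coefficient itself. The exponents balance as follows. At level r let p^s be
-- the part of p^r dividing k, and r = s + d. All entries of a block are then multiples of p^s, so
-- passing to level r + 1 has relative error p^(2(s+1)), while each of two blocks is divisible by
-- p^d: in total 2(s + 1) + 2d = 2(r + 1). For the cube the relative error must improve to
-- p^((s+1)+(r+1)+(s+1)). This asks for a partial sum divisible by p^r in every binomial factor. The
-- entries other than k are ≡ -k (mod p^r), so k and one of them sum to 0, which is enough for one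
-- or two such entries; with three, the total is ≡ -2k, and the last factor, which joins -3k and k
-- or -k and -k, has no such sum in general. Finiteness is assumed for n only, so it has to be
-- carried over to the multiples of n.

infix 4 _≈_[_]
-- The left side is isolated so that matching on the equation eliminates x, and what remains is a
-- polynomial identity for the ring solver. Modulus 0 is allowed and means equality.
record _≈_[_] (x y q : ℤ) : Set where
  constructor _,_
  field
    quotient : ℤ
    equality : x ≡ y + quotient * q

module _ where

  private
    variable
      q x y z w : ℤ

  ≈-reflexive : x ≡ y → x ≈ y [ q ]
  ≈-reflexive {x} {q = q} refl = + 0 , lemma x q
    where
    lemma : ∀ x q → x ≡ x + + 0 * q
    lemma = solve-∀

  ≈-refl : x ≈ x [ q ]
  ≈-refl = ≈-reflexive refl

  ≈-sym : x ≈ y [ q ] → y ≈ x [ q ]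
  ≈-sym {y = y} {q} (k , refl) = - k , lemma y k q
    where
    lemma : ∀ y k q → y ≡ y + k * q + - k * q
    lemma = solve-∀

  ≈-trans : x ≈ y [ q ] → y ≈ z [ q ] → x ≈ z [ q ]
  ≈-trans {q = q} {z} (k , refl) (l , refl) = l + k , lemma z l k q
    where
    lemma : ∀ z l k q → z + l * q + k * q ≡ z + (l + k) * q
    lemma = solve-∀

  ≈-+ : x ≈ y [ q ] → z ≈ w [ q ] → x + z ≈ y + w [ q ]
  ≈-+ {y = y} {q} {w = w} (k , refl) (l , refl) = k + l , lemma y k q w l
    where
    lemma : ∀ y k q w l → y + k * q + (w + l * q) ≡ y + w + (k + l) * q
    lemma = solve-∀

  ≈-* : x ≈ y [ q ] → z ≈ w [ q ] → x * z ≈ y * w [ q ]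
  ≈-* {y = y} {q} {w = w} (k , refl) (l , refl) = y * l + k * w + k * l * q , lemma y k q w l
    where
    lemma : ∀ y k q w l → (y + k * q) * (w + l * q) ≡ y * w + (y * l + k * w + k * l * q) * q
    lemma = solve-∀

  ≈-+ˡ : ∀ z → x ≈ y [ q ] → z + x ≈ z + y [ q ]
  ≈-+ˡ z x≈y = ≈-+ (≈-refl {z}) x≈y

  ≈-+ʳ : ∀ z → x ≈ y [ q ] → x + z ≈ y + z [ q ]
  ≈-+ʳ z x≈y = ≈-+ x≈y (≈-refl {z})

  ≈-*ˡ : ∀ z → x ≈ y [ q ] → z * x ≈ z * y [ q ]
  ≈-*ˡ z x≈y = ≈-* (≈-refl {z}) x≈y

  ≈-*ʳ : ∀ z → x ≈ y [ q ] → x * z ≈ y * z [ q ]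
  ≈-*ʳ z x≈y = ≈-* x≈y (≈-refl {z})

  ≈⇒∣ : x ≈ y [ q ] → q ∣ x - y
  ≈⇒∣ {y = y} {q} (k , refl) = divides k (lemma y k q)
    where
    lemma : ∀ y k q → y + k * q - y ≡ k * q
    lemma = solve-∀

  ∣⇒≈ : q ∣ x - y → x ≈ y [ q ]
  ∣⇒≈ {q} {x} {y} (divides k eq) = k , trans (lemma x y) (cong (_+_ y) eq)
    where
    lemma : ∀ x y → x ≡ y + (x - y)
    lemma = solve-∀

  ∣⇒≈0 : q ∣ x → x ≈ + 0 [ q ]
  ∣⇒≈0 (divides k eq) = k , trans eq (sym (+-identityˡ _))

  ≈0⇒∣ : x ≈ + 0 [ q ] → q ∣ x
  ≈0⇒∣ (k , eq) = divides k (trans eq (+-identityˡ _))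

  ∣-resp-≈ : x ≈ y [ q ] → q ∣ y → q ∣ x
  ∣-resp-≈ x≈y q∣y = ≈0⇒∣ (≈-trans x≈y (∣⇒≈0 q∣y))

  ∣-*-∣ : x ∣ z → y ∣ w → x * y ∣ z * w
  ∣-*-∣ {x} {y = y} (divides k refl) (divides l refl) = divides (k * l) (lemma k x l y)
    where
    lemma : ∀ k x l y → k * x * (l * y) ≡ k * l * (x * y)
    lemma = solve-∀

  ≈-weaken : z ∣ q → x ≈ y [ q ] → x ≈ y [ z ]
  ≈-weaken {z} {y = y} (divides j refl) (k , eq) = k * j , trans eq (cong (_+_ y) (sym (*-assoc k j z)))

  x∣0 : x ∣ + 0
  x∣0 = divides (+ 0) refl

  ^-mono-∣ : ∀ x {m n} → m ℕ.≤ n → x ^ m ∣ x ^ n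
  ^-mono-∣ x {m} {n} m≤n = divides (x ^ (n ℕ.∸ m)) (trans
    (cong (x ^_) (sym (ℕ.m∸n+n≡m m≤n))) (^-distribˡ-+-* x (n ℕ.∸ m) m))

  ^-∣-base : ∀ x {n} → 1 ℕ.≤ n → x ∣ x ^ n
  ^-∣-base x {n} 1≤n = subst (_∣ x ^ n) (*-identityʳ x) (^-mono-∣ x 1≤n)

-- p-adic units and quotients of units

module Units (p : ℕ) (p-prime : Prime p) where

  P : ℤ
  P = + p

  instance
    p-nonZero : ℕ.NonZero p
    p-nonZero = prime⇒nonZero p-prime

  -- Invertibility modulo `P` alone; `unit-inverse` lifts the inverse to every power of `P`.
  record Unit (u : ℤ) : Set where
    constructor _,_
    field
      inverse   : ℤ
      isInverse : u * inverse ≈ + 1 [ P ]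

  private
    pos-1+* : ∀ {a b c d} → 1 ℕ.+ a ℕ.* b ≡ c ℕ.* d → + 1 + + a * + b ≡ + c * + d
    pos-1+* {a} {b} {c} {d} eq = trans (cong (λ z → + 1 + z) (sym (pos-* a b))) (trans (cong +_ eq) (pos-* c d))

    unit-+ : ∀ n → ¬ p ℕ.∣ n → Unit (+ n)
    unit-+ n p∤n with coprime-Bézout coprime
      where
      coprime : Coprime p n
      coprime (d∣p , d∣n) with prime⇒irreducible p-prime d∣p
      ... | inj₁ d≡1  = d≡1
      ... | inj₂ refl = contradiction d∣n p∤n
    ... | Bézout.+- x y eq = - + y , (- + x , trans (lemma₁ (+ n) (+ y)) (trans (cong -_ (pos-1+*-1 eq)) (lemma₂ (+ x) P)))
      where
      pos-1+*-1 : 1 ℕ.+ y ℕ.* n ≡ x ℕ.* p → + y * + n ≡ + x * P - + 1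
      pos-1+*-1 e = trans (lemma (+ y * + n)) (cong (λ a → a - + 1) (pos-1+* {y} {n} {x} {p} e))
        where
        lemma : ∀ a → a ≡ + 1 + a - + 1
        lemma = solve-∀
      lemma₁ : ∀ n y → n * - y ≡ - (y * n)
      lemma₁ = solve-∀
      lemma₂ : ∀ x P → - (x * P - + 1) ≡ + 1 + - x * P
      lemma₂ = solve-∀
    ... | Bézout.-+ x y eq = + y , (+ x , trans (*-comm (+ n) (+ y)) (sym (pos-1+* {x} {p} {y} {n} eq)))

  unit-* : ∀ {u v} → Unit u → Unit v → Unit (u * v)
  unit-* {u} {v} (u′ , uu′≈1) (v′ , vv′≈1) =
    u′ * v′ , ≈-trans (≈-reflexive (lemma u v u′ v′)) (≈-* uu′≈1 vv′≈1)
    where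
    lemma : ∀ u v u′ v′ → u * v * (u′ * v′) ≡ u * u′ * (v * v′)
    lemma = solve-∀

  unit-neg : ∀ {u} → Unit u → Unit (- u)
  unit-neg {u} (u′ , uu′≈1) = - u′ , ≈-trans (≈-reflexive (lemma u u′)) uu′≈1
    where
    lemma : ∀ u v → - u * - v ≡ u * v
    lemma = solve-∀

  unit-1 : Unit (+ 1)
  unit-1 = + 1 , ≈-refl

  unit-resp-≈ : ∀ {u v} → u ≈ v [ P ] → Unit v → Unit u
  unit-resp-≈ u≈v (v′ , vv′≈1) = v′ , ≈-trans (≈-* u≈v ≈-refl) vv′≈1

  P∤⇒unit : ∀ {u} → ¬ P ∣ u → Unit u
  P∤⇒unit {+ n}      P∤u = unit-+ n (P∤u ∘ ∣ᵤ⇒∣)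
  P∤⇒unit { -[1+ n ]} P∤u = unit-neg (unit-+ (suc n) (P∤u ∘ ∣ᵤ⇒∣))

  unit⇒P∤ : ∀ {u} → Unit u → ¬ P ∣ u
  unit⇒P∤ {u} (v , uv≈1) P∣u = p∤1 (∣⇒∣ᵤ (∣-resp-≈ (≈-sym uv≈1) (∣m⇒∣m*n v P∣u)))
    where
    p∤1 : ¬ p ℕ.∣ 1
    p∤1 p∣1 = ¬prime[1] (subst Prime (ℕ.∣1⇒≡1 p∣1) p-prime)

  unit-inverse : ∀ {u} → Unit u → ∀ t → ∃ λ v → u * v ≈ + 1 [ P ^ t ]
  unit-inverse {u} u-unit zero = + 0 , (- + 1 , lemma u)
    where
    lemma : ∀ u → u * + 0 ≡ + 1 + - + 1 * + 1
    lemma = solve-∀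
  -- 1 - u w with w = v + u′ - u v u′ factors as (1 - u v) (1 - u u′).
  unit-inverse {u} u-unit@(u′ , (k , uu′≡)) (suc t) with unit-inverse u-unit t
  ... | v , (l , uv≡) = v + u′ - u * v * u′ , (- (l * k) , (begin
    u * (v + u′ - u * v * u′)                                   ≡⟨ lemma₁ u v u′ ⟩
    + 1 - (+ 1 - u * v) * (+ 1 - u * u′)                        ≡⟨ cong₂ (λ a b → + 1 - (+ 1 - a) * (+ 1 - b)) uv≡ uu′≡ ⟩
    + 1 - (+ 1 - (+ 1 + l * P ^ t)) * (+ 1 - (+ 1 + k * P))     ≡⟨ lemma₂ l k P (P ^ t) ⟩
    + 1 + - (l * k) * (P * P ^ t)                               ∎))
    where
    open ≡-Reasoning
    lemma₁ : ∀ u v w → u * (v + w - u * v * w) ≡ + 1 - (+ 1 - u * v) * (+ 1 - u * w)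
    lemma₁ = solve-∀
    lemma₂ : ∀ l k P Q → + 1 - (+ 1 - (+ 1 + l * Q)) * (+ 1 - (+ 1 + k * P)) ≡ + 1 + - (l * k) * (P * Q)
    lemma₂ = solve-∀

  unit-cancel-∣ : ∀ {u x} t → Unit u → P ^ t ∣ u * x → P ^ t ∣ x
  unit-cancel-∣ {u} {x} t u-unit P^t∣ux with unit-inverse u-unit t
  ... | v , uv≈1 = ∣-resp-≈
    (≈-trans (≈-reflexive (sym (*-identityˡ x))) (≈-trans (≈-* (≈-sym uv≈1) ≈-refl) (≈-reflexive (lemma u v x))))
    (∣n⇒∣m*n v P^t∣ux)
    where
    lemma : ∀ u v x → u * v * x ≡ v * (u * x)
    lemma = solve-∀

  unit-cancel-≈ : ∀ {u x y} t → Unit u → u * x ≈ u * y [ P ^ t ] → x ≈ y [ P ^ t ]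
  unit-cancel-≈ {u} {x} {y} t u-unit ux≈uy =
    ∣⇒≈ (unit-cancel-∣ t u-unit (subst (P ^ t ∣_) (lemma u x y) (≈⇒∣ ux≈uy)))
    where
    lemma : ∀ u x y → u * x - u * y ≡ u * (x - y)
    lemma = solve-∀

  -- "x = (U / V) y with U / V ≡ σ (mod q)", which makes sense p-adically even for x = y = 0.
  record Ratio (q σ x y : ℤ) : Set where
    constructor ratio
    field
      {V U}    : ℤ
      V-unit   : Unit V
      U≈σV     : U ≈ σ * V [ q ]
      equation : V * x ≡ U * y

  ratio-refl : ∀ {q x} → Ratio q (+ 1) x x
  ratio-refl = ratio unit-1 ≈-refl refl

  ratio-* : ∀ {q σ τ x y z w} → Ratio q σ x y → Ratio q τ z w → Ratio q (σ * τ) (x * z) (y * w)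
  ratio-* {σ = σ} {τ} {x} {y} {z} {w} (ratio {V} {U} V-unit U≈ eq) (ratio {V′} {U′} V′-unit U′≈ eq′) =
    ratio (unit-* V-unit V′-unit) (≈-trans (≈-* U≈ U′≈) (≈-reflexive (lemma σ V τ V′)))
      (trans (lemma V V′ x z) (trans (cong₂ _*_ eq eq′) (lemma U y U′ w)))
    where
    lemma : ∀ a b c d → a * b * (c * d) ≡ a * c * (b * d)
    lemma = solve-∀

  ratio-trans : ∀ {q σ τ x y z} → Ratio q σ x y → Ratio q τ y z → Ratio q (σ * τ) x z
  ratio-trans {σ = σ} {τ} {x} {y} {z} (ratio {V} {U} V-unit U≈ eq) (ratio {V′} {U′} V′-unit U′≈ eq′) =
    ratio (unit-* V-unit V′-unit) (≈-trans (≈-* U≈ U′≈) (≈-reflexive (lemma₀ σ V τ V′)))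
      (trans (lemma₁ V V′ x) (trans (cong (V′ *_) eq) (trans (lemma₂ V′ U y) (trans (cong (U *_) eq′) (sym (*-assoc U U′ z))))))
    where
    lemma₀ : ∀ a b c d → a * b * (c * d) ≡ a * c * (b * d)
    lemma₀ = solve-∀
    lemma₁ : ∀ V V′ x → V * V′ * x ≡ V′ * (V * x)
    lemma₁ = solve-∀
    lemma₂ : ∀ V U y → V * (U * y) ≡ U * (V * y)
    lemma₂ = solve-∀

  ratio-zero : ∀ {q σ x y} → x ≡ + 0 → y ≡ + 0 → Ratio q σ x y
  ratio-zero {q} {σ} refl refl = ratio {U = σ * + 1} unit-1 ≈-refl (sym (*-zeroʳ (σ * + 1)))

  ratio-weaken : ∀ {q r σ x y} → q ∣ r → Ratio r σ x y → Ratio q σ x y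
  ratio-weaken q∣r (ratio V-unit U≈ eq) = ratio V-unit (≈-weaken q∣r U≈) eq

  ratio-sign : ∀ {q σ τ x y} → σ ≈ τ [ q ] → Ratio q σ x y → Ratio q τ x y
  ratio-sign σ≈τ (ratio V-unit U≈ eq) = ratio V-unit (≈-trans U≈ (≈-* σ≈τ ≈-refl)) eq

  -- A relative error P^a of a number divisible by P^b is an absolute error P^(a+b). Here the
  -- precision of the ratios and the divisibility of the terms are added.
  ratio⇒≈ : ∀ {a b σ x y} → Ratio (P ^ a) σ x y → P ^ b ∣ y → x ≈ σ * y [ P ^ (a ℕ.+ b) ]
  ratio⇒≈ {a} {b} {σ} {x} (ratio {V} {U} V-unit (k , U≡) eq) (divides l refl) =
    unit-cancel-≈ (a ℕ.+ b) V-unit (k * l , (begin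
      V * x                                               ≡⟨ eq ⟩
      U * (l * P ^ b)                                     ≡⟨ cong (_* (l * P ^ b)) U≡ ⟩
      (σ * V + k * P ^ a) * (l * P ^ b)                   ≡⟨ lemma σ V k l (P ^ a) (P ^ b) ⟩
      V * (σ * (l * P ^ b)) + k * l * (P ^ a * P ^ b)     ≡⟨ cong (λ z → V * (σ * (l * P ^ b)) + k * l * z) (^-distribˡ-+-* P a b) ⟨
      V * (σ * (l * P ^ b)) + k * l * P ^ (a ℕ.+ b)       ∎))
    where
    open ≡-Reasoning
    lemma : ∀ σ V k l A B → (σ * V + k * A) * (l * B) ≡ V * (σ * (l * B)) + k * l * (A * B)
    lemma = solve-∀

  ratio-≈ : ∀ {a σ x y} → Ratio (P ^ a) σ x y → x ≈ σ * y [ P ^ a ]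
  ratio-≈ {a} {σ} {x} {y} R = subst (λ t → x ≈ σ * y [ P ^ t ]) (ℕ.+-identityʳ a) (ratio⇒≈ {a} {0} R (divides y (sym (*-identityʳ y))))

-- Sums and products over integer intervals

≈[0]⇒≡ : ∀ {x y} → x ≈ y [ + 0 ] → x ≡ y
≈[0]⇒≡ {y = y} (k , eq) = trans eq (trans (cong (_+_ y) (*-zeroʳ k)) (+-identityʳ y))

-- Sums and products share these lemmas through a commutative monoid structure that respects
-- congruences. An interval is given by its first element c, of any sign, and its length.
module Interval (_∙_ : ℤ → ℤ → ℤ) (ε : ℤ) (isCommutativeMonoid : IsCommutativeMonoid _∙_ ε)
  (∙-cong-≈ : ∀ {q x y z w} → x ≈ y [ q ] → z ≈ w [ q ] → (x ∙ z) ≈ (y ∙ w) [ q ]) where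

  open IsCommutativeMonoid isCommutativeMonoid using (assoc; comm; identityˡ; identityʳ)

  fold : (ℤ → ℤ) → ℤ → ℕ → ℤ
  fold f c zero    = ε
  fold f c (suc L) = fold f c L ∙ f (c + + L)

  fold-cong-≈ : ∀ {q f g c d} L → (∀ j → j ℕ.< L → f (c + + j) ≈ g (d + + j) [ q ]) →
                fold f c L ≈ fold g d L [ q ]
  fold-cong-≈ zero    f≈g = ≈-refl
  fold-cong-≈ (suc L) f≈g = ∙-cong-≈ (fold-cong-≈ L λ j j<L → f≈g j (ℕ.m<n⇒m<1+n j<L)) (f≈g L (ℕ.n<1+n L))

  -- Equality is congruence modulo 0, so this is the case q = 0 of `fold-cong-≈`.
  fold-cong : ∀ {f g c d} L → (∀ j → j ℕ.< L → f (c + + j) ≡ g (d + + j)) → fold f c L ≡ fold g d L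
  fold-cong L f≡g = ≈[0]⇒≡ (fold-cong-≈ L λ j j<L → ≈-reflexive (f≡g j j<L))

  fold-split : ∀ f c L M → fold f c (L ℕ.+ M) ≡ fold f c L ∙ fold f (c + + L) M
  fold-split f c L zero    = trans (cong (fold f c) (ℕ.+-identityʳ L)) (sym (identityʳ _))
  fold-split f c L (suc M) = begin
    fold f c (L ℕ.+ suc M)                                      ≡⟨ cong (fold f c) (ℕ.+-suc L M) ⟩
    fold f c (L ℕ.+ M) ∙ f (c + + (L ℕ.+ M))                    ≡⟨ cong₂ _∙_ (fold-split f c L M) (cong f (sym (+-assoc c (+ L) (+ M)))) ⟩
    (fold f c L ∙ fold f (c + + L) M) ∙ f (c + + L + + M)       ≡⟨ assoc _ _ _ ⟩
    fold f c L ∙ (fold f (c + + L) M ∙ f (c + + L + + M))       ∎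
    where open ≡-Reasoning

  fold-head : ∀ f c L → fold f c (suc L) ≡ f c ∙ fold f (+ 1 + c) L
  fold-head f c L = trans (fold-split f c 1 L)
    (cong₂ _∙_ (trans (identityˡ _) (cong f (+-identityʳ c))) (cong (λ d → fold f d L) (+-comm c (+ 1))))

  fold-∙ : ∀ f g c L → fold (λ x → f x ∙ g x) c L ≡ fold f c L ∙ fold g c L
  fold-∙ f g c zero    = sym (identityˡ ε)
  fold-∙ f g c (suc L) = trans (cong (_∙ (f (c + + L) ∙ g (c + + L))) (fold-∙ f g c L)) (interchange _ _ _ _)
    where
    interchange : ∀ a b c d → (a ∙ b) ∙ (c ∙ d) ≡ (a ∙ c) ∙ (b ∙ d)
    interchange a b c d = trans (assoc a b (c ∙ d)) (trans (cong (a ∙_) (trans (sym (assoc b c d))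
      (trans (cong (_∙ d) (comm b c)) (assoc c b d)))) (sym (assoc a c (b ∙ d))))

  -- The reflection x ↦ c + d + L - 1 - x exchanges the intervals of length L starting at c and at
  -- d; a free d allows both halves of a pairing to be indexed by the same interval.
  fold-reverse : ∀ f c d L → fold f c L ≡ fold (λ x → f (c + d + + L - + 1 - x)) d L
  fold-reverse f c d zero    = refl
  fold-reverse f c d (suc L) = begin
    fold f c (suc L)                                                          ≡⟨ fold-head f c L ⟩
    f c ∙ fold f (+ 1 + c) L                                                  ≡⟨ comm _ _ ⟩
    fold f (+ 1 + c) L ∙ f c                                                  ≡⟨ cong₂ _∙_ (fold-reverse f (+ 1 + c) d L) (cong f (lemma₂ c d (+ L))) ⟩
    fold (λ x → f (+ 1 + c + d + + L - + 1 - x)) d L ∙ f (c + d + + suc L - + 1 - (d + + L))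
      ≡⟨ cong (_∙ f (c + d + + suc L - + 1 - (d + + L))) (fold-cong {c = d} {d = d} L λ j _ → cong f (lemma₁ c d (+ L) (d + + j))) ⟩
    fold (λ x → f (c + d + + suc L - + 1 - x)) d L ∙ f (c + d + + suc L - + 1 - (d + + L)) ∎
    where
    open ≡-Reasoning
    lemma₁ : ∀ c d L x → + 1 + c + d + L - + 1 - x ≡ c + d + (+ 1 + L) - + 1 - x
    lemma₁ = solve-∀
    lemma₂ : ∀ c d L → c ≡ c + d + (+ 1 + L) - + 1 - (d + L)
    lemma₂ = solve-∀

  -- Moving the interval one place up from d exchanges the value f d for the congruent f (d + L); n
  -- counts such moves.
  fold-shift : ∀ {q f} L → (∀ x → f (x + + L) ≈ f x [ q ]) → ∀ c n → fold f (c + + n) L ≈ fold f c L [ q ]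
  fold-shift         zero     periodic c n       = ≈-refl
  fold-shift         (suc L)  periodic c zero    = ≈-reflexive (cong (λ d → fold _ d (suc L)) (+-identityʳ c))
  fold-shift {f = f} (suc L)  periodic c (suc n) = ≈-trans step (fold-shift (suc L) periodic c n)
    where
    d = c + + n
    lemma : ∀ c n → c + (+ 1 + n) ≡ + 1 + (c + n)
    lemma = solve-∀
    lemma′ : ∀ d L → + 1 + d + L ≡ d + (+ 1 + L)
    lemma′ = solve-∀
    step : fold f (c + + suc n) (suc L) ≈ fold f d (suc L) [ _ ]
    step = ≈-trans (≈-reflexive (cong (λ d → fold f d (suc L)) (lemma c (+ n))))
      (≈-trans (∙-cong-≈ ≈-refl (≈-trans (≈-reflexive (cong f (lemma′ d (+ L)))) (periodic d)))
      (≈-reflexive (trans (comm _ _) (sym (fold-head f d L)))))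

  fold-periodic : ∀ {q f} L → (∀ x → f (x + + L) ≈ f x [ q ]) → ∀ c d → fold f c L ≈ fold f d L [ q ]
  fold-periodic {q} {f} L periodic c d with c - d in eq
  ... | + n      = subst (λ c → fold f c L ≈ fold f d L [ q ]) (trans (cong (_+_ d) (sym eq)) (lemma c d)) (fold-shift L periodic d n)
    where
    lemma : ∀ c d → d + (c - d) ≡ c
    lemma = solve-∀
  ... | -[1+ n ] = ≈-sym (subst (λ d → fold f d L ≈ fold f c L [ q ]) (trans (cong (λ z → c + - z) (sym eq)) (lemma c d)) (fold-shift L periodic c (suc n)))
    where
    lemma : ∀ c d → c + - (c - d) ≡ d
    lemma = solve-∀

  fold-group : ∀ f a c L → fold f (+ a * c) (L ℕ.* a) ≡ fold (λ m → fold f (+ a * m) a) c L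
  fold-group f a c zero    = refl
  fold-group f a c (suc L) = begin
    fold f (+ a * c) (a ℕ.+ L ℕ.* a)                                             ≡⟨ cong (fold f (+ a * c)) (ℕ.+-comm a (L ℕ.* a)) ⟩
    fold f (+ a * c) (L ℕ.* a ℕ.+ a)                                             ≡⟨ fold-split f (+ a * c) (L ℕ.* a) a ⟩
    fold f (+ a * c) (L ℕ.* a) ∙ fold f (+ a * c + + (L ℕ.* a)) a                ≡⟨ cong₂ (λ x d → x ∙ fold f d a) (fold-group f a c L)
                                                                                   (trans (cong (_+_ (+ a * c)) (pos-* L a)) (lemma (+ a) c (+ L))) ⟩
    fold (λ m → fold f (+ a * m) a) c L ∙ fold f (+ a * (c + + L)) a             ∎
    where
    open ≡-Reasoning
    lemma : ∀ a c L → a * c + L * a ≡ a * (c + L)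
    lemma = solve-∀

open Interval _+_ (+ 0) +-0-isCommutativeMonoid ≈-+ public using () renaming
  ( fold to ∑; fold-cong-≈ to ∑-cong-≈; fold-cong to ∑-cong; fold-split to ∑-split; fold-head to ∑-head
  ; fold-∙ to ∑-+; fold-reverse to ∑-reverse; fold-periodic to ∑-periodic; fold-group to ∑-group)

open Interval _*_ (+ 1) *-1-isCommutativeMonoid ≈-* public using () renaming
  ( fold to ∏; fold-cong-≈ to ∏-cong-≈; fold-cong to ∏-cong; fold-split to ∏-split; fold-head to ∏-head
  ; fold-∙ to ∏-*; fold-reverse to ∏-reverse; fold-periodic to ∏-periodic)

∑-distrib : ∀ a f c L → ∑ (λ x → a * f x) c L ≡ a * ∑ f c L
∑-distrib a f c zero    = sym (*-zeroʳ a)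
∑-distrib a f c (suc L) = trans (cong (λ x → x + a * f (c + + L)) (∑-distrib a f c L))
  (sym (*-distribˡ-+ a (∑ f c L) (f (c + + L))))

∑-zero-≈ : ∀ {q f c} L → (∀ j → j ℕ.< L → f (c + + j) ≈ + 0 [ q ]) → ∑ f c L ≈ + 0 [ q ]
∑-zero-≈ zero    f≈0 = ≈-refl
∑-zero-≈ (suc L) f≈0 = ≈-+ (∑-zero-≈ L λ j j<L → f≈0 j (ℕ.m<n⇒m<1+n j<L)) (f≈0 L (ℕ.n<1+n L))

-- All products of two or more of the terms a f(x) are multiples of a².
∏-1+ : ∀ a f c L → ∏ (λ x → + 1 + a * f x) c L ≈ + 1 + a * ∑ f c L [ a * a ]
∏-1+ a f c zero    = ≈-reflexive (lemma a)
  where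
  lemma : ∀ a → + 1 ≡ + 1 + a * + 0
  lemma = solve-∀
∏-1+ a f c (suc L) = ≈-trans (≈-* (∏-1+ a f c L) ≈-refl) (S * F , lemma a S F)
  where
  S = ∑ f c L
  F = f (c + + L)
  lemma : ∀ a S F → (+ 1 + a * S) * (+ 1 + a * F) ≡ + 1 + a * (S + F) + S * F * (a * a)
  lemma = solve-∀

-- Binomial coefficients with integer entries

-- Pascal's rule splits the coefficient on the left, both halves are covered by the induction
-- hypothesis, and Pascal's rule for n recombines them.
[1+k]*[1+n]C[1+k] : ∀ n k → suc k ℕ.* (suc n C suc k) ≡ suc n ℕ.* (n C k)
[1+k]*[1+n]C[1+k] zero    zero    = refl
[1+k]*[1+n]C[1+k] zero    (suc k) = trans (cong (suc (suc k) ℕ.*_) (k>n⇒nCk≡0 (s≤s (s≤s (z≤n {k})))))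
  (trans (ℕ.*-zeroʳ (suc (suc k))) (sym (cong (ℕ._+ 0) (k>n⇒nCk≡0 (s≤s (z≤n {k}))))))
[1+k]*[1+n]C[1+k] (suc n) zero    = begin
  1 ℕ.* (suc (suc n) C 1)          ≡⟨ cong (1 ℕ.*_) (nCk+nC[k+1]≡[n+1]C[k+1] (suc n) 0) ⟨
  1 ℕ.* (1 ℕ.+ suc n C 1)          ≡⟨ lemma (suc n C 1) ⟩
  1 ℕ.+ 1 ℕ.* (suc n C 1)          ≡⟨ cong suc ([1+k]*[1+n]C[1+k] n 0) ⟩
  1 ℕ.+ suc n ℕ.* 1                ∎
  where
  open ≡-Reasoning
  lemma : ∀ a → 1 ℕ.* (1 ℕ.+ a) ≡ 1 ℕ.+ 1 ℕ.* a
  lemma = ℕ-Solver.solve-∀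
[1+k]*[1+n]C[1+k] (suc n) (suc k) = begin
  (2 ℕ.+ k) ℕ.* (suc (suc n) C suc (suc k))                                      ≡⟨ cong ((2 ℕ.+ k) ℕ.*_) (nCk+nC[k+1]≡[n+1]C[k+1] (suc n) (suc k)) ⟨
  (2 ℕ.+ k) ℕ.* ((suc n C suc k) ℕ.+ (suc n C suc (suc k)))                      ≡⟨ lemma₁ k (suc n C suc k) (suc n C suc (suc k)) ⟩
  (suc n C suc k) ℕ.+ suc k ℕ.* (suc n C suc k) ℕ.+ (2 ℕ.+ k) ℕ.* (suc n C suc (suc k))
    ≡⟨ cong₂ (λ a b → (suc n C suc k) ℕ.+ a ℕ.+ b) ([1+k]*[1+n]C[1+k] n k) ([1+k]*[1+n]C[1+k] n (suc k)) ⟩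
  (suc n C suc k) ℕ.+ suc n ℕ.* (n C k) ℕ.+ suc n ℕ.* (n C suc k)                 ≡⟨ lemma₂ (suc n C suc k) (suc n) (n C k) (n C suc k) ⟩
  (suc n C suc k) ℕ.+ suc n ℕ.* ((n C k) ℕ.+ (n C suc k))                         ≡⟨ cong (λ a → (suc n C suc k) ℕ.+ suc n ℕ.* a) (nCk+nC[k+1]≡[n+1]C[k+1] n k) ⟩
  (2 ℕ.+ n) ℕ.* (suc n C suc k)                                                   ∎
  where
  open ≡-Reasoning
  lemma₁ : ∀ k a b → (2 ℕ.+ k) ℕ.* (a ℕ.+ b) ≡ a ℕ.+ (1 ℕ.+ k) ℕ.* a ℕ.+ (2 ℕ.+ k) ℕ.* b
  lemma₁ = ℕ-Solver.solve-∀
  lemma₂ : ∀ c n a b → c ℕ.+ n ℕ.* a ℕ.+ n ℕ.* b ≡ c ℕ.+ n ℕ.* (a ℕ.+ b)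
  lemma₂ = ℕ-Solver.solve-∀

[m+k]Ck≡[m+k]Cm : ∀ m k → (m ℕ.+ k) C k ≡ (m ℕ.+ k) C m
[m+k]Ck≡[m+k]Cm m k = trans (nCk≡nC[n∸k] (ℕ.m≤n+m k m)) (cong ((m ℕ.+ k) C_) (ℕ.m+n∸n≡m m k))

[-1]^[m+n+n] : ∀ m n → (- + 1) ^ (m ℕ.+ n ℕ.+ n) ≡ (- + 1) ^ m
[-1]^[m+n+n] m n = trans (^-distribˡ-+-* (- + 1) (m ℕ.+ n) n) (trans (cong (_* ((- + 1) ^ n)) (^-distribˡ-+-* (- + 1) m n))
  (trans (*-assoc ((- + 1) ^ m) _ _) (trans (cong (((- + 1) ^ m) *_) (square n)) (*-identityʳ ((- + 1) ^ m)))))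
  where
  square : ∀ n → (- + 1) ^ n * (- + 1) ^ n ≡ + 1
  square zero    = refl
  square (suc n) = trans (lemma ((- + 1) ^ n)) (square n)
    where
    lemma : ∀ a → - + 1 * a * (- + 1 * a) ≡ a * a
    lemma = solve-∀

-- Since this holds in all four sign quadrants of the extended coefficient, it gives, with the
-- symmetry below, the recurrences in both arguments, and it is the source of every divisibility of
-- block terms.
binomℤ-absorb : ∀ n k → k * binomℤ n k ≡ n * binomℤ (n - + 1) (k - + 1)
binomℤ-absorb (+ zero)   (+ zero)   = refl
binomℤ-absorb (+ zero)   (+ suc k)  = trans (cong (λ a → + suc k * + a) (k>n⇒nCk≡0 (s≤s (z≤n {k})))) (*-zeroʳ (+ suc k))
binomℤ-absorb (+ suc n)  (+ zero)   = sym (*-zeroʳ (+ suc n))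
binomℤ-absorb (+ suc n)  (+ suc k)  = trans (sym (pos-* (suc k) (suc n C suc k)))
  (trans (cong +_ ([1+k]*[1+n]C[1+k] n k)) (pos-* (suc n) (n C k)))
binomℤ-absorb (+ zero)   -[1+ k ]   = *-zeroʳ -[1+ k ]
binomℤ-absorb (+ suc n)  -[1+ k ]   = trans (*-zeroʳ -[1+ k ]) (sym (*-zeroʳ (+ suc n)))
-- The lower index k - 1 = -1 lies strictly between n - 1 and 0, where the coefficient vanishes.
binomℤ-absorb -[1+ m ]   (+ zero)   = sym (trans (cong (λ a → -[1+ m ] * ((- + 1) ^ (suc (m ℕ.+ 0)) * + a))
  (k>n⇒nCk≡0 (s≤s (z≤n {m ℕ.+ 0})))) (trans (cong (-[1+ m ] *_) (*-zeroʳ ((- + 1) ^ (suc (m ℕ.+ 0))))) (*-zeroʳ -[1+ m ])))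
binomℤ-absorb -[1+ m ]   (+ suc k)  = begin
  + suc k * (- + 1 * s * + ((m ℕ.+ suc k) C suc k))           ≡⟨ lemma₁ (+ suc k) s (+ ((m ℕ.+ suc k) C suc k)) ⟩
  - s * (+ suc k * + ((m ℕ.+ suc k) C suc k))                 ≡⟨ cong (- s *_) absorb ⟩
  - s * (+ suc m * + ((suc m ℕ.+ k) C k))                     ≡⟨ lemma₂ s (+ suc m) (+ ((suc m ℕ.+ k) C k)) ⟩
  -- The summand 0 appears because `-[1+ m ] - + 1` computes to `-[1+ suc (m ℕ.+ 0) ]`.
  - + suc m * (s * + ((suc m ℕ.+ k) C k))                     ≡⟨ cong (λ a → - + suc m * (s * + ((suc a ℕ.+ k) C k))) (ℕ.+-identityʳ m) ⟨
  - + suc m * (s * + ((suc (m ℕ.+ 0) ℕ.+ k) C k))             ∎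
  where
  open ≡-Reasoning
  s = (- + 1) ^ k
  absorb : + suc k * + ((m ℕ.+ suc k) C suc k) ≡ + suc m * + ((suc m ℕ.+ k) C k)
  absorb = begin
    + suc k * + ((m ℕ.+ suc k) C suc k)        ≡⟨ pos-* (suc k) _ ⟨
    + (suc k ℕ.* ((m ℕ.+ suc k) C suc k))      ≡⟨ cong (λ a → + (suc k ℕ.* (a C suc k))) (ℕ.+-suc m k) ⟩
    + (suc k ℕ.* (suc (m ℕ.+ k) C suc k))      ≡⟨ cong +_ ([1+k]*[1+n]C[1+k] (m ℕ.+ k) k) ⟩
    + (suc (m ℕ.+ k) ℕ.* ((m ℕ.+ k) C k))      ≡⟨ cong (λ a → + (suc (m ℕ.+ k) ℕ.* a)) ([m+k]Ck≡[m+k]Cm m k) ⟩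
    + (suc (m ℕ.+ k) ℕ.* ((m ℕ.+ k) C m))      ≡⟨ cong +_ ([1+k]*[1+n]C[1+k] (m ℕ.+ k) m) ⟨
    + (suc m ℕ.* (suc (m ℕ.+ k) C suc m))      ≡⟨ cong (λ a → + (suc m ℕ.* a)) ([m+k]Ck≡[m+k]Cm (suc m) k) ⟨
    + (suc m ℕ.* ((suc m ℕ.+ k) C k))          ≡⟨ pos-* (suc m) _ ⟩
    + suc m * + ((suc m ℕ.+ k) C k)            ∎
  lemma₁ : ∀ a s b → a * (- + 1 * s * b) ≡ - s * (a * b)
  lemma₁ = solve-∀
  lemma₂ : ∀ s a b → - s * (a * b) ≡ - a * (s * b)
  lemma₂ = solve-∀
binomℤ-absorb -[1+ m ]   -[1+ j ]   = begin
  - + suc j * (s * + (j C m))                                                     ≡⟨ lemma (+ suc j) s (+ (j C m)) ⟩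
  - s * (+ suc j * + (j C m))                                                     ≡⟨ cong (- s *_) (sym (trans (sym (pos-* (suc m) _)) (trans (cong +_ ([1+k]*[1+n]C[1+k] j m)) (pos-* (suc j) _)))) ⟩
  - s * (+ suc m * + (suc j C suc m))                                             ≡⟨ lemma (+ suc m) s (+ (suc j C suc m)) ⟨
  - + suc m * (s * + (suc j C suc m))                                             ≡⟨ cong (λ a → - + suc m * (a * + (suc j C suc m))) (sym s′≡s) ⟩
  - + suc m * ((- + 1) ^ (suc j ℕ.+ suc m) * + (suc j C suc m))                   ≡⟨ cong₂ (λ a b → - + suc m * ((- + 1) ^ (suc a ℕ.+ suc b) * + (suc a C suc b))) (ℕ.+-identityʳ j) (ℕ.+-identityʳ m) ⟨
  - + suc m * ((- + 1) ^ (suc (j ℕ.+ 0) ℕ.+ suc (m ℕ.+ 0)) * + (suc (j ℕ.+ 0) C suc (m ℕ.+ 0)))  ∎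
  where
  open ≡-Reasoning
  s = (- + 1) ^ (j ℕ.+ m)
  s′≡s : (- + 1) ^ (suc j ℕ.+ suc m) ≡ s
  s′≡s = trans (cong ((- + 1) ^_) (lemma′ j m)) ([-1]^[m+n+n] (j ℕ.+ m) 1)
    where
    lemma′ : ∀ j m → suc j ℕ.+ suc m ≡ j ℕ.+ m ℕ.+ 1 ℕ.+ 1
    lemma′ = ℕ-Solver.solve-∀
  lemma : ∀ a s b → - a * (s * b) ≡ - s * (a * b)
  lemma = solve-∀

-- For n < 0 the reflection exchanges the ranges k ≥ 0 and k ≤ n, on which the coefficient is given
-- by different formulas, and preserves the gap n < k < 0, on which it is zero.
binomℤ-sym : ∀ n k → binomℤ n k ≡ binomℤ n (n - k)
binomℤ-sym (+ n) (+ k) with k ℕ.≤? n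
... | yes k≤n = trans (cong +_ (nCk≡nC[n∸k] k≤n)) (cong (binomℤ (+ n)) (sym (trans (m-n≡m⊖n n k) (⊖-≥ k≤n))))
... | no  k≰n with d , refl ← ℕ.m≤n⇒∃[o]m+o≡n (ℕ.≰⇒> k≰n) =
  trans (cong +_ (k>n⇒nCk≡0 (ℕ.≰⇒> k≰n))) (cong (binomℤ (+ n)) (sym (lemma (+ n) (+ d))))
  where
  lemma : ∀ n d → n - (+ 1 + (n + d)) ≡ - (+ 1 + d)
  lemma = solve-∀
binomℤ-sym (+ n) -[1+ j ] = cong +_ (sym (k>n⇒nCk≡0 (ℕ.m<m+n n (s≤s z≤n))))
binomℤ-sym -[1+ m ] (+ k) = trans (cong₂ _*_ (sym sign) (cong +_ ([m+k]Ck≡[m+k]Cm m k))) (cong (binomℤ -[1+ m ]) (sym (lemma (+ m) (+ k))))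
  where
  sign : (- + 1) ^ (m ℕ.+ k ℕ.+ m) ≡ (- + 1) ^ k
  sign = trans (cong (λ a → (- + 1) ^ (a ℕ.+ m)) (ℕ.+-comm m k)) ([-1]^[m+n+n] k m)
  lemma : ∀ m k → - (+ 1 + m) - k ≡ - (+ 1 + (m + k))
  lemma = solve-∀
binomℤ-sym -[1+ m ] -[1+ j ] with m ℕ.≤? j
... | yes m≤j with d , refl ← ℕ.m≤n⇒∃[o]m+o≡n m≤j =
  trans (cong₂ _*_ sign (cong +_ (sym ([m+k]Ck≡[m+k]Cm m d)))) (cong (binomℤ -[1+ m ]) (sym (lemma (+ m) (+ d))))
  where
  sign : (- + 1) ^ (m ℕ.+ d ℕ.+ m) ≡ (- + 1) ^ d
  sign = trans (cong (λ a → (- + 1) ^ (a ℕ.+ m)) (ℕ.+-comm m d)) ([-1]^[m+n+n] d m)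
  lemma : ∀ m d → - (+ 1 + m) - - (+ 1 + (m + d)) ≡ d
  lemma = solve-∀
... | no  m≰j with d , refl ← ℕ.m≤n⇒∃[o]m+o≡n (ℕ.≰⇒> m≰j) =
  trans (vanish ((- + 1) ^ (j ℕ.+ suc (j ℕ.+ d))) j (s≤s (ℕ.m≤m+n j d)))
    (trans (sym (vanish ((- + 1) ^ (d ℕ.+ suc (j ℕ.+ d))) d (s≤s (ℕ.m≤n+m d j)))) (cong (binomℤ -[1+ suc (j ℕ.+ d) ]) (sym (lemma (+ j) (+ d)))))
  where
  vanish : ∀ s i → i ℕ.< suc (j ℕ.+ d) → s * + (i C suc (j ℕ.+ d)) ≡ + 0
  vanish s i i< = trans (cong (λ a → s * + a) (k>n⇒nCk≡0 i<)) (*-zeroʳ s)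
  lemma : ∀ j d → - (+ 1 + (+ 1 + (j + d))) - - (+ 1 + j) ≡ - (+ 1 + d)
  lemma = solve-∀

binomℤ-+-sym : ∀ a b → binomℤ (a + b) a ≡ binomℤ (a + b) b
binomℤ-+-sym a b = trans (binomℤ-sym (a + b) a) (cong (binomℤ (a + b)) (lemma a b))
  where
  lemma : ∀ a b → a + b - a ≡ b
  lemma = solve-∀

binomℤ-absorb′ : ∀ n k → (n - k) * binomℤ n k ≡ n * binomℤ (n - + 1) k
binomℤ-absorb′ n k = begin
  (n - k) * binomℤ n k                              ≡⟨ cong ((n - k) *_) (binomℤ-sym n k) ⟩
  (n - k) * binomℤ n (n - k)                        ≡⟨ binomℤ-absorb n (n - k) ⟩
  n * binomℤ (n - + 1) (n - k - + 1)                ≡⟨ cong (λ a → n * binomℤ (n - + 1) a) (lemma n k) ⟩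
  n * binomℤ (n - + 1) (n - + 1 - k)                ≡⟨ cong (n *_) (binomℤ-sym (n - + 1) k) ⟨
  n * binomℤ (n - + 1) k                            ∎
  where
  open ≡-Reasoning
  lemma : ∀ n k → n - k - + 1 ≡ n - + 1 - k
  lemma = solve-∀

binomℤ-step : ∀ n k → (+ 1 + k) * binomℤ n (+ 1 + k) ≡ (n - k) * binomℤ n k
binomℤ-step n k = begin
  (+ 1 + k) * binomℤ n (+ 1 + k)                     ≡⟨ binomℤ-absorb n (+ 1 + k) ⟩
  n * binomℤ (n - + 1) (+ 1 + k - + 1)               ≡⟨ cong (λ a → n * binomℤ (n - + 1) a) (lemma k) ⟩
  n * binomℤ (n - + 1) k                             ≡⟨ binomℤ-absorb′ n k ⟨
  (n - k) * binomℤ n k                               ∎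
  where
  open ≡-Reasoning
  lemma : ∀ k → + 1 + k - + 1 ≡ k
  lemma = solve-∀

rising : ℤ → ℕ → ℤ
rising b a = ∏ (λ x → x) (+ 1 + b) a

-- The product formula is uniform in the sign of b, so it turns identities between coefficients with
-- one nonnegative entry into identities between products of consecutive integers.
binomℤ-rising : ∀ b a → binomℤ (+ a + b) (+ a) * + (a !) ≡ rising b a
binomℤ-rising b zero    = trans (*-identityʳ (binomℤ (+ 0 + b) (+ 0))) (binomℤ-0 (+ 0 + b))
  where
  binomℤ-0 : ∀ n → binomℤ n (+ 0) ≡ + 1
  binomℤ-0 (+ n)    = refl
  binomℤ-0 -[1+ n ] = refl
binomℤ-rising b (suc a) = begin
  binomℤ n (+ suc a) * + (suc a ℕ.* a !)                    ≡⟨ cong (binomℤ n (+ suc a) *_) (pos-* (suc a) (a !)) ⟩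
  binomℤ n (+ suc a) * (+ suc a * + (a !))                  ≡⟨ lemma₁ (binomℤ n (+ suc a)) (+ suc a) (+ (a !)) ⟩
  + suc a * binomℤ n (+ suc a) * + (a !)                    ≡⟨ cong (_* + (a !)) (binomℤ-absorb n (+ suc a)) ⟩
  n * binomℤ (n - + 1) (+ suc a - + 1) * + (a !)            ≡⟨ cong₂ (λ m k → n * binomℤ m k * + (a !)) (lemma₂ (+ a) b) (lemma₃ (+ a)) ⟩
  n * binomℤ (+ a + b) (+ a) * + (a !)                      ≡⟨ *-assoc n _ _ ⟩
  n * (binomℤ (+ a + b) (+ a) * + (a !))                    ≡⟨ cong (n *_) (binomℤ-rising b a) ⟩
  n * rising b a                                            ≡⟨ *-comm n (rising b a) ⟩
  rising b a * n                                            ≡⟨ cong (rising b a *_) (lemma₄ (+ a) b) ⟩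
  rising b a * (+ 1 + b + + a)                              ∎
  where
  open ≡-Reasoning
  n = + suc a + b
  lemma₁ : ∀ x y z → x * (y * z) ≡ y * x * z
  lemma₁ = solve-∀
  lemma₂ : ∀ a b → + 1 + a + b - + 1 ≡ a + b
  lemma₂ = solve-∀
  lemma₃ : ∀ a → + 1 + a - + 1 ≡ a
  lemma₃ = solve-∀
  lemma₄ : ∀ a b → + 1 + a + b ≡ + 1 + b + a
  lemma₄ = solve-∀

-- In terms of the Γ function: both factors 1/Γ of the denominator have a zero, and the numerator
-- has only a simple pole.
binomℤ-neg-neg : ∀ a b → a < + 0 → b < + 0 → binomℤ (a + b) a ≡ + 0
binomℤ-neg-neg -[1+ a ] -[1+ b ] _ _ = trans (cong (λ c → (- + 1) ^ (a ℕ.+ suc (a ℕ.+ b)) * + c)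
  (k>n⇒nCk≡0 (s≤s (ℕ.m≤m+n a b)))) (*-zeroʳ ((- + 1) ^ (a ℕ.+ suc (a ℕ.+ b))))
binomℤ-neg-neg (+ _)    _     (_<_.+<+ ()) _
binomℤ-neg-neg -[1+ _ ] (+ _) _ (_<_.+<+ ())

binomℤ-pos-neg : ∀ n k → + 0 ≤ n → k < + 0 → binomℤ n k ≡ + 0
binomℤ-pos-neg (+ n) -[1+ k ] _ _ = refl
binomℤ-pos-neg (+ n) (+ _)    _ (_<_.+<+ ())

rising-split : ∀ n c k → rising n (c ℕ.+ k) ≡ rising n c * rising (n + + c) k
rising-split n c k = trans (∏-split (λ x → x) (+ 1 + n) c k)
  (cong (λ a → rising n c * ∏ (λ x → x) a k) (+-assoc (+ 1) n (+ c)))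

!≡rising : ∀ a → + (a !) ≡ rising (+ 0) a
!≡rising zero    = refl
!≡rising (suc a) = trans (pos-* (suc a) (a !)) (trans (*-comm (+ suc a) (+ (a !))) (cong (_* + suc a) (!≡rising a)))

-- The value of `multinomial` on three entries, without its trailing factor 1.
trinomial : ℤ → ℤ → ℤ → ℤ
trinomial a b c = binomℤ (a + b) b * binomℤ (a + b + c) c

trinomial-zero₁ : ∀ a b c → a < + 0 → b < + 0 → trinomial a b c ≡ + 0
trinomial-zero₁ a b c a<0 b<0 = cong (_* binomℤ (a + b + c) c) (trans (sym (binomℤ-+-sym a b)) (binomℤ-neg-neg a b a<0 b<0))

private
  -- Prepares the rotation of entries. For nonnegative c and k and an arbitrary n, this lemma and
  -- its two companions find the same product (n + 1)⋯(n + c + k) for each position of n, and the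
  -- factorials cancel.
  trinomial-++ : ∀ n c k → trinomial n (+ c) (+ k) * (+ (c !) * + (k !)) ≡ rising n (c ℕ.+ k)
  trinomial-++ n c k = begin
    trinomial n (+ c) (+ k) * (+ (c !) * + (k !))                                       ≡⟨ lemma (binomℤ (n + + c) (+ c)) (binomℤ (n + + c + + k) (+ k)) (+ (c !)) (+ (k !)) ⟩
    binomℤ (n + + c) (+ c) * + (c !) * (binomℤ (n + + c + + k) (+ k) * + (k !))         ≡⟨ cong₂ (λ x y → binomℤ x (+ c) * + (c !) * (binomℤ y (+ k) * + (k !))) (+-comm n (+ c)) (+-comm (n + + c) (+ k)) ⟩
    binomℤ (+ c + n) (+ c) * + (c !) * (binomℤ (+ k + (n + + c)) (+ k) * + (k !))       ≡⟨ cong₂ _*_ (binomℤ-rising n c) (binomℤ-rising (n + + c) k) ⟩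
    rising n c * rising (n + + c) k                                                     ≡⟨ rising-split n c k ⟨
    rising n (c ℕ.+ k)                                                                  ∎
    where
    open ≡-Reasoning
    lemma : ∀ a b c d → a * b * (c * d) ≡ a * c * (b * d)
    lemma = solve-∀

  trinomial-++* : ∀ n c k → trinomial (+ c) (+ k) n * (+ (c !) * + (k !)) ≡ rising n (c ℕ.+ k)
  trinomial-++* n c k = begin
    trinomial (+ c) (+ k) n * (+ (c !) * + (k !))                                       ≡⟨ cong₂ (λ x y → binomℤ x (+ k) * y * (+ (c !) * + (k !))) (+-comm (+ c) (+ k)) (sym (binomℤ-+-sym (+ (c ℕ.+ k)) n)) ⟩
    binomℤ (+ k + + c) (+ k) * binomℤ (+ (c ℕ.+ k) + n) (+ (c ℕ.+ k)) * (+ (c !) * + (k !))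
      ≡⟨ lemma (binomℤ (+ k + + c) (+ k)) (binomℤ (+ (c ℕ.+ k) + n) (+ (c ℕ.+ k))) (+ (c !)) (+ (k !)) ⟩
    binomℤ (+ (c ℕ.+ k) + n) (+ (c ℕ.+ k)) * (+ (c !) * (binomℤ (+ k + + c) (+ k) * + (k !))) ≡⟨ cong (binomℤ (+ (c ℕ.+ k) + n) (+ (c ℕ.+ k)) *_) [c+k]! ⟩
    binomℤ (+ (c ℕ.+ k) + n) (+ (c ℕ.+ k)) * + ((c ℕ.+ k) !)                            ≡⟨ binomℤ-rising n (c ℕ.+ k) ⟩
    rising n (c ℕ.+ k)                                                                  ∎
    where
    open ≡-Reasoning
    lemma : ∀ a b c d → a * b * (c * d) ≡ b * (c * (a * d))
    lemma = solve-∀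
    [c+k]! : + (c !) * (binomℤ (+ k + + c) (+ k) * + (k !)) ≡ + ((c ℕ.+ k) !)
    [c+k]! = trans (cong₂ _*_ (!≡rising c) (binomℤ-rising (+ c) k)) (trans (sym (rising-split (+ 0) c k)) (sym (!≡rising (c ℕ.+ k))))

  trinomial-+*+ : ∀ n c k → trinomial (+ c) n (+ k) * (+ (c !) * + (k !)) ≡ rising n (c ℕ.+ k)
  trinomial-+*+ n c k = trans (cong₂ (λ x y → x * y * (+ (c !) * + (k !)))
    (trans (sym (binomℤ-+-sym (+ c) n)) (cong (λ a → binomℤ a (+ c)) (+-comm (+ c) n)))
    (cong (λ a → binomℤ (a + + k) (+ k)) (+-comm (+ c) n))) (trinomial-++ n c k)

  cancel-!! : ∀ c k {x y} → x * (+ (c !) * + (k !)) ≡ y * (+ (c !) * + (k !)) → x ≡ y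
  cancel-!! c k {x} {y} = *-cancelʳ-≡ x y (+ (c !) * + (k !))
    where instance
      _ = ℕ._!≢0 c
      _ = ℕ._!≢0 k
      _ = i*j≢0 (+ (c !)) (+ (k !))

  -- Covers a negative c next to a negative a or b. Either a + b is nonnegative over a negative
  -- entry, and the first factor vanishes, or a + b and c are both negative, and the second one
  -- does.
  trinomial-zero₂ : ∀ a b c → (binomℤ (a + b) b ≡ + 0 ⊎ a + b < + 0) → c < + 0 → trinomial a b c ≡ + 0
  trinomial-zero₂ a b c (inj₁ z) c<0 = cong (_* binomℤ (a + b + c) c) z
  trinomial-zero₂ a b c (inj₂ a+b<0) c<0 =
    trans (cong (binomℤ (a + b) b *_) (trans (sym (binomℤ-+-sym (a + b) c)) (binomℤ-neg-neg (a + b) c a+b<0 c<0))) (*-zeroʳ (binomℤ (a + b) b))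

  zero⊎neg : ∀ a b → b < + 0 → binomℤ (a + b) b ≡ + 0 ⊎ a + b < + 0
  zero⊎neg a b b<0 with + 0 ≤? a + b
  ... | yes 0≤a+b = inj₁ (binomℤ-pos-neg (a + b) b 0≤a+b b<0)
  ... | no  0≰a+b = inj₂ (≰⇒> 0≰a+b)

  zero⊎neg′ : ∀ a b → a < + 0 → binomℤ (a + b) b ≡ + 0 ⊎ a + b < + 0
  zero⊎neg′ a b a<0 with zero⊎neg b a a<0
  ... | inj₁ z     = inj₁ (trans (sym (binomℤ-+-sym a b)) (trans (cong (λ c → binomℤ c a) (+-comm a b)) z))
  ... | inj₂ b+a<0 = inj₂ (subst (_< + 0) (+-comm b a) b+a<0)

-- The iterated product of binomial coefficients hides the symmetry of its entries. Two nonnegative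
-- entries reduce both sides to the same product of consecutive integers; two negative ones make
-- both sides zero.
trinomial-cyclic : ∀ a b c → trinomial a b c ≡ trinomial b c a
trinomial-cyclic a (+ b) (+ c)             = cancel-!! b c (trans (trinomial-++ a b c) (sym (trinomial-++* a b c)))
trinomial-cyclic (+ a) (+ b) c@(-[1+ _ ])  = cancel-!! a b (trans (trinomial-++* c a b) (sym (trans
  (cong (trinomial (+ b) c (+ a) *_) (*-comm (+ (a !)) (+ (b !)))) (trans (trinomial-+*+ c b a) (cong (rising c) (ℕ.+-comm b a))))))
trinomial-cyclic (+ a) b@(-[1+ _ ]) (+ c)  = cancel-!! a c (trans (trinomial-+*+ b a c) (sym (trans
  (cong (trinomial b (+ c) (+ a) *_) (*-comm (+ (a !)) (+ (c !)))) (trans (trinomial-++ b c a) (cong (rising b) (ℕ.+-comm c a))))))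
trinomial-cyclic -[1+ a ] -[1+ b ] c       = trans (trinomial-zero₁ -[1+ a ] -[1+ b ] c -<+ -<+) (sym (trinomial-zero₂ -[1+ b ] c -[1+ a ] (zero⊎neg′ -[1+ b ] c -<+) -<+))
trinomial-cyclic -[1+ a ] b@(+ _) -[1+ c ] = trans (trinomial-zero₂ -[1+ a ] b -[1+ c ] (zero⊎neg′ -[1+ a ] b -<+) -<+) (sym (trinomial-zero₂ b -[1+ c ] -[1+ a ] (zero⊎neg b -[1+ c ] -<+) -<+))
trinomial-cyclic a@(+ _) -[1+ b ] -[1+ c ] = trans (trinomial-zero₂ a -[1+ b ] -[1+ c ] (zero⊎neg a -[1+ b ] -<+) -<+) (sym (trinomial-zero₁ -[1+ b ] -[1+ c ] a -<+ -<+))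

-- Multinomial coefficients of a block

∣k*binomℤ : ∀ {c x} k → c ∣ x → c ∣ k * binomℤ x k
∣k*binomℤ {c} {x} k c∣x = subst (c ∣_) (sym (binomℤ-absorb x k)) (∣m⇒∣m*n (binomℤ (x - + 1) (k - + 1)) c∣x)

i-j+j≡i : ∀ i j → i - j + j ≡ i
i-j+j≡i = solve-∀

-- The last entry x of the block and k contribute a factor binomℤ x k.
∣k*multinomialGo : ∀ {c} k acc x xs → All (c ∣_) (x ∷ xs) →
                   c ∣ k * multinomialGo acc (map (λ x → x - k) (x ∷ xs) ++ [ k ])
∣k*multinomialGo {c} k acc x [] (c∣x ∷ []) = subst (c ∣_) (sym (begin
  k * (binomℤ (acc + (x - k)) (x - k) * (binomℤ (acc + (x - k) + k) k * + 1))      ≡⟨ cong (λ z → k * (binomℤ (acc + (x - k)) (x - k) * z)) (*-identityʳ _) ⟩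
  k * trinomial acc (x - k) k                                                      ≡⟨ cong (k *_) (trinomial-cyclic acc (x - k) k) ⟩
  k * (binomℤ (x - k + k) k * binomℤ (x - k + k + acc) acc)                        ≡⟨ *-assoc k _ _ ⟨
  k * binomℤ (x - k + k) k * binomℤ (x - k + k + acc) acc                          ∎))
  (∣m⇒∣m*n (binomℤ (x - k + k + acc) acc) (∣k*binomℤ k (subst (c ∣_) (sym (i-j+j≡i x k)) c∣x)))
  where open ≡-Reasoning
∣k*multinomialGo {c} k acc x (y ∷ ys) (_ ∷ c∣ys) = subst (c ∣_) (lemma k (binomℤ (acc + (x - k)) (x - k)) _)
  (∣n⇒∣m*n (binomℤ (acc + (x - k)) (x - k)) (∣k*multinomialGo k (acc + (x - k)) y ys c∣ys))
  where
  lemma : ∀ k b m → b * (k * m) ≡ k * (b * m)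
  lemma = solve-∀

∣k*blockTerm : ∀ {c} k x xs → All (c ∣_) (x ∷ xs) → c ∣ k * blockTerm k (x ∷ xs)
∣k*blockTerm {c} k x []       (c∣x ∷ []) = subst (λ z → c ∣ k * z) (sym (*-identityʳ _)) (∣k*binomℤ k (subst (c ∣_) (sym (i-j+j≡i x k)) c∣x))
∣k*blockTerm     k x (y ∷ ys) (_ ∷ c∣ys) = ∣k*multinomialGo k (x - k) y ys c∣ys

pos-^ : ∀ m n → + (m ℕ.^ n) ≡ (+ m) ^ n
pos-^ m zero    = refl
pos-^ m (suc n) = trans (pos-* m (m ℕ.^ n)) (cong (+ m *_) (pos-^ m n))

∣-+ʳ : ∀ {q x y} → q ∣ x → q ∣ x + y → q ∣ y
∣-+ʳ q∣x q∣x+y = ∣m+n∣m⇒∣n q∣x+y q∣x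

≈-mod-1 : ∀ {x y q} → x ≈ y [ q ^ 0 ]
≈-mod-1 {x} {y} = x - y , lemma x y
  where
  lemma : ∀ x y → x ≡ y + (x - y) * + 1
  lemma = solve-∀

≈-mod-* : ∀ {d q r x y} → q ∣ d → x ≈ y [ r ] → d * x ≈ d * y [ q * r ]
≈-mod-* {q = q} {r} {y = y} (divides j refl) (k , refl) = j * k , lemma j q y k r
  where
  lemma : ∀ j q y k r → j * q * (y + k * r) ≡ j * q * y + j * k * (q * r)
  lemma = solve-∀

-- Products and sums over the integers prime to p

module PrimeToP (p : ℕ) (p-prime : Prime p) where

  open Units p p-prime public

  P∣P^ : ∀ {s} → 1 ℕ.≤ s → P ∣ P ^ s
  P∣P^ = ^-∣-base P

  unit-cancel-P∣ : ∀ {u x} → Unit u → P ∣ u * x → P ∣ x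
  unit-cancel-P∣ {u} {x} u-unit P∣ux = subst (_∣ x) (*-identityʳ P)
    (unit-cancel-∣ 1 u-unit (subst (_∣ u * x) (sym (*-identityʳ P)) P∣ux))

  -- Multiples of `P` are replaced by 1, so that a product over the integers prime to p can run over
  -- a whole interval.
  φ : ℤ → ℤ
  φ x with P ∣? x
  ... | yes _ = + 1
  ... | no  _ = x

  φ-∣ : ∀ {x} → P ∣ x → φ x ≡ + 1
  φ-∣ {x} P∣x with P ∣? x
  ... | yes _   = refl
  ... | no  P∤x = contradiction P∣x P∤x

  φ-∤ : ∀ {x} → ¬ P ∣ x → φ x ≡ x
  φ-∤ {x} P∤x with P ∣? x
  ... | yes P∣x = contradiction P∣x P∤x
  ... | no  _   = refl

  φ-unit : ∀ x → Unit (φ x)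
  φ-unit x with P ∣? x
  ... | yes _   = unit-1
  ... | no  P∤x = P∤⇒unit P∤x

  φ-cong-≈ : ∀ {q x y} → P ∣ q → x ≈ y [ q ] → φ x ≈ φ y [ q ]
  φ-cong-≈ {x = x} {y} P∣q x≈y with P ∣? x | P ∣? y
  ... | yes _   | yes _   = ≈-refl
  ... | yes P∣x | no  P∤y = contradiction (∣-resp-≈ (≈-weaken P∣q (≈-sym x≈y)) P∣x) P∤y
  ... | no  P∤x | yes P∣y = contradiction (∣-resp-≈ (≈-weaken P∣q x≈y) P∣y) P∤x
  ... | no  _   | no  _   = x≈y

  ∏-unit : ∀ {f} c L → (∀ x → Unit (f x)) → Unit (∏ f c L)
  ∏-unit c zero    f-unit = unit-1
  ∏-unit c (suc L) f-unit = unit-* (∏-unit c L f-unit) (f-unit (c + + L))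

  H : ℤ → ℕ → ℤ
  H b a = ∏ φ (+ 1 + b) a

  H-unit : ∀ b a → Unit (H b a)
  H-unit b a = ∏-unit (+ 1 + b) a φ-unit

  -- Both ends of the interval contribute 1. The reflection used for the pairing turns (b , b + L]
  -- into [b , b + L), and this returns to the former.
  ∏φ-shift : ∀ b L → P ∣ b → P ∣ b + + L → H b L ≡ ∏ φ b L
  ∏φ-shift b L P∣b P∣b+L = begin
    H b L                      ≡⟨ *-identityˡ (H b L) ⟨
    + 1 * H b L                ≡⟨ cong (_* H b L) (φ-∣ P∣b) ⟨
    φ b * H b L                ≡⟨ ∏-head φ b L ⟨
    ∏ φ b L * φ (b + + L)      ≡⟨ cong (∏ φ b L *_) (φ-∣ P∣b+L) ⟩
    ∏ φ b L * + 1              ≡⟨ *-identityʳ (∏ φ b L) ⟩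
    ∏ φ b L                    ∎
    where open ≡-Reasoning

  paired : ℤ → ℤ → ℤ → ℤ
  paired b a y = φ (b + y) * φ (b + a - y)

  private
    H-from-1 : ∀ b L → H b L ≡ ∏ (λ y → φ (b + y)) (+ 1) L
    H-from-1 b L = ∏-cong L λ j _ → cong φ (lemma b (+ j))
      where
      lemma : ∀ b j → + 1 + b + j ≡ b + (+ 1 + j)
      lemma = solve-∀

    H-reversed : ∀ b L → P ∣ b → P ∣ b + + L → H b L ≡ ∏ (λ y → φ (b + + L - y)) (+ 1) L
    H-reversed b L P∣b P∣b+L = trans (∏φ-shift b L P∣b P∣b+L) (trans (∏-reverse φ b (+ 1) L)
      (∏-cong {c = + 1} {d = + 1} L λ j _ → cong φ (lemma b (+ L) (+ 1 + + j))))
      where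
      lemma : ∀ b L x → b + + 1 + L - + 1 - x ≡ b + L - x
      lemma = solve-∀

  H*H≡∏paired : ∀ b a → P ∣ b → P ∣ + a → H b a * H b a ≡ ∏ (paired b (+ a)) (+ 1) a
  H*H≡∏paired b a P∣b P∣a = trans (cong₂ _*_ (H-from-1 b a) (H-reversed b a P∣b (∣m∣n⇒∣m+n P∣b P∣a)))
    (sym (∏-* (λ y → φ (b + y)) (λ y → φ (b + + a - y)) (+ 1) a))

  -- If half the length is still a multiple of p, the two halves of the interval can be paired with
  -- each other. This gives `H` itself instead of its square and avoids the square root, which loses
  -- precision at p = 2.
  H≡∏paired-half : ∀ b h → P ∣ b → P ∣ + h → H b (h ℕ.+ h) ≡ ∏ (paired b (+ (h ℕ.+ h))) (+ 1) h
  H≡∏paired-half b h P∣b P∣h = begin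
    H b (h ℕ.+ h)                                                                  ≡⟨ ∏-split φ (+ 1 + b) h h ⟩
    H b h * ∏ φ (+ 1 + b + + h) h                                                  ≡⟨ cong (λ c → H b h * ∏ φ c h) (+-assoc (+ 1) b (+ h)) ⟩
    H b h * H (b + + h) h                                                          ≡⟨ cong₂ _*_ (H-from-1 b h) (trans (H-reversed (b + + h) h P∣b+h (∣m∣n⇒∣m+n P∣b+h P∣h))
                                                                                      (∏-cong {c = + 1} {d = + 1} h λ j _ → cong (λ c → φ (c - (+ 1 + + j))) (+-assoc b (+ h) (+ h)))) ⟩
    ∏ (λ y → φ (b + y)) (+ 1) h * ∏ (λ y → φ (b + + (h ℕ.+ h) - y)) (+ 1) h         ≡⟨ ∏-* (λ y → φ (b + y)) (λ y → φ (b + + (h ℕ.+ h) - y)) (+ 1) h ⟨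
    ∏ (paired b (+ (h ℕ.+ h))) (+ 1) h                                             ∎
    where
    open ≡-Reasoning
    P∣b+h = ∣m∣n⇒∣m+n P∣b P∣h

  private
    paired-∣ : ∀ {b a y} → P ∣ b → P ∣ a → P ∣ y → paired b a y ≡ + 1
    paired-∣ P∣b P∣a P∣y = cong₂ _*_ (φ-∣ (∣m∣n⇒∣m+n P∣b P∣y)) (φ-∣ (∣m∣n⇒∣m+n (∣m∣n⇒∣m+n P∣b P∣a) (∣m⇒∣-m P∣y)))

    P∤b-y : ∀ {b y} → P ∣ b → ¬ P ∣ y → ¬ P ∣ b - y
    P∤b-y {b} {y} P∣b P∤y P∣b-y = P∤y (subst (P ∣_) (lemma b y) (∣m∣n⇒∣m-n P∣b P∣b-y))
      where
      lemma : ∀ b y → b - (b - y) ≡ y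
      lemma = solve-∀

    paired-∤ : ∀ {b a y} → P ∣ b → P ∣ a → ¬ P ∣ y → paired b a y ≡ (b + y) * (b + a - y)
    paired-∤ P∣b P∣a P∤y = cong₂ _*_ (φ-∤ (P∤y ∘ ∣-+ʳ P∣b)) (φ-∤ (P∤b-y (∣m∣n⇒∣m+n P∣b P∣a) P∤y))

    -- Hence paired b a y depends on b only through b (a + b).
    [b+y]*[b+a-y] : ∀ b a y → (b + y) * (b + a - y) ≡ (+ 0 + y) * (+ 0 + a - y) + b * (a + b)
    [b+y]*[b+a-y] = solve-∀

  paired-≈ : ∀ {q b a} → P ∣ b → P ∣ a → q ∣ b * (a + b) → ∀ y → paired b a y ≈ paired (+ 0) a y [ q ]
  paired-≈ {q} {b} {a} P∣b P∣a q∣D y = cases (P ∣? y)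
    where
    cases : Dec (P ∣ y) → paired b a y ≈ paired (+ 0) a y [ q ]
    cases (yes P∣y) = ≈-reflexive (trans (paired-∣ P∣b P∣a P∣y) (sym (paired-∣ x∣0 P∣a P∣y)))
    cases (no  P∤y) = ≈-trans (≈-reflexive (trans (paired-∤ P∣b P∣a P∤y) ([b+y]*[b+a-y] b a y)))
      (≈-trans (≈-+ˡ ((+ 0 + y) * (+ 0 + a - y)) (∣⇒≈0 q∣D)) (≈-reflexive (trans (+-identityʳ _) (sym (paired-∤ x∣0 P∣a P∤y)))))

  H-cong-P : ∀ {q b c} a → P ∣ q → b ≈ c [ q ] → H b a ≈ H c a [ q ]
  H-cong-P {b = b} {c} a P∣q b≈c = ∏-cong-≈ {c = + 1 + b} {d = + 1 + c} a λ j _ → φ-cong-≈ P∣q (≈-+ʳ (+ j) (≈-+ˡ (+ 1) b≈c))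

  -- Since x + y ≡ 2y is a unit modulo `P`, it cancels from x² - y² = (x + y)(x - y).
  square-cancel : ∀ {x y} t → Unit (+ 2) → Unit y → x ≈ y [ P ] → x * x ≈ y * y [ P ^ t ] → x ≈ y [ P ^ t ]
  square-cancel {x} {y} t 2-unit y-unit x≈y xx≈yy =
    ∣⇒≈ (unit-cancel-∣ t (unit-resp-≈ x+y≈2y (unit-* 2-unit y-unit)) (subst (P ^ t ∣_) (lemma x y) (≈⇒∣ xx≈yy)))
    where
    lemma : ∀ x y → x * x - y * y ≡ (x + y) * (x - y)
    lemma = solve-∀
    lemma′ : ∀ y → y + y ≡ + 2 * y
    lemma′ = solve-∀
    x+y≈2y : x + y ≈ + 2 * y [ P ]
    x+y≈2y = ≈-trans (≈-+ʳ y x≈y) (≈-reflexive (lemma′ y))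

  H≈H0-square : ∀ {b} a t → Unit (+ 2) → P ∣ b → H b a * H b a ≈ H (+ 0) a * H (+ 0) a [ P ^ t ] → H b a ≈ H (+ 0) a [ P ^ t ]
  H≈H0-square a t 2-unit P∣b = square-cancel t 2-unit (H-unit (+ 0) a) (H-cong-P a (∣-refl) (∣⇒≈0 P∣b))

  H≈H0-odd : ∀ {b} a t → Unit (+ 2) → P ∣ b → P ∣ + a → P ^ t ∣ b * (+ a + b) → H b a ≈ H (+ 0) a [ P ^ t ]
  H≈H0-odd {b} a t 2-unit P∣b P∣a P^t∣D = H≈H0-square a t 2-unit P∣b
    (≈-trans (≈-reflexive (H*H≡∏paired b a P∣b P∣a))
    (≈-trans (∏-cong-≈ {c = + 1} {d = + 1} a λ j _ → paired-≈ P∣b P∣a P^t∣D (+ 1 + + j))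
    (≈-reflexive (sym (H*H≡∏paired (+ 0) a x∣0 P∣a)))))

  H≈H0-half : ∀ {q b} h → P ∣ b → P ∣ + h → q ∣ b * (+ (h ℕ.+ h) + b) → H b (h ℕ.+ h) ≈ H (+ 0) (h ℕ.+ h) [ q ]
  H≈H0-half {q} {b} h P∣b P∣h q∣D =
    ≈-trans (≈-reflexive (H≡∏paired-half b h P∣b P∣h))
    (≈-trans (∏-cong-≈ {c = + 1} {d = + 1} h λ j _ → paired-≈ P∣b (∣m∣n⇒∣m+n P∣h P∣h) q∣D (+ 1 + + j))
    (≈-reflexive (sym (H≡∏paired-half (+ 0) h x∣0 P∣h))))

  -- The value 0 at the multiples of P lets sums over the integers prime to p run over whole intervals.
  module Inverse (M : ℕ) where

    inv : ℤ → ℤ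
    inv y with P ∣? y
    ... | yes _   = + 0
    ... | no  P∤y = proj₁ (unit-inverse (P∤⇒unit P∤y) M)

    inv-∣ : ∀ {y} → P ∣ y → inv y ≡ + 0
    inv-∣ {y} P∣y with P ∣? y
    ... | yes _   = refl
    ... | no  P∤y = contradiction P∣y P∤y

    inv-∤ : ∀ {y} → ¬ P ∣ y → y * inv y ≈ + 1 [ P ^ M ]
    inv-∤ {y} P∤y with P ∣? y
    ... | yes P∣y  = contradiction P∣y P∤y
    ... | no  P∤y′ = proj₂ (unit-inverse (P∤⇒unit P∤y′) M)

    -- The factor κ serves three purposes: 1 gives compatibility with congruences, -1 the reflection
    -- and 2 the doubling of the index.
    inv-scale : ∀ {κ y z} s → s ℕ.≤ M → Unit κ → z ≈ κ * y [ P ^ s ] → κ * inv z ≈ inv y [ P ^ s ]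
    inv-scale             zero      s≤M κ-unit z≈κy = ≈-mod-1 {q = P}
    inv-scale {κ} {y} {z} s@(suc _) s≤M κ-unit z≈κy = cases (P ∣? y)
      where
      P∣q = P∣P^ {s} (s≤s z≤n)
      q∣P^M = ^-mono-∣ P s≤M
      cases : Dec (P ∣ y) → κ * inv z ≈ inv y [ P ^ s ]
      cases (yes P∣y) = ≈-reflexive (trans (cong (κ *_) (inv-∣ P∣z)) (trans (*-zeroʳ κ) (sym (inv-∣ P∣y))))
        where
        P∣z : P ∣ z
        P∣z = ∣-resp-≈ (≈-weaken P∣q z≈κy) (∣n⇒∣m*n κ P∣y)
      cases (no P∤y) =
        ≈-trans (≈-reflexive (lemma₁ (κ * inv z)))
        (≈-trans (≈-*ˡ (κ * inv z) (≈-sym (≈-weaken q∣P^M (inv-∤ P∤y))))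
        (≈-trans (≈-reflexive (lemma₂ κ (inv z) y (inv y)))
        (≈-trans (≈-*ʳ (inv y) (≈-trans (≈-*ʳ (inv z) (≈-sym z≈κy)) (≈-weaken q∣P^M (inv-∤ P∤z))))
        (≈-reflexive (*-identityˡ (inv y))))))
        where
        lemma₁ : ∀ x → x ≡ x * + 1
        lemma₁ = solve-∀
        lemma₂ : ∀ κ i y j → κ * i * (y * j) ≡ κ * y * i * j
        lemma₂ = solve-∀
        P∤z : ¬ P ∣ z
        P∤z P∣z = P∤y (unit-cancel-P∣ κ-unit (∣-resp-≈ (≈-sym (≈-weaken P∣q z≈κy)) P∣z))

    inv² : ℤ → ℤ
    inv² y = inv y * inv y

    inv²-scale : ∀ {κ y z} s → s ℕ.≤ M → Unit κ → z ≈ κ * y [ P ^ s ] → κ * κ * inv² z ≈ inv² y [ P ^ s ]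
    inv²-scale {κ} {y} {z} s s≤M κ-unit z≈κy = ≈-trans (≈-reflexive (lemma κ (inv z)))
      (≈-* (inv-scale s s≤M κ-unit z≈κy) (inv-scale s s≤M κ-unit z≈κy))
      where
      lemma : ∀ κ i → κ * κ * (i * i) ≡ κ * i * (κ * i)
      lemma = solve-∀

    inv²-cong : ∀ {y z} s → s ℕ.≤ M → z ≈ y [ P ^ s ] → inv² z ≈ inv² y [ P ^ s ]
    inv²-cong {y} {z} s s≤M z≈y = ≈-trans (≈-reflexive (sym (*-identityˡ (inv² z))))
      (inv²-scale s s≤M unit-1 (≈-trans z≈y (≈-reflexive (sym (*-identityˡ y)))))

    -- The sum S over a full period equals both its even part and its odd part E, and 4 E ≡ S, so 3 S ≡ 0.
    ∑inv²≈0 : Unit (+ 2) → Unit (+ 3) → ∀ s → s ℕ.≤ M → ∀ c → ∑ inv² c (p ℕ.^ s) ≈ + 0 [ P ^ s ]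
    ∑inv²≈0 2-unit 3-unit s s≤M c = ≈-trans (∑-periodic q periodic c (+ 0)) S≈0
      where
      q = p ℕ.^ s
      Q = P ^ s
      S E O : ℤ
      S = ∑ inv² (+ 0) q
      E = ∑ (λ m → inv² (+ 2 * m)) (+ 0) q
      O = ∑ (λ m → inv² (+ 2 * m + + 1)) (+ 0) q

      x+q≈x : ∀ x → x + + q ≈ x [ Q ]
      x+q≈x x = + 1 , cong (_+_ x) (trans (pos-^ p s) (sym (*-identityˡ Q)))

      periodic : ∀ x → inv² (x + + q) ≈ inv² x [ Q ]
      periodic x = inv²-cong s s≤M (x+q≈x x)

      periodic₂ : ∀ x → inv² (+ 2 * (x + + q)) ≈ inv² (+ 2 * x) [ Q ]
      periodic₂ x = inv²-cong s s≤M (≈-*ˡ (+ 2) (x+q≈x x))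

      half = proj₁ (unit-inverse 2-unit s)

      -- 2m + 1 ≡ 2(m + half) modulo `Q`, so the odd part is the even part with its index moved by
      -- `half`, and periodicity removes the move.
      O≈E : O ≈ E [ Q ]
      O≈E = ≈-trans (∑-cong-≈ {c = + 0} {d = half} q λ j _ → inv²-cong s s≤M
          (≈-trans (≈-+ˡ (+ 2 * (+ 0 + + j)) (≈-sym (proj₂ (unit-inverse 2-unit s)))) (≈-reflexive (lemma half (+ j)))))
        (∑-periodic {f = λ m → inv² (+ 2 * m)} q periodic₂ half (+ 0))
        where
        lemma : ∀ h j → + 2 * (+ 0 + j) + + 2 * h ≡ + 2 * (h + j)
        lemma = solve-∀

      S+S≈E+O : S + S ≈ E + O [ Q ]
      S+S≈E+O =
        ≈-trans (≈-+ˡ S (∑-periodic q periodic (+ 0) (+ 0 + + q)))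
        (≈-trans (≈-reflexive (trans (sym (∑-split inv² (+ 0) q q)) (trans (cong (∑ inv² (+ 0)) (ℕ-lemma q)) (∑-group inv² 2 (+ 0) q))))
        (≈-reflexive (trans (∑-cong {c = + 0} {d = + 0} q λ j _ → pair (+ 0 + + j))
          (∑-+ (λ m → inv² (+ 2 * m)) (λ m → inv² (+ 2 * m + + 1)) (+ 0) q))))
        where
        ℕ-lemma : ∀ q → q ℕ.+ q ≡ q ℕ.* 2
        ℕ-lemma = ℕ-Solver.solve-∀
        pair : ∀ m → ∑ inv² (+ 2 * m) 2 ≡ inv² (+ 2 * m) + inv² (+ 2 * m + + 1)
        pair m = cong (λ x → x + inv² (+ 2 * m + + 1)) (trans (+-identityˡ _) (cong inv² (+-identityʳ (+ 2 * m))))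

      S≈E : S ≈ E [ Q ]
      S≈E = unit-cancel-≈ s 2-unit (≈-trans (≈-reflexive (lemma S)) (≈-trans S+S≈E+O
        (≈-trans (≈-+ˡ E O≈E) (≈-reflexive (sym (lemma E))))))
        where
        lemma : ∀ S → + 2 * S ≡ S + S
        lemma = solve-∀

      4E≈S : + 4 * E ≈ S [ Q ]
      4E≈S = ≈-trans (≈-reflexive (sym (∑-distrib (+ 4) (λ m → inv² (+ 2 * m)) (+ 0) q)))
        (∑-cong-≈ {c = + 0} {d = + 0} q λ j _ → inv²-scale {+ 2} s s≤M 2-unit ≈-refl)

      S≈0 : S ≈ + 0 [ Q ]
      S≈0 = ∣⇒≈0 (unit-cancel-∣ s 3-unit (subst (Q ∣_) (lemma S)
        (≈⇒∣ (≈-trans (≈-*ˡ (+ 4) S≈E) 4E≈S))))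
        where
        lemma : ∀ S → + 4 * S - S ≡ + 3 * S
        lemma = solve-∀

    ∑inv²-multiple≈0 : Unit (+ 2) → Unit (+ 3) → ∀ s → s ℕ.≤ M → ∀ c n → ∑ inv² c (n ℕ.* p ℕ.^ s) ≈ + 0 [ P ^ s ]
    ∑inv²-multiple≈0 2-unit 3-unit s s≤M c zero    = ≈-refl
    ∑inv²-multiple≈0 2-unit 3-unit s s≤M c (suc n) = ≈-trans (≈-reflexive (∑-split inv² c (p ℕ.^ s) (n ℕ.* p ℕ.^ s)))
      (≈-+ (∑inv²≈0 2-unit 3-unit s s≤M c) (∑inv²-multiple≈0 2-unit 3-unit s s≤M (c + + (p ℕ.^ s)) n))

  -- Dividing the pairs for b by those for 0 leaves the factors 1 + D u(y) with u(y) = 1 / (y (a -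
  -- y)). Their product is 1 + D ∑ u modulo D², which is precise enough because s ≤ t, and u(y) ≡ -1
  -- / y² modulo P^s because P^s divides a.
  H≈H0 : ∀ {b} n s t → Unit (+ 2) → Unit (+ 3) → 1 ℕ.≤ s → s ℕ.≤ t → P ∣ b →
         P ^ t ∣ b * (+ (n ℕ.* p ℕ.^ s) + b) → H b (n ℕ.* p ℕ.^ s) ≈ H (+ 0) (n ℕ.* p ℕ.^ s) [ P ^ (t ℕ.+ s) ]
  H≈H0 {b} n s t 2-unit 3-unit 1≤s s≤t P∣b P^t∣D = H≈H0-square a (t ℕ.+ s) 2-unit P∣b
    (≈-trans (≈-reflexive (H*H≡∏paired b a P∣b P∣a))
    (≈-trans (∏-cong-≈ {c = + 1} {d = + 1} a λ j _ → paired≈ (+ 1 + + j))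
    (≈-trans (≈-reflexive (∏-* (paired (+ 0) (+ a)) (λ y → + 1 + D * u y) (+ 1) a))
    (≈-trans (≈-*ˡ (∏ (paired (+ 0) (+ a)) (+ 1) a) ∏≈1) (≈-reflexive (trans (*-identityʳ _) (sym (H*H≡∏paired (+ 0) a x∣0 P∣a))))))))
    where
    a = n ℕ.* p ℕ.^ s
    D = b * (+ a + b)
    open Inverse (t ℕ.+ s)

    P^s∣a : P ^ s ∣ + a
    P^s∣a = divides (+ n) (trans (pos-* n (p ℕ.^ s)) (cong (+ n *_) (pos-^ p s)))

    P∣a : P ∣ + a
    P∣a = ∣-trans (P∣P^ 1≤s) P^s∣a

    u : ℤ → ℤ
    u y = inv y * inv (+ a - y)

    paired≈ : ∀ y → paired b (+ a) y ≈ paired (+ 0) (+ a) y * (+ 1 + D * u y) [ P ^ (t ℕ.+ s) ]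
    paired≈ y = cases (P ∣? y)
      where
      cases : Dec (P ∣ y) → paired b (+ a) y ≈ paired (+ 0) (+ a) y * (+ 1 + D * u y) [ P ^ (t ℕ.+ s) ]
      cases (yes P∣y) = ≈-reflexive (trans (paired-∣ P∣b P∣a P∣y) (sym (cong₂ _*_ (paired-∣ x∣0 P∣a P∣y)
        (trans (cong (λ z → + 1 + D * (z * inv (+ a - y))) (inv-∣ P∣y)) (cong (_+_ (+ 1)) (*-zeroʳ D))))))
      cases (no P∤y) = ≈-trans (≈-reflexive (trans (paired-∤ P∣b P∣a P∤y) ([b+y]*[b+a-y] b (+ a) y)))
        (≈-trans (≈-+ˡ ((+ 0 + y) * (+ 0 + + a - y)) (≈-trans (≈-reflexive (sym (*-identityʳ D))) (≈-*ˡ D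
          (≈-sym (≈-* (inv-∤ P∤y) (inv-∤ (P∤b-y P∣a P∤y)))))))
        (≈-reflexive (trans (lemma D y (+ a) (inv y) (inv (+ a - y))) (cong (_* (+ 1 + D * u y)) (sym (paired-∤ x∣0 P∣a P∤y))))))
        where
        lemma : ∀ D y a i j → (+ 0 + y) * (+ 0 + a - y) + D * (y * i * ((a - y) * j)) ≡ (+ 0 + y) * (+ 0 + a - y) * (+ 1 + D * (i * j))
        lemma = solve-∀

    u≈-inv² : ∀ y → u y ≈ - + 1 * inv² y [ P ^ s ]
    u≈-inv² y = ≈-trans (≈-reflexive (lemma (inv y) (inv (+ a - y)))) (≈-*ˡ (- + 1) (≈-*ˡ (inv y)
      (inv-scale s (ℕ.m≤n+m s t) (unit-neg unit-1) (≈-trans (≈-+ʳ (- y) (∣⇒≈0 P^s∣a)) (≈-reflexive (lemma′ y))))))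
      where
      lemma : ∀ i j → i * j ≡ - + 1 * (i * (- + 1 * j))
      lemma = solve-∀
      lemma′ : ∀ y → + 0 - y ≡ - + 1 * y
      lemma′ = solve-∀

    ∑u≈0 : ∑ u (+ 1) a ≈ + 0 [ P ^ s ]
    ∑u≈0 = ≈-trans (∑-cong-≈ {g = λ y → - + 1 * inv² y} {c = + 1} {d = + 1} a λ j _ → u≈-inv² (+ 1 + + j))
      (≈-trans (≈-reflexive (∑-distrib (- + 1) inv² (+ 1) a))
      (≈-*ˡ (- + 1) (∑inv²-multiple≈0 2-unit 3-unit s (ℕ.m≤n+m s t) (+ 1) n)))

    ∏≈1 : ∏ (λ y → + 1 + D * u y) (+ 1) a ≈ + 1 [ P ^ (t ℕ.+ s) ]
    ∏≈1 = ≈-trans (≈-weaken (subst (_∣ D * D) (sym (^-distribˡ-+-* P t s)) (∣-*-∣ P^t∣D (∣-trans (^-mono-∣ P s≤t) P^t∣D)))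
        (∏-1+ D u (+ 1) a))
      (≈-+ˡ (+ 1) (subst (λ q → D * ∑ u (+ 1) a ≈ + 0 [ q ]) (sym (^-distribˡ-+-* P t s))
        (≈-trans (≈-mod-* P^t∣D ∑u≈0) (≈-reflexive (*-zeroʳ D)))))

-- Comparison of binomial coefficients with entries p a and with entries a

module Scaling (p : ℕ) (p-prime : Prime p) where

  open PrimeToP p p-prime public

  p-1 : ℕ
  p-1 = ℕ.pred p

  p≡suc-p-1 : p ≡ suc p-1
  p≡suc-p-1 = sym (ℕ.suc-pred p)

  private
    ∏-unsnoc-p : ∀ f c → ∏ f c p ≡ ∏ f c p-1 * f (c + + p-1)
    ∏-unsnoc-p f c = cong (∏ f c) p≡suc-p-1

  P∤1+Pm+j : ∀ m j → j ℕ.< p-1 → ¬ P ∣ + 1 + P * m + + j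
  P∤1+Pm+j m j j<p-1 P∣ = ℕ.>⇒∤ (ℕ.≤-trans (s≤s j<p-1) (ℕ.≤-reflexive (sym p≡suc-p-1)))
    (∣⇒∣ᵤ (∣-+ʳ (∣m⇒∣m*n m ∣-refl) (subst (P ∣_) (lemma (P * m) (+ j)) P∣)))
    where
    lemma : ∀ a j → + 1 + a + j ≡ a + (+ 1 + j)
    lemma = solve-∀

  private
    block-end : ∀ m → + 1 + P * m + + p-1 ≡ P * (+ 1 + m)
    block-end m = trans (lemma (P * m) (+ p-1)) (trans (cong (λ a → P * m + + a) (sym p≡suc-p-1)) (lemma′ P m))
      where
      lemma : ∀ a q → + 1 + a + q ≡ a + (+ 1 + q)
      lemma = solve-∀
      lemma′ : ∀ P m → P * m + P ≡ P * (+ 1 + m)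
      lemma′ = solve-∀

    ∏-block : ∀ m → ∏ (λ x → x) (+ 1 + P * m) p ≡ P * (+ 1 + m) * H (P * m) p
    ∏-block m = begin
      ∏ (λ x → x) c p                        ≡⟨ ∏-unsnoc-p (λ x → x) c ⟩
      ∏ (λ x → x) c p-1 * (c + + p-1)        ≡⟨ cong₂ _*_ (∏-cong {c = c} {d = c} p-1 λ j j< → sym (φ-∤ (P∤1+Pm+j m j j<))) (block-end m) ⟩
      ∏ φ c p-1 * (P * (+ 1 + m))            ≡⟨ *-comm (∏ φ c p-1) _ ⟩
      P * (+ 1 + m) * ∏ φ c p-1              ≡⟨ cong (P * (+ 1 + m) *_) (*-identityʳ (∏ φ c p-1)) ⟨
      P * (+ 1 + m) * (∏ φ c p-1 * + 1)      ≡⟨ cong (λ a → P * (+ 1 + m) * (∏ φ c p-1 * a)) (φ-∣ (subst (P ∣_) (sym (block-end m)) (∣m⇒∣m*n (+ 1 + m) ∣-refl))) ⟨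
      P * (+ 1 + m) * (∏ φ c p-1 * φ (c + + p-1)) ≡⟨ cong (P * (+ 1 + m) *_) (∏-unsnoc-p φ c) ⟨
      P * (+ 1 + m) * H (P * m) p            ∎
      where
      open ≡-Reasoning
      c = + 1 + P * m

  -- Among the a p factors, the multiples of `P` are P (b + 1), ..., P (b + a); the others make up
  -- `H`.
  rising-P : ∀ b a → rising (P * b) (a ℕ.* p) ≡ P ^ a * H (P * b) (a ℕ.* p) * rising b a
  rising-P b zero    = refl
  rising-P b (suc a) = begin
    rising (P * b) (p ℕ.+ a ℕ.* p)                                        ≡⟨ cong (rising (P * b)) (ℕ.+-comm p (a ℕ.* p)) ⟩
    rising (P * b) (a ℕ.* p ℕ.+ p)                                        ≡⟨ rising-split (P * b) (a ℕ.* p) p ⟩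
    rising (P * b) (a ℕ.* p) * rising (P * b + + (a ℕ.* p)) p             ≡⟨ cong₂ (λ x y → x * rising y p) (rising-P b a) Pb+ap ⟩
    P ^ a * H (P * b) (a ℕ.* p) * rising b a * rising (P * (b + + a)) p   ≡⟨ cong (P ^ a * H (P * b) (a ℕ.* p) * rising b a *_) (∏-block (b + + a)) ⟩
    P ^ a * H (P * b) (a ℕ.* p) * rising b a * (P * (+ 1 + (b + + a)) * H (P * (b + + a)) p)
      ≡⟨ lemma (P ^ a) (H (P * b) (a ℕ.* p)) (rising b a) P b (+ a) (H (P * (b + + a)) p) ⟩
    P * P ^ a * (H (P * b) (a ℕ.* p) * H (P * (b + + a)) p) * (rising b a * (+ 1 + b + + a))  ≡⟨ cong (λ h → P * P ^ a * h * (rising b a * (+ 1 + b + + a))) H-split ⟨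
    P * P ^ a * H (P * b) (p ℕ.+ a ℕ.* p) * (rising b a * (+ 1 + b + + a)) ∎
    where
    open ≡-Reasoning
    Pb+ap : P * b + + (a ℕ.* p) ≡ P * (b + + a)
    Pb+ap = trans (cong (_+_ (P * b)) (pos-* a p)) (lemma P b (+ a))
      where
      lemma : ∀ P b a → P * b + a * P ≡ P * (b + a)
      lemma = solve-∀
    H-split : H (P * b) (p ℕ.+ a ℕ.* p) ≡ H (P * b) (a ℕ.* p) * H (P * (b + + a)) p
    H-split = trans (cong (H (P * b)) (ℕ.+-comm p (a ℕ.* p))) (trans (∏-split φ (+ 1 + P * b) (a ℕ.* p) p)
      (cong (λ c → H (P * b) (a ℕ.* p) * ∏ φ c p) (trans (+-assoc (+ 1) (P * b) (+ (a ℕ.* p))) (cong (_+_ (+ 1)) Pb+ap))))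
    lemma : ∀ Q h r P b a h′ → Q * h * r * (P * (+ 1 + (b + a)) * h′) ≡ P * Q * (h * h′) * (r * (+ 1 + b + a))
    lemma = solve-∀

  P^-nonZero : ∀ a → NonZero (P ^ a)
  P^-nonZero a = subst NonZero (pos-^ p a) (ℕ.m^n≢0 p a)

  -- `rising-P` at b gives the numerator and at 0 the factorial of a p; the common factor P^a a!
  -- cancels.
  binomℤ-P : ∀ b a → H (+ 0) (a ℕ.* p) * binomℤ (+ (a ℕ.* p) + P * b) (+ (a ℕ.* p)) ≡ H (P * b) (a ℕ.* p) * binomℤ (+ a + b) (+ a)
  binomℤ-P b a = *-cancelʳ-≡ _ _ (P ^ a * + (a !)) (begin
    H₀ * X * (P ^ a * + (a !))               ≡⟨ lemma₁ H₀ X (P ^ a) (+ (a !)) ⟩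
    X * (P ^ a * H₀ * + (a !))               ≡⟨ cong (λ z → X * (P ^ a * H₀ * z)) (!≡rising a) ⟩
    X * (P ^ a * H₀ * rising (+ 0) a)        ≡⟨ cong (λ z → X * z) [ap]! ⟨
    X * + ((a ℕ.* p) !)                      ≡⟨ binomℤ-rising (P * b) (a ℕ.* p) ⟩
    rising (P * b) (a ℕ.* p)                 ≡⟨ rising-P b a ⟩
    P ^ a * H₁ * rising b a                  ≡⟨ cong (P ^ a * H₁ *_) (binomℤ-rising b a) ⟨
    P ^ a * H₁ * (Y * + (a !))               ≡⟨ lemma₂ (P ^ a) H₁ Y (+ (a !)) ⟩
    H₁ * Y * (P ^ a * + (a !))               ∎)
    where
    open ≡-Reasoning
    H₀ = H (+ 0) (a ℕ.* p)
    H₁ = H (P * b) (a ℕ.* p)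
    X = binomℤ (+ (a ℕ.* p) + P * b) (+ (a ℕ.* p))
    Y = binomℤ (+ a + b) (+ a)
    instance
      _ = ℕ._!≢0 a
      _ = P^-nonZero a
      _ = i*j≢0 (P ^ a) (+ (a !))
    [ap]! : + ((a ℕ.* p) !) ≡ P ^ a * H₀ * rising (+ 0) a
    [ap]! = trans (!≡rising (a ℕ.* p)) (subst (λ z → rising z (a ℕ.* p) ≡ P ^ a * H z (a ℕ.* p) * rising (+ 0) a) (*-zeroʳ P) (rising-P (+ 0) a))
    lemma₁ : ∀ h x q f → h * x * (q * f) ≡ x * (q * h * f)
    lemma₁ = solve-∀
    lemma₂ : ∀ q h y f → q * h * (y * f) ≡ h * y * (q * f)
    lemma₂ = solve-∀

  scaled-nonneg : ∀ {q σ} a b → H (P * a) (b ℕ.* p) ≈ σ * H (+ 0) (b ℕ.* p) [ q ] →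
                  Ratio q σ (binomℤ (P * a + P * + b) (P * + b)) (binomℤ (a + + b) (+ b))
  scaled-nonneg {q} {σ} a b H≈ = ratio (H-unit (+ 0) (b ℕ.* p)) H≈ (begin
    H₀ * binomℤ (P * a + P * + b) (P * + b)                ≡⟨ cong₂ (λ n k → H₀ * binomℤ n k) (trans (+-comm (P * a) (P * + b)) (cong (λ z → z + P * a) Pb)) Pb ⟩
    H₀ * binomℤ (+ (b ℕ.* p) + P * a) (+ (b ℕ.* p))        ≡⟨ binomℤ-P a b ⟩
    H₁ * binomℤ (+ b + a) (+ b)                            ≡⟨ cong (λ n → H₁ * binomℤ n (+ b)) (+-comm (+ b) a) ⟩
    H₁ * binomℤ (a + + b) (+ b)                            ∎)
    where
    open ≡-Reasoning
    H₀ = H (+ 0) (b ℕ.* p)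
    H₁ = H (P * a) (b ℕ.* p)
    Pb : P * + b ≡ + (b ℕ.* p)
    Pb = trans (*-comm P (+ b)) (sym (pos-* b p))

  P*neg : ∀ {a} → a < + 0 → P * a < + 0
  P*neg {a} a<0 = subst (P * a <_) (*-zeroʳ P) (*-monoˡ-<-pos P {{pos}} a<0)
    where
    pos : Positive P
    pos = subst (λ n → Positive (+ n)) (sym p≡suc-p-1) _

  -- The length in `H` is a natural number, so a nonnegative entry has to serve as the length, and
  -- the symmetry of the coefficient lets either entry do so; each hypothesis covers one choice. If
  -- both entries are negative, both coefficients vanish.
  scaled : ∀ {q σ} a b → (∀ b′ → b ≡ + b′ → H (P * a) (b′ ℕ.* p) ≈ σ * H (+ 0) (b′ ℕ.* p) [ q ]) →
           (∀ a′ → a ≡ + a′ → H (P * b) (a′ ℕ.* p) ≈ σ * H (+ 0) (a′ ℕ.* p) [ q ]) →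
           Ratio q σ (binomℤ (P * a + P * b) (P * b)) (binomℤ (a + b) b)
  scaled a (+ b) H≈ _ = scaled-nonneg a b (H≈ b refl)
  scaled {q} {σ} (+ a) b@(-[1+ _ ]) _ H≈ = subst₂ (Ratio q σ)
    (trans (cong (λ n → binomℤ n (P * + a)) (+-comm (P * b) (P * + a))) (binomℤ-+-sym (P * + a) (P * b)))
    (trans (cong (λ n → binomℤ n (+ a)) (+-comm b (+ a))) (binomℤ-+-sym (+ a) b))
    (scaled-nonneg b a (H≈ a refl))
  scaled a@(-[1+ _ ]) b@(-[1+ _ ]) _ _ = ratio-zero
    (trans (sym (binomℤ-+-sym (P * a) (P * b))) (binomℤ-neg-neg (P * a) (P * b) (P*neg -<+) (P*neg -<+)))
    (trans (sym (binomℤ-+-sym a b)) (binomℤ-neg-neg a b -<+ -<+))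

≈-1* : ∀ {q x y} → x ≈ y [ q ] → x ≈ + 1 * y [ q ]
≈-1* {y = y} x≈y = ≈-trans x≈y (≈-reflexive (sym (*-identityˡ y)))

module ScalingCongruences (p : ℕ) (p-prime : Prime p) where

  open Scaling p p-prime public

  P∣P* : ∀ a → P ∣ P * a
  P∣P* a = ∣m⇒∣m*n a ∣-refl

  P∣*p : ∀ b → P ∣ + (b ℕ.* p)
  P∣*p b = divides (+ b) (pos-* b p)

  *p≡P* : ∀ b → + (b ℕ.* p) ≡ P * + b
  *p≡P* b = trans (pos-* b p) (*-comm (+ b) P)

  ^-∣-* : ∀ m n {x y} → P ^ m ∣ x → P ^ n ∣ y → P ^ (m ℕ.+ n) ∣ x * y
  ^-∣-* m n {x} {y} P^m∣x P^n∣y = subst (_∣ x * y) (sym (^-distribˡ-+-* P m n)) (∣-*-∣ P^m∣x P^n∣y)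

  scaled-odd : ∀ t a b → Unit (+ 2) → P ^ t ∣ P * a * (P * b + P * a) → P ^ t ∣ P * b * (P * a + P * b) →
               Ratio (P ^ t) (+ 1) (binomℤ (P * a + P * b) (P * b)) (binomℤ (a + b) b)
  scaled-odd t a b 2-unit D₁ D₂ = scaled a b
    (λ { b′ refl → ≈-1* (H≈H0-odd (b′ ℕ.* p) t 2-unit (P∣P* a) (P∣*p b′) (subst (λ z → P ^ t ∣ P * a * (z + P * a)) (sym (*p≡P* b′)) D₁)) })
    (λ { a′ refl → ≈-1* (H≈H0-odd (a′ ℕ.* p) t 2-unit (P∣P* b) (P∣*p a′) (subst (λ z → P ^ t ∣ P * b * (z + P * b)) (sym (*p≡P* a′)) D₂)) })

  private
    H≈H0-entry : ∀ {b} a s t → Unit (+ 2) → Unit (+ 3) → suc s ℕ.≤ t → P ^ s ∣ + a → P ∣ b →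
                 P ^ t ∣ b * (P * + a + b) → H b (a ℕ.* p) ≈ H (+ 0) (a ℕ.* p) [ P ^ (t ℕ.+ suc s) ]
    H≈H0-entry {b} a s t 2-unit 3-unit s<t P^s∣a P∣b D with ℕ.divides n a≡ ← subst (λ z → ∣ z ∣ ℕ.∣ a) (sym (pos-^ p s)) (∣⇒∣ᵤ P^s∣a) =
      subst (λ z → H b z ≈ H (+ 0) z [ P ^ (t ℕ.+ suc s) ]) n*≡
        (H≈H0 n (suc s) t 2-unit 3-unit (s≤s z≤n) s<t P∣b (subst (λ z → P ^ t ∣ b * (z + b)) (trans (sym (*p≡P* a)) (cong +_ (sym n*≡))) D))
      where
      lemma : ∀ n q p → n ℕ.* (p ℕ.* q) ≡ n ℕ.* q ℕ.* p
      lemma = ℕ-Solver.solve-∀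
      n*≡ : n ℕ.* p ℕ.^ suc s ≡ a ℕ.* p
      n*≡ = trans (lemma n (p ℕ.^ s) p) (cong (ℕ._* p) (sym a≡))

  scaled-entry-nonneg : ∀ s t a b → Unit (+ 2) → Unit (+ 3) → suc s ℕ.≤ t → P ^ s ∣ + b → P ^ t ∣ P * a * (P * + b + P * a) →
                        Ratio (P ^ (t ℕ.+ suc s)) (+ 1) (binomℤ (P * a + P * + b) (P * + b)) (binomℤ (a + + b) (+ b))
  scaled-entry-nonneg s t a b 2-unit 3-unit s<t P^s∣b D =
    scaled-nonneg a b (≈-1* (H≈H0-entry b s t 2-unit 3-unit s<t P^s∣b (P∣P* a) D))

  scaled-entry : ∀ s t a b → Unit (+ 2) → Unit (+ 3) → suc s ℕ.≤ t → P ^ s ∣ a → P ^ s ∣ b →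
                 P ^ t ∣ P * a * (P * b + P * a) → P ^ t ∣ P * b * (P * a + P * b) →
                 Ratio (P ^ (t ℕ.+ suc s)) (+ 1) (binomℤ (P * a + P * b) (P * b)) (binomℤ (a + b) b)
  scaled-entry s t a b 2-unit 3-unit s<t P^s∣a P^s∣b D₁ D₂ = scaled a b
    (λ { b′ refl → ≈-1* (H≈H0-entry b′ s t 2-unit 3-unit s<t P^s∣b (P∣P* a) D₁) })
    (λ { a′ refl → ≈-1* (H≈H0-entry a′ s t 2-unit 3-unit s<t P^s∣a (P∣P* b) D₂) })

  -- With length P b, `H` runs over a multiple of a period of `φ` modulo P^r, so its starting point
  -- does not matter; with length P a, its starting point P b is 0 modulo P^r.
  scaled-bottom : ∀ r a b → 1 ℕ.≤ r → P ^ r ∣ P * b →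
                  Ratio (P ^ r) (+ 1) (binomℤ (P * a + P * b) (P * b)) (binomℤ (a + b) b)
  scaled-bottom r a b 1≤r P^r∣Pb = scaled a b
    (λ { b′ refl → ≈-1* (∏-periodic (b′ ℕ.* p) (λ x → φ-cong-≈ (P∣P^ 1≤r)
           (≈-trans (≈-+ˡ x (∣⇒≈0 (subst (P ^ r ∣_) (sym (*p≡P* b′)) P^r∣Pb))) (≈-reflexive (+-identityʳ x)))) (+ 1 + P * a) (+ 1)) })
    (λ { a′ refl → ≈-1* (H-cong-P (a′ ℕ.* p) (P∣P^ 1≤r) (∣⇒≈0 P^r∣Pb)) })

-- Products of block terms

entries : ℤ → ℤ → List ℤ → List ℤ
entries c k xs = map (λ x → x - k) (map (c *_) xs) ++ [ k ]

scaledBlockTerm : ℤ → ℤ → List ℤ → ℤ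
scaledBlockTerm c k xs = multinomial (entries c k xs)

blocksProduct : ℤ → ℤ → List (List ℤ) → ℤ
blocksProduct c k bs = foldr _*_ (+ 1) (map (scaledBlockTerm c k) bs)

NonEmpty : List ℤ → Set
NonEmpty xs = 1 ℕ.≤ length xs

entries-∣ : ∀ {q c k} xs → q ∣ c → q ∣ k → All (q ∣_) (entries c k xs)
entries-∣ []       q∣c q∣k = q∣k ∷ []
entries-∣ (x ∷ xs) q∣c q∣k = ∣m∣n⇒∣m-n (∣m⇒∣m*n x q∣c) q∣k ∷ entries-∣ xs q∣c q∣k

-- This homogeneity is what matches the index p k at level r + 1 with the index k at level r, entry
-- by entry.
entries-* : ∀ a c k xs → entries (a * c) (a * k) xs ≡ map (a *_) (entries c k xs)
entries-* a c k []       = refl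
entries-* a c k (x ∷ xs) = cong₂ _∷_ (lemma a c k x) (entries-* a c k xs)
  where
  lemma : ∀ a c k x → a * c * x - a * k ≡ a * (c * x - k)
  lemma = solve-∀

map-*-∣ : ∀ c xs → All (c ∣_) (map (c *_) xs)
map-*-∣ c []       = []
map-*-∣ c (x ∷ xs) = ∣m⇒∣m*n x ∣-refl ∷ map-*-∣ c xs

∣k*scaledBlockTerm : ∀ c k {xs} → NonEmpty xs → c ∣ k * scaledBlockTerm c k xs
∣k*scaledBlockTerm c k {x ∷ xs} _ = ∣k*blockTerm k (c * x) (map (c *_) xs) (map-*-∣ c (x ∷ xs))

-- The comparison factor by factor is made once for an abstract relation, and used for `Ratio` with
-- factor 1 and, at p = 2, for congruence modulo 4.
module Multiplicative (_~_ : ℤ → ℤ → Set) (1~1 : (+ 1) ~ (+ 1))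
  (~-* : ∀ {x y z w} → x ~ y → z ~ w → (x * z) ~ (y * w)) where

  -- D is closed under addition because the binomial factors involve the partial sums of the
  -- entries.
  multinomialGo-~ : ∀ {D : ℤ → Set} q → (∀ {a b} → D a → D b → D (a + b)) →
                    (∀ a b → D a → D b → binomℤ (q * a + q * b) (q * b) ~ binomℤ (a + b) b) →
                    ∀ {acc as} → D acc → All D as → multinomialGo (q * acc) (map (q *_) as) ~ multinomialGo acc as
  multinomialGo-~ q D-+ binom-~ {acc} {[]}     Dacc []        = 1~1
  multinomialGo-~ q D-+ binom-~ {acc} {a ∷ as} Dacc (Da ∷ Das) = ~-* (binom-~ acc a Dacc Da)
    (subst (λ z → multinomialGo z (map (q *_) as) ~ multinomialGo (acc + a) as) (*-distribˡ-+ q acc a)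
      (multinomialGo-~ q D-+ binom-~ (D-+ Dacc Da) Das))

  scaledBlockTerm-~ : ∀ {D : ℤ → Set} q → (∀ {a b} → D a → D b → D (a + b)) →
                      (∀ a b → D a → D b → binomℤ (q * a + q * b) (q * b) ~ binomℤ (a + b) b) →
                      ∀ {c k xs} → All D (entries c k xs) → scaledBlockTerm (q * c) (q * k) xs ~ scaledBlockTerm c k xs
  scaledBlockTerm-~ {D} q D-+ binom-~ {c} {k} {xs} D-entries =
    subst (λ es → multinomial es ~ scaledBlockTerm c k xs) (sym (entries-* q c k xs)) (multinomial-~ D-entries)
    where
    multinomial-~ : ∀ {es} → All D es → multinomial (map (q *_) es) ~ multinomial es
    multinomial-~ []         = 1~1
    multinomial-~ (De ∷ Des) = multinomialGo-~ q D-+ binom-~ De Des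

  blocksProduct-~ : ∀ c k c′ k′ {bs} → All (λ xs → scaledBlockTerm c k xs ~ scaledBlockTerm c′ k′ xs) bs →
                    blocksProduct c k bs ~ blocksProduct c′ k′ bs
  blocksProduct-~ c k c′ k′ []       = 1~1
  blocksProduct-~ c k c′ k′ (x ∷ xs) = ~-* x (blocksProduct-~ c k c′ k′ xs)

module Blocks (p : ℕ) (p-prime : Prime p) where

  open ScalingCongruences p p-prime public

  blocksProduct-∣ : ∀ {e} c k {bs} n → n ℕ.≤ length bs → All (λ xs → P ^ e ∣ scaledBlockTerm c k xs) bs → P ^ (n ℕ.* e) ∣ blocksProduct c k bs
  blocksProduct-∣     c k {bs} zero    _        _        = divides (blocksProduct c k bs) (sym (*-identityʳ _))
  blocksProduct-∣ {e} c k      (suc n) (s≤s n≤) (d ∷ ds) = ^-∣-* e (n ℕ.* e) d (blocksProduct-∣ c k n n≤ ds)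

  blocksProduct-unit-∣ : ∀ {r k bs} n → Unit k → n ℕ.≤ length bs → All NonEmpty bs → P ^ (n ℕ.* r) ∣ blocksProduct (P ^ r) k bs
  blocksProduct-unit-∣ {r} {k} n k-unit n≤ nonEmpty =
    blocksProduct-∣ (P ^ r) k n n≤ (All.map (λ {xs} ne → unit-cancel-∣ r k-unit (∣k*scaledBlockTerm (P ^ r) k {xs} ne)) nonEmpty)

  -- The bound r makes such a splitting exist for k = 0 as well.
  record Split (r : ℕ) (k : ℤ) : Set where
    constructor split
    field
      s d     : ℕ
      s+d≡r   : s ℕ.+ d ≡ r
      k′      : ℤ
      k≡      : k ≡ P ^ s * k′
      maximal : d ≡ 0 ⊎ Unit k′

    P^s∣k : P ^ s ∣ k
    P^s∣k = divides k′ (trans k≡ (*-comm (P ^ s) k′))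

    P^d∣ : ∀ {y} → P ^ r ∣ k * y → P ^ d ∣ y
    P^d∣ {y} P^r∣ky with maximal
    ... | inj₁ d≡0    = subst (λ d → P ^ d ∣ y) (sym d≡0) (divides y (sym (*-identityʳ y)))
    ... | inj₂ k′-unit = unit-cancel-∣ d k′-unit (*-cancelˡ-∣ (P ^ s) {{P^-nonZero s}}
      (subst₂ _∣_ (trans (cong (P ^_) (sym s+d≡r)) (^-distribˡ-+-* P s d)) (trans (cong (_* y) k≡) (*-assoc (P ^ s) k′ y)) P^r∣ky))

  split-at : ∀ r k → Split r k
  split-at zero    k = split 0 0 refl k (sym (*-identityˡ k)) (inj₁ refl)
  split-at (suc r) k with split-at r k
  ... | split s d s+d≡r k′ k≡ (inj₂ k′-unit) = split s (suc d) (trans (ℕ.+-suc s d) (cong suc s+d≡r)) k′ k≡ (inj₂ k′-unit)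
  ... | split s .0 s+0≡r k′ k≡ (inj₁ refl) with P ∣? k′
  ...   | no  P∤k′             = split s 1 (trans (ℕ.+-suc s 0) (cong suc s+0≡r)) k′ k≡ (inj₂ (P∤⇒unit P∤k′))
  ...   | yes (divides k″ refl) = split (suc s) 0 (cong suc s+0≡r) k″ (trans k≡ (lemma (P ^ s) k″ P)) (inj₁ refl)
    where
    lemma : ∀ q k P → q * (k * P) ≡ P * q * k
    lemma = solve-∀

  module _ {q : ℤ} where
    open Multiplicative (Ratio q (+ 1)) ratio-refl ratio-* public
      renaming (multinomialGo-~ to multinomialGo-ratio; scaledBlockTerm-~ to scaledBlockTerm-ratio; blocksProduct-~ to blocksProduct-ratio)

  -- Kept as a hypothesis of the argument for squares because it is reached in two ways: by a square
  -- root if 2 is a unit, and by pairing halves if p = 2 and s ≥ 1.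
  SquareScaling : ℕ → Set
  SquareScaling s = ∀ a b → P ^ s ∣ a → P ^ s ∣ b → Ratio (P ^ (suc s ℕ.+ suc s)) (+ 1) (binomℤ (P * a + P * b) (P * b)) (binomℤ (a + b) b)

  P^suc∣ : ∀ {s a} → P ^ s ∣ a → P ^ suc s ∣ P * a
  P^suc∣ = *-monoʳ-∣ P

  squareScaling : Unit (+ 2) → ∀ s → SquareScaling s
  squareScaling 2-unit s a b P^s∣a P^s∣b = scaled-odd (suc s ℕ.+ suc s) a b 2-unit
    (^-∣-* (suc s) (suc s) Pa (∣m∣n⇒∣m+n Pb Pa)) (^-∣-* (suc s) (suc s) Pb (∣m∣n⇒∣m+n Pa Pb))
    where
    Pa = P^suc∣ {s} P^s∣a
    Pb = P^suc∣ {s} P^s∣b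

  -- The relative error P^e is multiplied by the P^d that divides each of at least two blocks.
  blocksProduct-≈ : ∀ {r k bs} e (σ : Split r k) → 2 ℕ.≤ length bs → All NonEmpty bs →
    All (λ xs → Ratio (P ^ e) (+ 1) (scaledBlockTerm (P ^ suc r) (P * k) xs) (scaledBlockTerm (P ^ r) k xs)) bs →
    blocksProduct (P ^ suc r) (P * k) bs ≈ blocksProduct (P ^ r) k bs [ P ^ (e ℕ.+ 2 ℕ.* Split.d σ) ]
  blocksProduct-≈ {r} {k} {bs} e σ 2≤ nonEmpty ratios =
    ≈-trans (ratio⇒≈ {e} (blocksProduct-ratio (P ^ suc r) (P * k) (P ^ r) k ratios) (blocksProduct-∣ {Split.d σ} (P ^ r) k 2 2≤
      (All.map (λ {xs} ne → Split.P^d∣ σ (∣k*scaledBlockTerm (P ^ r) k {xs} ne)) nonEmpty)))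
    (≈-reflexive (*-identityˡ _))

  blocksProduct-square : ∀ {r k bs} (σ : Split r k) → SquareScaling (Split.s σ) → 2 ℕ.≤ length bs → All NonEmpty bs →
    blocksProduct (P ^ suc r) (P * k) bs ≈ blocksProduct (P ^ r) k bs [ P ^ (2 ℕ.* suc r) ]
  blocksProduct-square {r} {k} {bs} σ@(split s d refl _ _ _) scaling 2≤ nonEmpty =
    subst (λ e → blocksProduct (P ^ suc r) (P * k) bs ≈ blocksProduct (P ^ r) k bs [ P ^ e ]) (lemma s d)
      (blocksProduct-≈ (suc s ℕ.+ suc s) σ 2≤ nonEmpty (All.map (λ {xs} _ → scaledBlockTerm-ratio P ∣m∣n⇒∣m+n scaling {P ^ r} {k} {xs}
        (entries-∣ xs (^-mono-∣ P (ℕ.m≤m+n s d)) (Split.P^s∣k σ))) nonEmpty))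
    where
    lemma : ∀ s d → suc s ℕ.+ suc s ℕ.+ 2 ℕ.* d ≡ 2 ℕ.* suc (s ℕ.+ d)
    lemma = ℕ-Solver.solve-∀

  private
    -- In the first factor the sum x + y, in the second the start x + y of the interval supplies
    -- P^(r+1), and the other term of B (A + B) supplies P^(s+1). For the second factor this takes z
    -- as the length, hence z must be nonnegative.
    trinomial-scaled : ∀ {r s} x y z → Unit (+ 2) → Unit (+ 3) → P ^ s ∣ x → P ^ s ∣ y → P ^ s ∣ + z → s ℕ.≤ r → P ^ r ∣ x + y →
                       Ratio (P ^ (suc s ℕ.+ suc r ℕ.+ suc s)) (+ 1) (trinomial (P * x) (P * y) (P * + z)) (trinomial x y (+ z))
    trinomial-scaled {r} {s} x y z 2-unit 3-unit P^s∣x P^s∣y P^s∣z s≤r P^r∣x+y = ratio-*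
      (scaled-entry s t x y 2-unit 3-unit s<t P^s∣x P^s∣y
        (^-∣-* (suc s) (suc r) (P^suc∣ {s} P^s∣x) (subst (P ^ suc r ∣_) (+-comm (P * x) (P * y)) P^r+1∣Px+Py))
        (^-∣-* (suc s) (suc r) (P^suc∣ {s} P^s∣y) P^r+1∣Px+Py))
      (subst (λ n → Ratio (P ^ (t ℕ.+ suc s)) (+ 1) (binomℤ (n + P * + z) (P * + z)) (binomℤ (x + y + + z) (+ z))) (*-distribˡ-+ P x y)
        (scaled-entry-nonneg s t (x + y) z 2-unit 3-unit s<t P^s∣z
          (subst (λ e → P ^ e ∣ P * (x + y) * (P * + z + P * (x + y))) (ℕ.+-comm (suc r) (suc s))
            (^-∣-* (suc r) (suc s) (P^suc∣ {r} P^r∣x+y) (∣m∣n⇒∣m+n (P^suc∣ {s} P^s∣z) (P^suc∣ {s} (∣m∣n⇒∣m+n P^s∣x P^s∣y)))))))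
      where
      t = suc s ℕ.+ suc r
      s<t : suc s ℕ.≤ t
      s<t = ℕ.m≤m+n (suc s) (suc r)
      P^r+1∣Px+Py : P ^ suc r ∣ P * x + P * y
      P^r+1∣Px+Py = subst (P ^ suc r ∣_) (*-distribˡ-+ P x y) (P^suc∣ {r} P^r∣x+y)

    -- Rotating the trinomial coefficient puts a nonnegative entry last; if there is none, it vanishes.
    short-trinomial : ∀ {r s} a b k → Unit (+ 2) → Unit (+ 3) → P ^ s ∣ a → P ^ s ∣ b → P ^ s ∣ k → s ℕ.≤ r → P ^ r ∣ a + k → P ^ r ∣ b + k →
                      Ratio (P ^ (suc s ℕ.+ suc r ℕ.+ suc s)) (+ 1) (trinomial (P * a) (P * b) (P * k)) (trinomial a b k)
    short-trinomial (+ a) b k 2-unit 3-unit s∣a s∣b s∣k s≤r r∣a+k r∣b+k =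
      subst₂ (Ratio _ (+ 1)) (sym (trinomial-cyclic (P * + a) (P * b) (P * k))) (sym (trinomial-cyclic (+ a) b k))
        (trinomial-scaled b k a 2-unit 3-unit s∣b s∣k s∣a s≤r r∣b+k)
    short-trinomial a@(-[1+ _ ]) (+ b) k 2-unit 3-unit s∣a s∣b s∣k s≤r r∣a+k r∣b+k =
      subst₂ (Ratio _ (+ 1)) (trinomial-cyclic (P * k) (P * a) (P * + b)) (trinomial-cyclic k a (+ b))
        (trinomial-scaled k a b 2-unit 3-unit s∣k s∣a s∣b s≤r (subst (_ ∣_) (+-comm a k) r∣a+k))
    short-trinomial a@(-[1+ _ ]) b@(-[1+ _ ]) k _ _ _ _ _ _ _ _ =
      ratio-zero (trinomial-zero₁ (P * a) (P * b) (P * k) (P*neg -<+) (P*neg -<+)) (trinomial-zero₁ a b k -<+ -<+)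

  short-block-ratio : ∀ {r s k} xs → Unit (+ 2) → Unit (+ 3) → s ℕ.≤ r → P ^ s ∣ k → NonEmpty xs → length xs ℕ.≤ 2 →
    Ratio (P ^ (suc s ℕ.+ suc r ℕ.+ suc s)) (+ 1) (scaledBlockTerm (P ^ suc r) (P * k) xs) (scaledBlockTerm (P ^ r) k xs)
  short-block-ratio {r} {s} {k} xs 2-unit 3-unit s≤r P^s∣k nonEmpty short =
    subst (λ es → Ratio _ (+ 1) (multinomial es) (scaledBlockTerm (P ^ r) k xs)) (sym (entries-* P (P ^ r) k xs)) (cases xs nonEmpty short)
    where
    e = suc s ℕ.+ suc r ℕ.+ suc s
    entry : ∀ x → P ^ s ∣ P ^ r * x - k
    entry x = ∣m∣n⇒∣m-n (∣m⇒∣m*n x (^-mono-∣ P s≤r)) P^s∣k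
    entry+k : ∀ x → P ^ r ∣ P ^ r * x - k + k
    entry+k x = subst (P ^ r ∣_) (sym (i-j+j≡i (P ^ r * x) k)) (∣m⇒∣m*n x ∣-refl)
    cases : ∀ xs → NonEmpty xs → length xs ℕ.≤ 2 → Ratio (P ^ e) (+ 1) (multinomial (map (P *_) (entries (P ^ r) k xs))) (scaledBlockTerm (P ^ r) k xs)
    cases (x ∷ []) _ _ = ratio-* (scaled-entry s (suc s ℕ.+ suc r) a k 2-unit 3-unit (ℕ.m≤m+n (suc s) (suc r)) (entry x) P^s∣k
        (^-∣-* (suc s) (suc r) (P^suc∣ {s} (entry x)) (subst (P ^ suc r ∣_) (+-comm (P * a) (P * k)) P∣Pa+Pk))
        (^-∣-* (suc s) (suc r) (P^suc∣ {s} P^s∣k) P∣Pa+Pk)) ratio-refl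
      where
      a = P ^ r * x - k
      P∣Pa+Pk : P ^ suc r ∣ P * a + P * k
      P∣Pa+Pk = subst (P ^ suc r ∣_) (*-distribˡ-+ P a k) (P^suc∣ {r} (entry+k x))
    cases (x ∷ y ∷ []) _ _ = subst₂ (Ratio (P ^ e) (+ 1)) (lemma (binomℤ (P * a + P * b) (P * b)) _) (lemma (binomℤ (a + b) b) _)
      (short-trinomial a b k 2-unit 3-unit (entry x) (entry y) P^s∣k s≤r (entry+k x) (entry+k y))
      where
      a = P ^ r * x - k
      b = P ^ r * y - k
      lemma : ∀ u v → u * v ≡ u * (v * + 1)
      lemma u v = cong (u *_) (sym (*-identityʳ v))
    cases (_ ∷ _ ∷ _ ∷ _) _ (s≤s (s≤s ()))

  -- With r = s + d, the exponent (s + 1) + (r + 1) + (s + 1) of the ratios and 2d from two blocks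
  -- add up to 3(r + 1).
  blocksProduct-cube : ∀ {r} k {bs} → Unit (+ 2) → Unit (+ 3) → 2 ℕ.≤ length bs → All NonEmpty bs → All (λ xs → length xs ℕ.≤ 2) bs →
    blocksProduct (P ^ suc r) (P * k) bs ≈ blocksProduct (P ^ r) k bs [ P ^ (3 ℕ.* suc r) ]
  blocksProduct-cube {r} k {bs} 2-unit 3-unit 2≤ nonEmpty short with split-at r k
  ... | σ@(split s d refl _ _ _) =
    subst (λ e → blocksProduct (P ^ suc r) (P * k) bs ≈ blocksProduct (P ^ r) k bs [ P ^ e ]) (lemma s d)
      (blocksProduct-≈ (suc s ℕ.+ suc r ℕ.+ suc s) σ 2≤ nonEmpty (All.map (λ {xs} (ne , sh) →
        short-block-ratio xs 2-unit 3-unit (ℕ.m≤m+n s d) (Split.P^s∣k σ) ne sh) (All.zip (nonEmpty , short))))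
    where
    lemma : ∀ s d → suc s ℕ.+ suc (s ℕ.+ d) ℕ.+ suc s ℕ.+ 2 ℕ.* d ≡ 3 ℕ.* suc (s ℕ.+ d)
    lemma = ℕ-Solver.solve-∀

-- The prime 2
module Two where

  open Blocks 2 prime[2] public

  even⊎odd : ∀ a → (P ∣ a) ⊎ ∃ λ c → a ≡ + 1 + + 2 * c
  even⊎odd a with a %ℕ 2 | n%ℕd<d a 2 | a≡a%ℕn+[a/ℕn]*n a 2
  ... | 0 | _ | eq = inj₁ (divides (a /ℕ 2) (trans eq (+-identityˡ _)))
  ... | 1 | _ | eq = inj₂ (a /ℕ 2 , trans eq (cong (_+_ (+ 1)) (*-comm (a /ℕ 2) (+ 2))))
  ... | suc (suc _) | s≤s (s≤s ()) | _

  Odd : ℤ → Set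
  Odd a = ∃ λ c → a ≡ + 1 + + 2 * c

  private
    *2≡+ : ∀ b → b ℕ.* 2 ≡ b ℕ.+ b
    *2≡+ = ℕ-Solver.solve-∀

    H≈H0-even : ∀ {q} a b → P ∣ + b → q ∣ P * a * (P * + b + P * a) → H (P * a) (b ℕ.* 2) ≈ H (+ 0) (b ℕ.* 2) [ q ]
    H≈H0-even {q} a b P∣b q∣D = subst (λ z → H (P * a) z ≈ H (+ 0) z [ q ]) (sym (*2≡+ b))
      (H≈H0-half b (P∣P* a) P∣b (subst (λ z → q ∣ P * a * (z + P * a)) (trans (sym (*p≡P* b)) (cong +_ (*2≡+ b))) q∣D))

  scaled-even : ∀ {q} a b → P ∣ a → P ∣ b → q ∣ P * a * (P * b + P * a) → q ∣ P * b * (P * a + P * b) →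
                Ratio q (+ 1) (binomℤ (P * a + P * b) (P * b)) (binomℤ (a + b) b)
  scaled-even a b P∣a P∣b D₁ D₂ = scaled a b
    (λ { b′ refl → ≈-1* (H≈H0-even a b′ P∣b D₁) })
    (λ { a′ refl → ≈-1* (H≈H0-even b a′ P∣a D₂) })

  private
    4∣2* : ∀ {a} → P ∣ a → P ^ 2 ∣ P * a
    4∣2* {a} P∣a = *-monoʳ-∣ P (subst (_∣ a) (sym (*-identityʳ P)) P∣a)

    4∣D : ∀ a b → P ^ 2 ∣ P * a * (P * b + P * a)
    4∣D a b = divides (a * (b + a)) (lemma a b)
      where
      lemma : ∀ a b → + 2 * a * (+ 2 * b + + 2 * a) ≡ a * (b + a) * (+ 2 * (+ 2 * + 1))
      lemma = solve-∀

    φ-odd : ∀ {x} → Odd x → φ x ≡ x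
    φ-odd (c , refl) = φ-∤ (λ 2∣x → unit⇒P∤ {+ 1} unit-1 (subst (P ∣_) (lemma c) (∣m∣n⇒∣m-n 2∣x (P∣P* c))))
      where
      lemma : ∀ c → + 1 + + 2 * c - + 2 * c ≡ + 1
      lemma = solve-∀

  -- Used as the start of the interval, twice an even entry is 0 modulo 4; used as its length, an
  -- even entry lets the halves be paired, and the correction B (A + B) is a product of two even
  -- numbers.
  scaled-one-even : ∀ a b → (P ∣ a) ⊎ (P ∣ b) → Ratio (P ^ 2) (+ 1) (binomℤ (P * a + P * b) (P * b)) (binomℤ (a + b) b)
  scaled-one-even a b (inj₁ P∣a) = scaled a b
    (λ { b′ refl → ≈-1* (H-cong-P (b′ ℕ.* 2) (P∣P^ {2} (s≤s z≤n)) (∣⇒≈0 (4∣2* P∣a))) })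
    (λ { a′ refl → ≈-1* (H≈H0-even b a′ P∣a (4∣D b (+ a′))) })
  scaled-one-even a b (inj₂ P∣b) = scaled a b
    (λ { b′ refl → ≈-1* (H≈H0-even a b′ P∣b (4∣D a (+ b′))) })
    (λ { a′ refl → ≈-1* (H-cong-P (a′ ℕ.* 2) (P∣P^ {2} (s≤s z≤n)) (∣⇒≈0 (4∣2* P∣b))) })

  private
    -- H (2a) L and H (2a + 2) L differ in the factors 2a + 1 ≡ -1 and 2a + 1 + L ≡ 1 (mod 4).
    H≈-H0 : ∀ a b → Odd a → Odd (+ b) → H (P * a) (b ℕ.* 2) ≈ - + 1 * H (+ 0) (b ℕ.* 2) [ P ^ 2 ]
    H≈-H0 a b (c , refl) (d , b≡) =
      ≈-trans (≈-reflexive (sym (*-identityʳ (H (P * a) L))))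
      (≈-trans (≈-*ˡ (H (P * a) L) (≈-sym 2a+1+L≈1))
      (≈-trans (≈-reflexive swap)
      (≈-* 2a+1≈-1 (H-cong-P {b = + 2 + P * a} {c = + 0} L (P∣P^ {2} (s≤s z≤n)) (+ 1 + c , lemma₃ c)))))
      where
      L = b ℕ.* 2
      e = + 1 + P * a
      L≡ : + L ≡ + 2 + + 4 * d
      L≡ = trans (*p≡P* b) (trans (cong (P *_) b≡) (lemma d))
        where
        lemma : ∀ d → + 2 * (+ 1 + + 2 * d) ≡ + 2 + + 4 * d
        lemma = solve-∀
      2a+1+L≈1 : e + + L ≈ + 1 [ P ^ 2 ]
      2a+1+L≈1 = + 1 + c + d , trans (cong (_+_ e) L≡) (lemma c d)
        where
        lemma : ∀ c d → + 1 + + 2 * (+ 1 + + 2 * c) + (+ 2 + + 4 * d) ≡ + 1 + (+ 1 + c + d) * (+ 2 * (+ 2 * + 1))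
        lemma = solve-∀
      2a+1≈-1 : e ≈ - + 1 [ P ^ 2 ]
      2a+1≈-1 = + 1 + c , lemma c
        where
        lemma : ∀ c → + 1 + + 2 * (+ 1 + + 2 * c) ≡ - + 1 + (+ 1 + c) * (+ 2 * (+ 2 * + 1))
        lemma = solve-∀
      lemma₃ : ∀ c → + 2 + + 2 * (+ 1 + + 2 * c) ≡ + 0 + (+ 1 + c) * (+ 2 * (+ 2 * + 1))
      lemma₃ = solve-∀
      φe : φ e ≡ e
      φe = φ-odd (a , refl)
      φ[e+L] : φ (e + + L) ≡ e + + L
      φ[e+L] = φ-odd (a + + 1 + + 2 * d , trans (cong (_+_ e) L≡) (lemma a d))
        where
        lemma : ∀ a d → + 1 + + 2 * a + (+ 2 + + 4 * d) ≡ + 1 + + 2 * (a + + 1 + + 2 * d)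
        lemma = solve-∀
      φ[1+e] : φ (+ 1 + e) ≡ + 1
      φ[1+e] = φ-∣ (divides (+ 1 + a) (lemma a))
        where
        lemma : ∀ a → + 1 + (+ 1 + + 2 * a) ≡ (+ 1 + a) * + 2
        lemma = solve-∀
      φ[1+e+L] : φ (+ 1 + e + + L) ≡ + 1
      φ[1+e+L] = φ-∣ (∣m∣n⇒∣m+n (divides (+ 1 + a) (lemma a)) (P∣*p b))
        where
        lemma : ∀ a → + 1 + (+ 1 + + 2 * a) ≡ (+ 1 + a) * + 2
        lemma = solve-∀
      swap : H (P * a) L * (e + + L) ≡ e * H (+ 2 + P * a) L
      swap = begin
        ∏ φ e L * (e + + L)                      ≡⟨ cong (∏ φ e L *_) φ[e+L] ⟨
        ∏ φ e (suc L)                            ≡⟨ ∏-head φ e L ⟩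
        φ e * ∏ φ (+ 1 + e) L                    ≡⟨ cong₂ _*_ φe (sym (*-identityʳ (∏ φ (+ 1 + e) L))) ⟩
        e * (∏ φ (+ 1 + e) L * + 1)              ≡⟨ cong (λ z → e * (∏ φ (+ 1 + e) L * z)) φ[1+e+L] ⟨
        e * ∏ φ (+ 1 + e) (suc L)                ≡⟨ cong (e *_) (∏-head φ (+ 1 + e) L) ⟩
        e * (φ (+ 1 + e) * ∏ φ (+ 1 + (+ 1 + e)) L)  ≡⟨ cong (λ z → e * (z * ∏ φ (+ 1 + (+ 1 + e)) L)) φ[1+e] ⟩
        e * (+ 1 * ∏ φ (+ 1 + (+ 1 + e)) L)      ≡⟨ cong (e *_) (trans (*-identityˡ _) (cong (λ z → ∏ φ z L) (lemma a))) ⟩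
        e * H (+ 2 + P * a) L                    ∎
        where
        open ≡-Reasoning
        lemma : ∀ a → + 1 + (+ 1 + (+ 1 + + 2 * a)) ≡ + 1 + (+ 2 + + 2 * a)
        lemma = solve-∀

  scaled-odd-odd : ∀ a b → Odd a → Odd b → Ratio (P ^ 2) (- + 1) (binomℤ (P * a + P * b) (P * b)) (binomℤ (a + b) b)
  scaled-odd-odd a b a-odd b-odd = scaled a b
    (λ { b′ refl → H≈-H0 a b′ a-odd b-odd })
    (λ { a′ refl → H≈-H0 b a′ b-odd a-odd })

  odd⇒unit : ∀ {a} → Odd a → Unit a
  odd⇒unit {a} (c , refl) = + 1 , (c , lemma c)
    where
    lemma : ∀ c → (+ 1 + + 2 * c) * + 1 ≡ + 1 + c * + 2
    lemma = solve-∀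

  odd+odd : ∀ {a b} → Odd a → Odd b → P ∣ a + b
  odd+odd (c , refl) (d , refl) = divides (+ 1 + c + d) (lemma c d)
    where
    lemma : ∀ c d → + 1 + + 2 * c + (+ 1 + + 2 * d) ≡ (+ 1 + c + d) * + 2
    lemma = solve-∀

  -- By absorption, b times the coefficient is a multiple of the even number a + b, and b is odd.
  binomℤ-odd-odd : ∀ a b → Odd a → Odd b → P ∣ binomℤ (a + b) b
  binomℤ-odd-odd a b a-odd b-odd = unit-cancel-P∣ (odd⇒unit b-odd) (∣k*binomℤ b (odd+odd a-odd b-odd))

  -- Two odd entries produce the factor -1 modulo 4, but then the coefficient is even, and -x ≡ x
  -- modulo 4 for even x.
  binomℤ-mod-4 : ∀ a b → binomℤ (P * a + P * b) (P * b) ≈ binomℤ (a + b) b [ P ^ 2 ]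
  binomℤ-mod-4 a b = cases (even⊎odd a) (even⊎odd b)
    where
    cases : (P ∣ a) ⊎ Odd a → (P ∣ b) ⊎ Odd b → binomℤ (P * a + P * b) (P * b) ≈ binomℤ (a + b) b [ P ^ 2 ]
    cases (inj₁ P∣a) _ = ≈-trans (ratio-≈ {2} (scaled-one-even a b (inj₁ P∣a))) (≈-reflexive (*-identityˡ _))
    cases (inj₂ _) (inj₁ P∣b) = ≈-trans (ratio-≈ {2} (scaled-one-even a b (inj₂ P∣b))) (≈-reflexive (*-identityˡ _))
    cases (inj₂ a-odd) (inj₂ b-odd) = ≈-trans (ratio-≈ {2} (scaled-odd-odd a b a-odd b-odd)) (-1*even≈ (binomℤ-odd-odd a b a-odd b-odd))
      where
      -1*even≈ : ∀ {x} → P ∣ x → - + 1 * x ≈ x [ P ^ 2 ]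
      -1*even≈ (divides k refl) = - k , lemma k
        where
        lemma : ∀ k → - + 1 * (k * + 2) ≡ k * + 2 + - k * (+ 2 * (+ 2 * + 1))
        lemma = solve-∀

  private
    P∣P^suc : ∀ r → P ∣ P ^ suc r
    P∣P^suc r = P∣P^ {suc r} (s≤s z≤n)

    even-odd : ∀ {a b} → P ∣ a → Odd b → Odd (a - b)
    even-odd (divides k refl) (c , refl) = k - c - + 1 , lemma k c
      where
      lemma : ∀ k c → k * + 2 - (+ 1 + + 2 * c) ≡ + 1 + + 2 * (k - c - + 1)
      lemma = solve-∀

    ratio-mod-2 : ∀ a b → Ratio (P ^ 1) (+ 1) (binomℤ (P * a + P * b) (P * b)) (binomℤ (a + b) b)
    ratio-mod-2 a b = cases (even⊎odd a) (even⊎odd b)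
      where
      2∣4 = ^-mono-∣ P {1} {2} (s≤s z≤n)
      cases : (P ∣ a) ⊎ Odd a → (P ∣ b) ⊎ Odd b → Ratio (P ^ 1) (+ 1) (binomℤ (P * a + P * b) (P * b)) (binomℤ (a + b) b)
      cases (inj₁ P∣a)    _             = ratio-weaken 2∣4 (scaled-one-even a b (inj₁ P∣a))
      cases (inj₂ _)      (inj₁ P∣b)    = ratio-weaken 2∣4 (scaled-one-even a b (inj₂ P∣b))
      cases (inj₂ a-odd)  (inj₂ b-odd)  = ratio-sign -1≈1 (ratio-weaken 2∣4 (scaled-odd-odd a b a-odd b-odd))
        where
        -1≈1 : - + 1 ≈ + 1 [ P ^ 1 ]
        -1≈1 = - + 1 , refl

    -- For r ≥ 1 and k odd all entries of the blocks are odd. After n blocks, either all block ratios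
    -- were ≡ -1 (mod 4), or a factor of 2 beyond 2 ^ (n r) has been gained.
    data TwoRatio (n r : ℕ) (x y : ℤ) : Set where
      all-odd : Ratio (P ^ 2) ((- + 1) ^ n) x y → P ^ (n ℕ.* r) ∣ y → TwoRatio n r x y
      gain    : Ratio (P ^ 1) (+ 1) x y → P ^ (1 ℕ.+ n ℕ.* r) ∣ y → TwoRatio n r x y

    [-1]^n≈1 : ∀ n → (- + 1) ^ n ≈ + 1 [ P ^ 1 ]
    [-1]^n≈1 zero    = ≈-refl
    [-1]^n≈1 (suc n) = ≈-trans (≈-*ˡ (- + 1) ([-1]^n≈1 n)) (- + 1 , refl)

    all-odd⇒mod-2 : ∀ {n x y} → Ratio (P ^ 2) ((- + 1) ^ n) x y → Ratio (P ^ 1) (+ 1) x y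
    all-odd⇒mod-2 {n} R = ratio-sign ([-1]^n≈1 n) (ratio-weaken (^-mono-∣ P {1} {2} (s≤s z≤n)) R)

    TwoRatio-* : ∀ {n r x y z w} → TwoRatio 1 r x y → TwoRatio n r z w → TwoRatio (suc n) r (x * z) (y * w)
    TwoRatio-* {n} {r} {y = y} {w = w} X Z = cases X Z
      where
      1*r = ℕ.*-identityˡ r
      gain-∣ : P ^ (suc (1 ℕ.* r ℕ.+ n ℕ.* r)) ∣ y * w → P ^ (1 ℕ.+ suc n ℕ.* r) ∣ y * w
      gain-∣ = subst (λ e → P ^ (suc (e ℕ.+ n ℕ.* r)) ∣ y * w) 1*r
      cases : TwoRatio 1 r _ _ → TwoRatio n r _ _ → TwoRatio (suc n) r _ _
      cases (all-odd R d) (all-odd S e) = all-odd (ratio-* R S) (subst (λ e → P ^ (e ℕ.+ n ℕ.* r) ∣ y * w) 1*r (^-∣-* (1 ℕ.* r) (n ℕ.* r) d e))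
      cases (all-odd R d) (gain S e)    = gain (ratio-* (all-odd⇒mod-2 {1} R) S) (gain-∣ (subst (λ a → P ^ a ∣ y * w) (ℕ.+-suc (1 ℕ.* r) (n ℕ.* r)) (^-∣-* (1 ℕ.* r) (1 ℕ.+ n ℕ.* r) d e)))
      cases (gain R d)    (all-odd S e) = gain (ratio-* R (all-odd⇒mod-2 {n} S)) (gain-∣ (^-∣-* (1 ℕ.+ 1 ℕ.* r) (n ℕ.* r) d e))
      cases (gain R d)    (gain S e)    = gain (ratio-* R S) (∣-trans (^-mono-∣ P (ℕ.n≤1+n (1 ℕ.+ suc n ℕ.* r))) (subst (λ a → P ^ a ∣ y * w) (cong suc (ℕ.+-suc r (n ℕ.* r)))
        (subst (λ e → P ^ (suc (e ℕ.+ (1 ℕ.+ n ℕ.* r))) ∣ y * w) 1*r (^-∣-* (1 ℕ.+ 1 ℕ.* r) (1 ℕ.+ n ℕ.* r) d e))))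

    -- For one entry x the only factor joins two odd numbers. For two, the first factor does, and
    -- the second joins an even sum with k, so the total sign is again -1. In a longer block the
    -- first factor is even, and a later one still carries the full power of 2 from the last entry.
    block-TwoRatio : ∀ {r k xs} → Odd k → NonEmpty xs → TwoRatio 1 (suc r) (scaledBlockTerm (P ^ suc (suc r)) (P * k) xs) (scaledBlockTerm (P ^ suc r) k xs)
    block-TwoRatio {r} {k} {xs} k-odd nonEmpty =
      subst (λ es → TwoRatio 1 (suc r) (multinomial es) (scaledBlockTerm (P ^ suc r) k xs)) (sym (entries-* P (P ^ suc r) k xs)) (cases xs nonEmpty)
      where
      entry : ∀ x → Odd (P ^ suc r * x - k)
      entry x = even-odd (∣m⇒∣m*n x (P∣P^suc r)) k-odd
      P^r∣ : ∀ xs → NonEmpty xs → P ^ (1 ℕ.* suc r) ∣ scaledBlockTerm (P ^ suc r) k xs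
      P^r∣ xs ne = subst (λ e → P ^ e ∣ scaledBlockTerm (P ^ suc r) k xs) (sym (ℕ.*-identityˡ (suc r)))
        (unit-cancel-∣ (suc r) (odd⇒unit k-odd) (∣k*scaledBlockTerm (P ^ suc r) k {xs} ne))
      cases : ∀ xs → NonEmpty xs → TwoRatio 1 (suc r) (multinomial (map (P *_) (entries (P ^ suc r) k xs))) (scaledBlockTerm (P ^ suc r) k xs)
      cases xs@(x ∷ []) ne = all-odd (ratio-* (scaled-odd-odd _ k (entry x) k-odd) ratio-refl) (P^r∣ xs ne)
      cases xs@(x ∷ y ∷ []) ne = all-odd (ratio-* (scaled-odd-odd a b (entry x) (entry y)) (ratio-* third ratio-refl)) (P^r∣ xs ne)
        where
        a = P ^ suc r * x - k
        b = P ^ suc r * y - k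
        third : Ratio (P ^ 2) (+ 1) (binomℤ (P * a + P * b + P * k) (P * k)) (binomℤ (a + b + k) k)
        third = subst (λ n → Ratio (P ^ 2) (+ 1) (binomℤ (n + P * k) (P * k)) (binomℤ (a + b + k) k)) (*-distribˡ-+ P a b)
          (scaled-one-even (a + b) k (inj₁ (odd+odd (entry x) (entry y))))
      cases xs@(x ∷ ys@(y ∷ z ∷ zs)) ne = gain
        (multinomialGo-ratio {P ^ 1} {λ _ → ⊤} P (λ _ _ → tt) (λ a b _ _ → ratio-mod-2 a b) {P ^ suc r * x - k} tt (All.universal (λ _ → tt) (entries (P ^ suc r) k ys)))
        (subst (λ e → P ^ (1 ℕ.+ e) ∣ scaledBlockTerm (P ^ suc r) k xs) (sym (ℕ.*-identityˡ (suc r)))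
          (^-∣-* 1 (suc r) (subst (_∣ binomℤ (a + b) b) (sym (*-identityʳ P)) (binomℤ-odd-odd a b (entry x) (entry y)))
            (unit-cancel-∣ (suc r) (odd⇒unit k-odd) (∣k*multinomialGo k (a + b) (P ^ suc r * z) (map (P ^ suc r *_) zs) (map-*-∣ (P ^ suc r) (z ∷ zs))))))
        where
        a = P ^ suc r * x - k
        b = P ^ suc r * y - k

    blocks-TwoRatio : ∀ {r k bs} → Odd k → All NonEmpty bs →
      TwoRatio (length bs) (suc r) (blocksProduct (P ^ suc (suc r)) (P * k) bs) (blocksProduct (P ^ suc r) k bs)
    blocks-TwoRatio                 k-odd []         = all-odd ratio-refl (divides (+ 1) refl)
    blocks-TwoRatio {r} {k} {xs ∷ bs} k-odd (ne ∷ nes) = TwoRatio-* {length bs} {suc r} {z = blocksProduct (P ^ suc (suc r)) (P * k) bs} {blocksProduct (P ^ suc r) k bs} (block-TwoRatio {r} {k} {xs} k-odd ne) (blocks-TwoRatio {r} {k} {bs} k-odd nes)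

    -- Two factors -1 give 1 modulo 4, hence the exponent 2 + 2(r + 1). For n ≥ 3 the sign is read
    -- modulo 2 only, and 1 + n(r + 1) is still at least 2(r + 2). A gained factor 2 likewise makes
    -- up for a ratio known modulo 2.
    TwoRatio⇒≈ : ∀ {n r x y} → 2 ℕ.≤ n → TwoRatio n (suc r) x y → x ≈ y [ P ^ (2 ℕ.* suc (suc r)) ]
    TwoRatio⇒≈ {n} {r} {x} {y} 2≤n (gain R d) = ≈-weaken
      (^-mono-∣ P (ℕ.≤-trans (ℕ.≤-reflexive (lemma r)) (s≤s (s≤s (ℕ.*-monoˡ-≤ (suc r) 2≤n)))))
      (≈-trans (ratio⇒≈ {1} {1 ℕ.+ n ℕ.* suc r} R d) (≈-reflexive (*-identityˡ y)))
      where
      lemma : ∀ r → 2 ℕ.* suc (suc r) ≡ 2 ℕ.+ 2 ℕ.* suc r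
      lemma = ℕ-Solver.solve-∀
    TwoRatio⇒≈ {2} {r} {x} {y} _ (all-odd R d) = subst (λ e → x ≈ y [ P ^ e ]) (lemma r)
      (≈-trans (ratio⇒≈ {2} {2 ℕ.* suc r} R d) (≈-reflexive (*-identityˡ y)))
      where
      lemma : ∀ r → 2 ℕ.+ 2 ℕ.* suc r ≡ 2 ℕ.* suc (suc r)
      lemma = ℕ-Solver.solve-∀
    TwoRatio⇒≈ {n@(suc (suc (suc m)))} {r} {x} {y} _ (all-odd R d) = ≈-weaken
      (^-mono-∣ P {2 ℕ.* suc (suc r)} {1 ℕ.+ n ℕ.* suc r} (ℕ.≤-trans (ℕ.m≤m+n (2 ℕ.* suc (suc r)) (r ℕ.+ m ℕ.* suc r)) (ℕ.≤-reflexive (lemma r m))))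
      (≈-trans (ratio⇒≈ {1} {n ℕ.* suc r} (all-odd⇒mod-2 {n} R) d) (≈-reflexive (*-identityˡ y)))
      where
      lemma : ∀ r m → 2 ℕ.* suc (suc r) ℕ.+ (r ℕ.+ m ℕ.* suc r) ≡ 1 ℕ.+ (3 ℕ.+ m) ℕ.* suc r
      lemma = ℕ-Solver.solve-∀
    TwoRatio⇒≈ {1} (s≤s ()) _

    squareScaling₂ : ∀ s → 1 ℕ.≤ s → SquareScaling s
    squareScaling₂ s 1≤s a b P^s∣a P^s∣b = scaled-even a b (∣-trans (P∣P^ 1≤s) P^s∣a) (∣-trans (P∣P^ 1≤s) P^s∣b)
      (^-∣-* (suc s) (suc s) Pa (∣m∣n⇒∣m+n Pb Pa)) (^-∣-* (suc s) (suc s) Pb (∣m∣n⇒∣m+n Pa Pb))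
      where
      Pa = P^suc∣ {s} P^s∣a
      Pb = P^suc∣ {s} P^s∣b

    blocksProduct-mod-4 : ∀ c k bs → blocksProduct (P * c) (P * k) bs ≈ blocksProduct c k bs [ P ^ 2 ]
    blocksProduct-mod-4 c k bs = blocksProduct-~ (P * c) (P * k) c k (All.universal (λ xs →
      scaledBlockTerm-~ {λ _ → ⊤} P (λ _ _ → tt) (λ a b _ _ → binomℤ-mod-4 a b) {c} {k} {xs} (All.universal (λ _ → tt) (entries c k xs))) bs)
      where open Multiplicative (λ x y → x ≈ y [ P ^ 2 ]) ≈-refl ≈-*

  -- At r = 0 the modulus is 4, where every single binomial factor is already congruent. For r ≥ 1
  -- an even k forces s ≥ 1, and halves can be paired; for odd k the signs have to be followed
  -- through the blocks.
  blocksProduct-square₂ : ∀ r k {bs} → 2 ℕ.≤ length bs → All NonEmpty bs →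
    blocksProduct (P ^ suc r) (P * k) bs ≈ blocksProduct (P ^ r) k bs [ P ^ (2 ℕ.* suc r) ]
  blocksProduct-square₂ zero    k {bs} 2≤ nonEmpty = blocksProduct-mod-4 (+ 1) k bs
  blocksProduct-square₂ (suc r) k {bs} 2≤ nonEmpty with even⊎odd k | split-at (suc r) k
  ... | inj₂ k-odd | _                                = TwoRatio⇒≈ {length bs} {r} 2≤ (blocks-TwoRatio {r} {k} k-odd nonEmpty)
  ... | inj₁ P∣k   | σ@(split (suc s) d _ _ _ _)      = blocksProduct-square {suc r} {k} {bs} σ (squareScaling₂ (suc s) (s≤s z≤n)) 2≤ nonEmpty
  ... | inj₁ P∣k   | split 0 d d≡ k′ k≡ (inj₁ d≡0)    = contradiction (trans (sym d≡0) d≡) λ ()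
  ... | inj₁ P∣k   | split 0 d d≡ k′ k≡ (inj₂ k′-unit) = contradiction (subst (P ∣_) (trans k≡ (*-identityˡ k′)) P∣k) (unit⇒P∤ k′-unit)

-- Terms with k prime to p

εpow-suc : ∀ {ε} → ε * ε ≡ + 1 → ∀ k → εpow ε (+ 1 + k) ≡ ε * εpow ε k
εpow-suc     εε≡1 (+ n)          = refl
εpow-suc {ε} εε≡1 -[1+ zero ]    = sym (trans (cong (ε *_) (*-identityʳ ε)) εε≡1)
εpow-suc {ε} εε≡1 -[1+ suc n ]   = sym (trans (sym (*-assoc ε ε _)) (trans (cong (_* ε ^ suc n) εε≡1) (*-identityˡ _)))

εpow-square : ∀ {ε} → ε * ε ≡ + 1 → ∀ k → εpow ε k * εpow ε k ≡ + 1
εpow-square {ε} εε≡1 k = go ∣ k ∣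
  where
  go : ∀ n → ε ^ n * ε ^ n ≡ + 1
  go zero    = refl
  go (suc n) = trans (lemma ε (ε ^ n)) (cong₂ _*_ εε≡1 (go n))
    where
    lemma : ∀ a b → a * b * (a * b) ≡ a * a * (b * b)
    lemma = solve-∀

-- `εpow` is defined through the absolute value, so additivity across signs rests on ε² = 1: a
-- negative exponent is reduced to a positive one by inserting an even power of ε.
εpow-+ : ∀ {ε} → ε * ε ≡ + 1 → ∀ j k → εpow ε (j + k) ≡ εpow ε j * εpow ε k
εpow-+ {ε} εε≡1 (+ n)    k = go n
  where
  go : ∀ n → εpow ε (+ n + k) ≡ ε ^ n * εpow ε k
  go zero    = trans (cong (εpow ε) (+-identityˡ k)) (sym (*-identityˡ (εpow ε k)))
  go (suc n) = trans (cong (εpow ε) (+-assoc (+ 1) (+ n) k)) (trans (εpow-suc εε≡1 (+ n + k))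
    (trans (cong (ε *_) (go n)) (sym (*-assoc ε (ε ^ n) (εpow ε k)))))
εpow-+ {ε} εε≡1 -[1+ n ] k = begin
  εpow ε (-[1+ n ] + k)                                        ≡⟨ *-identityˡ _ ⟨
  + 1 * εpow ε (-[1+ n ] + k)                                  ≡⟨ cong (_* εpow ε (-[1+ n ] + k)) (εpow-square {ε} εε≡1 (+ suc n)) ⟨
  ε ^ suc n * ε ^ suc n * εpow ε (-[1+ n ] + k)                ≡⟨ *-assoc (ε ^ suc n) (ε ^ suc n) _ ⟩
  ε ^ suc n * (ε ^ suc n * εpow ε (-[1+ n ] + k))              ≡⟨ cong (ε ^ suc n *_) (εpow-+ εε≡1 (+ suc n) (-[1+ n ] + k)) ⟨
  ε ^ suc n * εpow ε (+ suc n + (-[1+ n ] + k))                ≡⟨ cong (λ z → ε ^ suc n * εpow ε z) (lemma (+ suc n) k) ⟩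
  ε ^ suc n * εpow ε k                                         ∎
  where
  open ≡-Reasoning
  lemma : ∀ n k → n + (- n + k) ≡ k
  lemma = solve-∀

εpow-neg : ∀ ε k → εpow ε (- k) ≡ εpow ε k
εpow-neg ε k = cong (ε ^_) (∣-i∣≡∣i∣ k)

^-fixed : ∀ {ε : ℤ} {m} → ε ^ m ≡ ε → ∀ s → ε ^ (m ℕ.^ s) ≡ ε
^-fixed {ε}     ε^m≡ε zero    = *-identityʳ ε
^-fixed {ε} {m} ε^m≡ε (suc s) = trans (sym (^-*-assoc ε m (m ℕ.^ s))) (trans (cong (_^ (m ℕ.^ s)) ε^m≡ε) (^-fixed ε^m≡ε s))

module PrimeToPTerms (p : ℕ) (p-prime : Prime p) where

  open Blocks p p-prime public

  unit-below-p : ∀ m {i} → suc i ℕ.< p → Unit (+ 1 + (P * m + + i))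
  unit-below-p m {i} i+1<p = P∤⇒unit (subst (λ z → ¬ P ∣ z) (+-assoc (+ 1) (P * m) (+ i))
    (P∤1+Pm+j m i (ℕ.s≤s⁻¹ (subst (suc i ℕ.<_) p≡suc-p-1 i+1<p))))

  -- For i = 0, passing from the tops P Y and Y to P Y - 1 and Y - 1 multiplies both coefficients by
  -- the same (Y - m) / Y, and P Y ≠ 0 can be cancelled. A further step from k to k + 1 multiplies
  -- by (P Y - 1 - k) / (1 + k), where 1 + k is a unit and P Y ≡ 0, that is by -1.
  binomℤ-floor : ∀ {R} Y m → Unit (+ 2) → NonZero Y → 1 ℕ.≤ R → P ^ R ∣ P * Y → ∀ i → i ℕ.< p →
                 Ratio (P ^ R) ((- + 1) ^ i) (binomℤ (P * Y - + 1) (P * m + + i)) (binomℤ (Y - + 1) m)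
  binomℤ-floor {R} Y m 2-unit Y≢0 1≤R P^R∣PY zero 0<p = base (scaled-odd R (Y - m) m 2-unit
      (subst (λ z → P ^ R ∣ P * (Y - m) * z) (lemma₁ P Y m) (∣n⇒∣m*n (P * (Y - m)) P^R∣PY))
      (subst (λ z → P ^ R ∣ P * m * z) (lemma₂ P Y m) (∣n⇒∣m*n (P * m) P^R∣PY)))
    where
    lemma₁ : ∀ P Y m → P * Y ≡ P * m + P * (Y - m)
    lemma₁ = solve-∀
    lemma₂ : ∀ P Y m → P * Y ≡ P * (Y - m) + P * m
    lemma₂ = solve-∀
    instance
      _ = Y≢0
      _ = i*j≢0 P Y
    base : Ratio (P ^ R) (+ 1) (binomℤ (P * (Y - m) + P * m) (P * m)) (binomℤ (Y - m + m) m) →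
           Ratio (P ^ R) (+ 1) (binomℤ (P * Y - + 1) (P * m + + 0)) (binomℤ (Y - + 1) m)
    base (ratio {V} {U} V-unit U≈V eq) = ratio V-unit U≈V (*-cancelˡ-≡ (P * Y) _ _ (begin
      P * Y * (V * binomℤ (P * Y - + 1) (P * m + + 0))            ≡⟨ cong (λ z → P * Y * (V * binomℤ (P * Y - + 1) z)) (+-identityʳ (P * m)) ⟩
      P * Y * (V * binomℤ (P * Y - + 1) (P * m))                  ≡⟨ lemma₃ (P * Y) V (binomℤ (P * Y - + 1) (P * m)) ⟩
      V * (P * Y * binomℤ (P * Y - + 1) (P * m))                  ≡⟨ cong (V *_) (binomℤ-absorb′ (P * Y) (P * m)) ⟨
      V * ((P * Y - P * m) * binomℤ (P * Y) (P * m))              ≡⟨ lemma₄ V P Y m (binomℤ (P * Y) (P * m)) ⟩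
      P * (Y - m) * (V * binomℤ (P * Y) (P * m))                  ≡⟨ cong (λ z → P * (Y - m) * (V * binomℤ z (P * m))) (lemma₂ P Y m) ⟩
      P * (Y - m) * (V * binomℤ (P * (Y - m) + P * m) (P * m))    ≡⟨ cong (P * (Y - m) *_) eq ⟩
      P * (Y - m) * (U * binomℤ (Y - m + m) m)                    ≡⟨ cong (λ z → P * (Y - m) * (U * binomℤ z m)) (i-j+j≡i Y m) ⟩
      P * (Y - m) * (U * binomℤ Y m)                              ≡⟨ lemma₅ P (Y - m) U (binomℤ Y m) ⟩
      P * (U * ((Y - m) * binomℤ Y m))                            ≡⟨ cong (λ z → P * (U * z)) (binomℤ-absorb′ Y m) ⟩
      P * (U * (Y * binomℤ (Y - + 1) m))                          ≡⟨ lemma₅ P Y U (binomℤ (Y - + 1) m) ⟨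
      P * Y * (U * binomℤ (Y - + 1) m)                            ∎))
      where
      open ≡-Reasoning
      lemma₃ : ∀ a V b → a * (V * b) ≡ V * (a * b)
      lemma₃ = solve-∀
      lemma₄ : ∀ V P Y m b → V * ((P * Y - P * m) * b) ≡ P * (Y - m) * (V * b)
      lemma₄ = solve-∀
      lemma₅ : ∀ P Y U b → P * Y * (U * b) ≡ P * (U * (Y * b))
      lemma₅ = solve-∀
  binomℤ-floor {R} Y m 2-unit Y≢0 1≤R P^R∣PY (suc i) i+1<p =
    ratio-trans step (binomℤ-floor {R} Y m 2-unit Y≢0 1≤R P^R∣PY i (ℕ.<-trans (ℕ.n<1+n i) i+1<p))
    where
    k = P * m + + i
    lemma : ∀ a i → a + (+ 1 + i) ≡ + 1 + (a + i)
    lemma = solve-∀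
    lemma′ : ∀ x k → x - + 1 - k ≡ x + - + 1 * (+ 1 + k)
    lemma′ = solve-∀
    step : Ratio (P ^ R) (- + 1) (binomℤ (P * Y - + 1) (P * m + + suc i)) (binomℤ (P * Y - + 1) k)
    step = ratio {V = + 1 + k} {U = P * Y - + 1 - k} (unit-below-p m i+1<p)
      (≈-trans (≈-reflexive (lemma′ (P * Y) k)) (≈-trans (≈-+ʳ (- + 1 * (+ 1 + k)) (∣⇒≈0 P^R∣PY)) (≈-reflexive (+-identityˡ _))))
      (trans (cong (λ z → (+ 1 + k) * binomℤ (P * Y - + 1) z) (lemma (P * m) (+ i))) (binomℤ-step (P * Y - + 1) k))

  -- Raising the top by one multiplies the coefficient by (a + P y) / a with the unit a = P w + i +
  -- 1, and P y ≡ 0 modulo P^R.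
  binomℤ-floor-top : ∀ {R} w y → 1 ℕ.≤ R → P ^ R ∣ P * y → ∀ i → i ℕ.< p →
                     Ratio (P ^ R) (+ 1) (binomℤ (P * w + + i + P * y) (P * y)) (binomℤ (w + y) y)
  binomℤ-floor-top {R} w y 1≤R P^R∣Py zero    0<p =
    subst (λ z → Ratio (P ^ R) (+ 1) (binomℤ (z + P * y) (P * y)) (binomℤ (w + y) y)) (sym (+-identityʳ (P * w))) (scaled-bottom R w y 1≤R P^R∣Py)
  binomℤ-floor-top {R} w y 1≤R P^R∣Py (suc i) i+1<p =
    ratio-trans step (binomℤ-floor-top {R} w y 1≤R P^R∣Py i (ℕ.<-trans (ℕ.n<1+n i) i+1<p))
    where
    K = P * y
    n = P * w + + suc i + K
    a = + 1 + (P * w + + i)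
    lemma₁ : ∀ w i K → + 1 + (w + i) ≡ w + (+ 1 + i) + K - K
    lemma₁ = solve-∀
    lemma₂ : ∀ w i K → w + (+ 1 + i) + K ≡ K + (+ 1 + (w + i))
    lemma₂ = solve-∀
    lemma₃ : ∀ w i K → w + (+ 1 + i) + K - + 1 ≡ w + i + K
    lemma₃ = solve-∀
    step : Ratio (P ^ R) (+ 1) (binomℤ n K) (binomℤ (P * w + + i + K) K)
    step = ratio {V = a} {U = n} (unit-below-p w i+1<p)
      (≈-1* (≈-trans (≈-reflexive (lemma₂ (P * w) (+ i) K)) (≈-trans (≈-+ʳ a (∣⇒≈0 P^R∣Py)) (≈-reflexive (+-identityˡ a)))))
      (trans (cong (_* binomℤ n K) (lemma₁ (P * w) (+ i) K)) (trans (binomℤ-absorb′ n K) (cong (λ z → n * binomℤ z K) (lemma₃ (P * w) (+ i) K))))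

  -- One block's share of the function F_r of the overview; `blockFactor` takes x to be the last
  -- entry of the block. The argument k - 1 comes from absorption, which splits off k and P^r x.
  record BlockFactor (xs : List ℤ) : Set where
    field
      x        : ℤ
      f        : ℕ → ℤ → ℤ
      k*block  : ∀ r k → k * scaledBlockTerm (P ^ r) k xs ≡ P ^ r * x * f r (k - + 1)
      f-floor  : NonZero x → ∀ r m i → i ℕ.< p → Ratio (P ^ suc r) ((- + 1) ^ i) (f (suc r) (P * m + + i)) (f r m)

  blockFactor : Unit (+ 2) → ∀ xs → NonEmpty xs → length xs ℕ.≤ 2 → BlockFactor xs
  blockFactor 2-unit (x ∷ []) _ _ = record
    { x = x
    ; f = λ r m → binomℤ (P ^ r * x - + 1) m
    ; k*block = λ r k → trans (cong (k *_) (*-identityʳ (binomℤ (P ^ r * x - k + k) k)))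
        (trans (cong (λ z → k * binomℤ z k) (i-j+j≡i (P ^ r * x) k)) (binomℤ-absorb (P ^ r * x) k))
    ; f-floor = λ x≢0 r m i i<p → subst (λ z → Ratio (P ^ suc r) ((- + 1) ^ i) (binomℤ (z - + 1) (P * m + + i)) (binomℤ (P ^ r * x - + 1) m))
        (sym (*-assoc P (P ^ r) x))
        (binomℤ-floor {suc r} (P ^ r * x) m 2-unit (i*j≢0 (P ^ r) x {{P^-nonZero r}} {{x≢0}}) (s≤s z≤n) (P^suc∣ {r} (∣m⇒∣m*n x ∣-refl)) i i<p)
    }
  blockFactor 2-unit (x₁ ∷ x₂ ∷ []) _ _ = record
    { x = x₂
    ; f = f
    ; k*block = k*block
    ; f-floor = λ x≢0 r m i i<p → subst (λ σ → Ratio (P ^ suc r) σ (f (suc r) (P * m + + i)) (f r m)) (*-identityʳ ((- + 1) ^ i))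
        (subst (λ z → Ratio (P ^ suc r) ((- + 1) ^ i * + 1) z (f r m)) (f-shape r m i i<p)
          (ratio-* (binomℤ-floor {suc r} (P ^ r * x₂) m 2-unit (i*j≢0 (P ^ r) x₂ {{P^-nonZero r}} {{x≢0}}) (s≤s z≤n) (P^suc∣ {r} (∣m⇒∣m*n x₂ ∣-refl)) i i<p)
            (binomℤ-floor-top {suc r} (P ^ r * x₁ - + 1 - m) (P ^ r * x₂) (s≤s z≤n) (P^suc∣ {r} (∣m⇒∣m*n x₂ ∣-refl)) (p ℕ.∸ suc i) (ℕ.∸-monoʳ-< (s≤s z≤n) i<p))))
    }
    where
    f : ℕ → ℤ → ℤ
    f r m = binomℤ (P ^ r * x₂ - + 1) m * binomℤ (P ^ r * x₁ - + 1 - m + P ^ r * x₂) (P ^ r * x₂)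

    -- Subtracting P m + i from P^(r+1) x₁ - 1 leaves the quotient P^r x₁ - 1 - m and the
    -- complementary digit p - 1 - i, so `binomℤ-floor-top` applies with p - 1 - i in place of i.
    f-shape : ∀ r m i → i ℕ.< p → binomℤ (P * (P ^ r * x₂) - + 1) (P * m + + i) *
        binomℤ (P * (P ^ r * x₁ - + 1 - m) + + (p ℕ.∸ suc i) + P * (P ^ r * x₂)) (P * (P ^ r * x₂)) ≡ f (suc r) (P * m + + i)
    f-shape r m i i<p = trans (cong (λ z → binomℤ (P * (P ^ r * x₂) - + 1) (P * m + + i) * binomℤ (z + P * (P ^ r * x₂)) (P * (P ^ r * x₂)))
        (trans (cong (λ z → P * (P ^ r * x₁ - + 1 - m) + z) p-1-i) (lemma P (P ^ r) x₁ m (+ i))))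
      (cong (λ z → binomℤ (z - + 1) (P * m + + i) * binomℤ (P * P ^ r * x₁ - + 1 - (P * m + + i) + z) z) (sym (*-assoc P (P ^ r) x₂)))
      where
      p-1-i : + (p ℕ.∸ suc i) ≡ P - (+ 1 + + i)
      p-1-i = trans (sym (⊖-≥ i<p)) (sym (m-n≡m⊖n p (suc i)))
      lemma : ∀ P Q x m i → P * (Q * x - + 1 - m) + (P - (+ 1 + i)) ≡ P * Q * x - + 1 - (P * m + i)
      lemma = solve-∀

    k*block : ∀ r k → k * scaledBlockTerm (P ^ r) k (x₁ ∷ x₂ ∷ []) ≡ P ^ r * x₂ * f r (k - + 1)
    k*block r k = begin
      k * (binomℤ (a + b) b * (binomℤ (a + b + k) k * + 1))      ≡⟨ cong (λ z → k * (binomℤ (a + b) b * z)) (*-identityʳ (binomℤ (a + b + k) k)) ⟩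
      k * trinomial a b k                                        ≡⟨ cong (k *_) (trinomial-cyclic a b k) ⟩
      k * (binomℤ (b + k) k * binomℤ (b + k + a) a)              ≡⟨ cong (λ z → k * (binomℤ z k * binomℤ (z + a) a)) (i-j+j≡i X k) ⟩
      k * (binomℤ X k * binomℤ (X + a) a)                        ≡⟨ *-assoc k (binomℤ X k) _ ⟨
      k * binomℤ X k * binomℤ (X + a) a                          ≡⟨ cong₂ _*_ (binomℤ-absorb X k) (sym (binomℤ-+-sym X a)) ⟩
      X * binomℤ (X - + 1) (k - + 1) * binomℤ (X + a) X          ≡⟨ cong (λ z → X * binomℤ (X - + 1) (k - + 1) * binomℤ z X) (lemma X (P ^ r * x₁) k) ⟩
      X * binomℤ (X - + 1) (k - + 1) * binomℤ (P ^ r * x₁ - + 1 - (k - + 1) + X) X  ≡⟨ *-assoc X _ _ ⟩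
      X * f r (k - + 1)                                          ∎
      where
      open ≡-Reasoning
      X = P ^ r * x₂
      a = P ^ r * x₁ - k
      b = P ^ r * x₂ - k
      lemma : ∀ X x k → X + (x - k) ≡ x - + 1 - (k - + 1) + X
      lemma = solve-∀
  blockFactor _ (_ ∷ _ ∷ _ ∷ _) _ (s≤s (s≤s ()))

  -- Each step replaces F (suc r) by F r and the weights by their sums over blocks of length p.
  weighted-sum : ∀ r e (g : ℤ → ℤ) (F : ℕ → ℤ → ℤ) → (∀ r m i → i ℕ.< p → F (suc r) (P * m + + i) ≈ F r m [ P ^ suc r ]) →
    (∀ s → s ℕ.≤ r → ∀ m → ∑ g (+ (p ℕ.^ s) * m) (p ℕ.^ s) ≈ + 0 [ P ^ (s ℕ.+ e) ]) →
    ∀ c L → ∑ (λ m → g m * F r m) (+ (p ℕ.^ r) * c) (L ℕ.* p ℕ.^ r) ≈ + 0 [ P ^ (r ℕ.+ e) ]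
  weighted-sum zero    e g F F-floor g≈0 c L = ∑-zero-≈ {f = λ m → g m * F 0 m} {c = + 1 * c} (L ℕ.* 1) λ j _ →
    ≈-*ʳ (F 0 (+ 1 * c + + j)) (g≈0-at (+ 1 * c + + j))
    where
    g≈0-at : ∀ m → g m ≈ + 0 [ P ^ e ]
    g≈0-at m = subst (λ z → z ≈ + 0 [ P ^ e ]) (trans (+-identityˡ _) (cong g (trans (+-identityʳ _) (*-identityˡ m)))) (g≈0 0 z≤n m)
  weighted-sum (suc r) e g F F-floor g≈0 c L =
    ≈-trans (≈-reflexive (trans (cong₂ (∑ (λ m → g m * F (suc r) m)) start (lemma p (p ℕ.^ r) L)) (∑-group (λ m → g m * F (suc r) m) p (+ (p ℕ.^ r) * c) (L ℕ.* p ℕ.^ r))))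
    (≈-trans (∑-cong-≈ {c = c₀} {d = c₀} (L ℕ.* p ℕ.^ r) λ j _ → inner (c₀ + + j))
    (subst (λ e′ → ∑ (λ m → g′ m * F r m) c₀ (L ℕ.* p ℕ.^ r) ≈ + 0 [ P ^ e′ ]) (ℕ.+-suc r e) (weighted-sum r (suc e) g′ F F-floor g′≈0 c L)))
    where
    c₀ = + (p ℕ.^ r) * c
    start : + (p ℕ.^ suc r) * c ≡ P * c₀
    start = trans (cong (_* c) (pos-* p (p ℕ.^ r))) (*-assoc P (+ (p ℕ.^ r)) c)
    lemma : ∀ p q L → L ℕ.* (p ℕ.* q) ≡ L ℕ.* q ℕ.* p
    lemma = ℕ-Solver.solve-∀
    g′ : ℤ → ℤ
    g′ m = ∑ g (P * m) p
    P^e∣g : ∀ m → P ^ e ∣ g m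
    P^e∣g m = ≈0⇒∣ (subst (λ z → z ≈ + 0 [ P ^ e ]) (trans (+-identityˡ _) (cong g (trans (+-identityʳ _) (*-identityˡ m)))) (g≈0 0 z≤n m))
    -- The weight is divisible by P^e and F is replaced with an error P^(r+1), so the error is
    -- P^(r+1+e). The new weights gain one factor P while r drops by one, and r + e stays the same.
    inner : ∀ m → ∑ (λ x → g x * F (suc r) x) (P * m) p ≈ g′ m * F r m [ P ^ (suc r ℕ.+ e) ]
    inner m = ≈-trans (∑-cong-≈ {f = λ x → g x * F (suc r) x} {g = λ x → F r m * g x} {c = P * m} {d = P * m} p λ i i<p →
        subst (λ q → g (P * m + + i) * F (suc r) (P * m + + i) ≈ F r m * g (P * m + + i) [ q ])
          (trans (sym (^-distribˡ-+-* P e (suc r))) (cong (P ^_) (ℕ.+-comm e (suc r))))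
          (≈-trans (≈-mod-* (P^e∣g (P * m + + i)) (F-floor r m i i<p)) (≈-reflexive (*-comm (g (P * m + + i)) (F r m)))))
      (≈-reflexive (trans (∑-distrib (F r m) g (P * m) p) (*-comm (F r m) (g′ m))))
    g′≈0 : ∀ s → s ℕ.≤ r → ∀ m → ∑ g′ (+ (p ℕ.^ s) * m) (p ℕ.^ s) ≈ + 0 [ P ^ (s ℕ.+ suc e) ]
    g′≈0 s s≤r m = subst₂ (λ z e′ → z ≈ + 0 [ P ^ e′ ])
      (trans (cong₂ (∑ g) (trans (cong (_* m) (pos-* p (p ℕ.^ s))) (*-assoc P (+ (p ℕ.^ s)) m)) (ℕ.*-comm p (p ℕ.^ s)))
        (∑-group g p (+ (p ℕ.^ s) * m) (p ℕ.^ s)))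
      (sym (ℕ.+-suc s e)) (g≈0 (suc s) (s≤s s≤r) m)

-- The sum over the indices prime to p

module PrimeToPSum (p : ℕ) (p-prime : Prime p) where

  open PrimeToPTerms p p-prime public

  εTerm : ℤ → ℕ → List (List ℤ) → ℤ → ℤ
  εTerm ε r bs k = εpow ε k * blocksProduct (P ^ r) k bs

  module _ (2-unit : Unit (+ 2)) (3-unit : Unit (+ 3)) (M : ℕ) where

    open Inverse M

    private
      inv²-at-P : ∀ {ε x} → P ∣ x → εpow ε x * inv² x ≡ + 0
      inv²-at-P {ε} {x} P∣x = trans (cong (λ z → εpow ε x * (z * inv x)) (inv-∣ P∣x)) (*-zeroʳ (εpow ε x))

    -- For ε = -1, k ↦ 2 c + q - k reverses the interval and flips the sign of ε ^ k, as q = p ^ s is odd.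
    ∑ε^k*inv²≈0 : ∀ ε → ε ≡ + 1 ⊎ ε ≡ - + 1 → ε ^ p ≡ ε → ∀ s → s ℕ.≤ M → ∀ m →
                  ∑ (λ x → εpow ε (+ 1 + x) * inv² (+ 1 + x)) (+ (p ℕ.^ s) * m) (p ℕ.^ s) ≈ + 0 [ P ^ s ]
    ∑ε^k*inv²≈0 .(+ 1) (inj₁ refl) _ s s≤M m = ≈-trans
      (≈-reflexive (∑-cong {f = λ x → εpow (+ 1) (+ 1 + x) * inv² (+ 1 + x)} {g = inv²} {c = c} {d = + 1 + c} (p ℕ.^ s) λ j _ → trans
        (cong (_* inv² (+ 1 + (c + + j))) (^-zeroˡ ∣ + 1 + (c + + j) ∣)) (trans (*-identityˡ _) (cong inv² (sym (+-assoc (+ 1) c (+ j)))))))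
      (∑inv²≈0 2-unit 3-unit s s≤M (+ 1 + c))
      where c = + (p ℕ.^ s) * m
    ∑ε^k*inv²≈0 .(- + 1) (inj₂ refl) ε^p≡ε zero s≤M m = ≈-mod-1 {q = P}
    ∑ε^k*inv²≈0 .(- + 1) (inj₂ refl) ε^p≡ε s@(suc _) s≤M m = ≈-trans
      (≈-reflexive (∑-cong {f = λ x → u (+ 1 + x)} {g = u} {c = c} {d = + 1 + c} q λ j _ → cong u (sym (+-assoc (+ 1) c (+ j)))))
      (∣⇒≈0 (unit-cancel-∣ s 2-unit (subst (P ^ s ∣_) (lemma S₁) (≈⇒∣ S₁≈-S₁))))
      where
      q = p ℕ.^ s
      c = + q * m
      u : ℤ → ℤ
      u x = εpow (- + 1) x * inv² x
      S₁ = ∑ u (+ 1 + c) q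
      q∣c : P ^ s ∣ c
      q∣c = ∣m⇒∣m*n m (subst (_∣ + q) (pos-^ p s) ∣-refl)
      q∣q : P ^ s ∣ + q
      q∣q = subst (_∣ + q) (pos-^ p s) ∣-refl
      P∣q = P∣P^ {s} (s≤s z≤n)
      lemma : ∀ x → x - - x ≡ + 2 * x
      lemma = solve-∀

      -- The reflection leads from (c , c + q] to [c , c + q); the two differ in multiples of p
      -- only, where the summand is 0.
      S₁≡S₀ : S₁ ≡ ∑ u c q
      S₁≡S₀ = begin
        S₁                      ≡⟨ +-identityˡ S₁ ⟨
        + 0 + S₁                ≡⟨ cong (_+ S₁) (inv²-at-P (∣-trans P∣q q∣c)) ⟨
        u c + S₁                ≡⟨ ∑-head u c q ⟨
        ∑ u c q + u (c + + q)   ≡⟨ cong (_+_ (∑ u c q)) (inv²-at-P (∣-trans P∣q (∣m∣n⇒∣m+n q∣c q∣q))) ⟩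
        ∑ u c q + + 0           ≡⟨ +-identityʳ _ ⟩
        ∑ u c q                 ∎
        where open ≡-Reasoning

      sign : ∀ x → εpow (- + 1) (c + + q + c - x) ≡ - + 1 * εpow (- + 1) x
      sign x = begin
        ε^ (c + + q + c - x)                       ≡⟨ εpow-+ {ε} refl (c + + q + c) (- x) ⟩
        ε^ (c + + q + c) * ε^ (- x)                ≡⟨ cong₂ _*_ (trans (εpow-+ {ε} refl (c + + q) c) (cong (_* ε^ c) (εpow-+ {ε} refl c (+ q)))) (εpow-neg ε x) ⟩
        ε^ c * ε^ (+ q) * ε^ c * ε^ x              ≡⟨ rearrange (ε^ c) (ε^ (+ q)) (ε^ x) ⟩
        ε^ c * ε^ c * (ε^ (+ q) * ε^ x)            ≡⟨ cong₂ (λ a b → a * (b * ε^ x)) (εpow-square {ε} refl c) (^-fixed {ε} {p} ε^p≡ε s) ⟩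
        + 1 * (- + 1 * ε^ x)                       ≡⟨ *-identityˡ _ ⟩
        - + 1 * ε^ x                               ∎
        where
        open ≡-Reasoning
        ε = - + 1
        ε^ = εpow ε
        rearrange : ∀ a b x → a * b * a * x ≡ a * a * (b * x)
        rearrange = solve-∀

      u-flip : ∀ x → u (c + + q + c - x) ≈ - + 1 * u x [ P ^ s ]
      u-flip x = ≈-trans (≈-reflexive (trans (cong (_* inv² y) (sign x)) (*-assoc (- + 1) (εpow (- + 1) x) (inv² y))))
        (≈-*ˡ (- + 1) (≈-*ˡ (εpow (- + 1) x) (≈-trans (≈-reflexive (sym (*-identityˡ (inv² y))))
          (inv²-scale s s≤M (unit-neg unit-1) (≈-trans (≈-+ʳ (- x) (∣⇒≈0 (∣m∣n⇒∣m+n (∣m∣n⇒∣m+n q∣c q∣q) q∣c))) (≈-reflexive (lemma′ x)))))))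
        where
        y = c + + q + c - x
        lemma′ : ∀ x → + 0 - x ≡ - + 1 * x
        lemma′ = solve-∀

      S₁≈-S₁ : S₁ ≈ - S₁ [ P ^ s ]
      S₁≈-S₁ = ≈-trans (≈-reflexive (∑-reverse u (+ 1 + c) c q))
        (≈-trans (∑-cong-≈ {g = λ x → - + 1 * u x} {c = c} {d = c} q λ j _ → ≈-trans (≈-reflexive (cong u (lemma″ c (+ q) (c + + j)))) (u-flip (c + + j)))
        (≈-reflexive (trans (∑-distrib (- + 1) u c q) (trans (-1*i≡-i _) (cong -_ (sym S₁≡S₀))))))
        where
        lemma″ : ∀ c q x → + 1 + c + c + q - + 1 - x ≡ c + q + c - x
        lemma″ = solve-∀

  private
    unit-1+Pm+j : ∀ m {j} → j ℕ.< p-1 → Unit (+ 1 + P * m + + j)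
    unit-1+Pm+j m {j} j<p-1 = P∤⇒unit (P∤1+Pm+j m j j<p-1)

  -- The double sum runs through the integers prime to p between P c and P (c + L), arranged by the
  -- quotient m on which F_r depends.
  PrimeToPSum : ℤ → ℕ → List (List ℤ) → ℤ → ℕ → ℤ
  PrimeToPSum ε r bs c L = ∑ (λ m → ∑ (εTerm ε r bs) (+ 1 + P * m) p-1) c L

  PrimeToPSum≈0 : ∀ {q} ε r bs → (∀ k → Unit k → q ∣ blocksProduct (P ^ r) k bs) → ∀ c L → PrimeToPSum ε r bs c L ≈ + 0 [ q ]
  PrimeToPSum≈0 ε r bs q∣ c L = ∑-zero-≈ {c = c} L λ j _ → ∑-zero-≈ {c = + 1 + P * (c + + j)} p-1 λ i i<p-1 →
    ∣⇒≈0 (∣n⇒∣m*n (εpow ε (+ 1 + P * (c + + j) + + i)) (q∣ _ (unit-1+Pm+j (c + + j) i<p-1)))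

  private
    -- The factors P^R split off from the two blocks give P^(2R), and the remaining weighted sum
    -- vanishes modulo P^R. The signs (-1)^i of the two floor congruences cancel each other.
    two-blocks : Unit (+ 2) → Unit (+ 3) → ∀ ε → ε ≡ + 1 ⊎ ε ≡ - + 1 → ε ^ p ≡ ε → ∀ r b₁ b₂ (F₁ : BlockFactor b₁) (F₂ : BlockFactor b₂) →
      NonZero (BlockFactor.x F₁) → NonZero (BlockFactor.x F₂) → ∀ c L →
      PrimeToPSum ε (suc r) (b₁ ∷ b₂ ∷ []) (+ (p ℕ.^ r) * c) (L ℕ.* p ℕ.^ r) ≈ + 0 [ P ^ (3 ℕ.* suc r) ]
    two-blocks 2-unit 3-unit ε ε≡±1 ε^p≡ε r b₁ b₂ F₁ F₂ x₁≢0 x₂≢0 c L =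
      ≈-trans (∑-cong-≈ {f = λ m → ∑ T (+ 1 + P * m) p-1} {g = λ m → ∑ G (P * m) p} {c = c₀} {d = c₀} L₀ λ j _ → inner (c₀ + + j))
      (≈-trans (≈-reflexive (sym (∑-group G p c₀ L₀)))
      (≈-trans (≈-reflexive (trans (cong₂ (∑ G) (sym start) (lemma p (p ℕ.^ r) L)) (∑-distrib κ (λ x → g x * F R x) (+ (p ℕ.^ R) * c) (L ℕ.* p ℕ.^ R))))
      (subst (λ q → κ * ∑ (λ x → g x * F R x) (+ (p ℕ.^ R) * c) (L ℕ.* p ℕ.^ R) ≈ + 0 [ q ]) modulus
        (≈-trans (≈-mod-* κ-∣ (weighted-sum R 0 g F F-floor g≈0 c L)) (≈-reflexive (*-zeroʳ κ))))))
      where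
      module F₁ = BlockFactor F₁
      module F₂ = BlockFactor F₂
      R = suc r
      -- Terms are multiplied by (k / k)² before any power of p is split off, so the inverses need
      -- the full final precision.
      M = 3 ℕ.* R
      open Inverse M
      c₀ = + (p ℕ.^ r) * c
      L₀ = L ℕ.* p ℕ.^ r
      T = εTerm ε R (b₁ ∷ b₂ ∷ [])
      κ = P ^ R * F₁.x * (P ^ R * F₂.x)
      F : ℕ → ℤ → ℤ
      F r m = F₁.f r m * F₂.f r m
      g : ℤ → ℤ
      g x = εpow ε (+ 1 + x) * inv² (+ 1 + x)
      G : ℤ → ℤ
      G x = κ * (g x * F R x)

      start : + (p ℕ.^ R) * c ≡ P * c₀
      start = trans (cong (_* c) (pos-* p (p ℕ.^ r))) (*-assoc P (+ (p ℕ.^ r)) c)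
      lemma : ∀ p q L → L ℕ.* q ℕ.* p ≡ L ℕ.* (p ℕ.* q)
      lemma = ℕ-Solver.solve-∀

      κ-∣ : P ^ (R ℕ.+ R) ∣ κ
      κ-∣ = ^-∣-* R R (∣m⇒∣m*n F₁.x ∣-refl) (∣m⇒∣m*n F₂.x ∣-refl)
      modulus : P ^ (R ℕ.+ R) * P ^ (R ℕ.+ 0) ≡ P ^ M
      modulus = trans (sym (^-distribˡ-+-* P (R ℕ.+ R) (R ℕ.+ 0))) (cong (P ^_) (lemma′ R))
        where
        lemma′ : ∀ R → R ℕ.+ R ℕ.+ (R ℕ.+ 0) ≡ 3 ℕ.* R
        lemma′ = ℕ-Solver.solve-∀

      F-floor : ∀ r m i → i ℕ.< p → F (suc r) (P * m + + i) ≈ F r m [ P ^ suc r ]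
      F-floor r m i i<p = ≈-trans (ratio-≈ {suc r} (ratio-* (F₁.f-floor x₁≢0 r m i i<p) (F₂.f-floor x₂≢0 r m i i<p)))
        (≈-reflexive (trans (cong (_* F r m) (εpow-square { - + 1} refl (+ i))) (*-identityˡ (F r m))))

      g≈0 : ∀ s → s ℕ.≤ R → ∀ m → ∑ g (+ (p ℕ.^ s) * m) (p ℕ.^ s) ≈ + 0 [ P ^ (s ℕ.+ 0) ]
      g≈0 s s≤R m = subst (λ e → ∑ g (+ (p ℕ.^ s) * m) (p ℕ.^ s) ≈ + 0 [ P ^ e ]) (sym (ℕ.+-identityʳ s))
        (∑ε^k*inv²≈0 2-unit 3-unit M ε ε≡±1 ε^p≡ε s (ℕ.≤-trans s≤R (ℕ.m≤m+n R _)) m)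

      -- T k * k² is a product of block factors, and inv² k inverts k².
      T≈G : ∀ k → Unit k → T k ≈ G (k - + 1) [ P ^ M ]
      T≈G k k-unit = ≈-trans (≈-reflexive (lemma₁ (εpow ε k) (scaledBlockTerm (P ^ R) k b₁) (scaledBlockTerm (P ^ R) k b₂)))
        (≈-trans (≈-*ˡ (T k) (≈-sym (≈-* (inv-∤ P∤k) (inv-∤ P∤k))))
        (≈-reflexive (begin
          εpow ε k * (t₁ * (t₂ * + 1)) * (k * inv k * (k * inv k))                    ≡⟨ lemma₂ (εpow ε k) t₁ t₂ k (inv k) ⟩
          k * t₁ * (k * t₂) * (εpow ε k * inv² k)                                     ≡⟨ cong₂ (λ a b → a * b * (εpow ε k * inv² k)) (F₁.k*block R k) (F₂.k*block R k) ⟩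
          P ^ R * F₁.x * F₁.f R (k - + 1) * (P ^ R * F₂.x * F₂.f R (k - + 1)) * (εpow ε k * inv² k)
            ≡⟨ lemma₃ (P ^ R * F₁.x) (F₁.f R (k - + 1)) (P ^ R * F₂.x) (F₂.f R (k - + 1)) (εpow ε k * inv² k) ⟩
          κ * (εpow ε k * inv² k * F R (k - + 1))                                     ≡⟨ cong (λ z → κ * (εpow ε z * inv² z * F R (k - + 1))) (lemma₄ k) ⟩
          G (k - + 1)                                                                 ∎)))
        where
        open ≡-Reasoning
        t₁ = scaledBlockTerm (P ^ R) k b₁
        t₂ = scaledBlockTerm (P ^ R) k b₂
        P∤k = unit⇒P∤ k-unit
        lemma₁ : ∀ e a b → e * (a * (b * + 1)) ≡ e * (a * (b * + 1)) * (+ 1 * + 1)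
        lemma₁ = solve-∀
        lemma₂ : ∀ e a b k i → e * (a * (b * + 1)) * (k * i * (k * i)) ≡ k * a * (k * b) * (e * (i * i))
        lemma₂ = solve-∀
        lemma₃ : ∀ x f y g w → x * f * (y * g) * w ≡ x * y * (w * (f * g))
        lemma₃ = solve-∀
        lemma₄ : ∀ k → k ≡ + 1 + (k - + 1)
        lemma₄ = solve-∀

      -- The p - 1 indices prime to p are completed to a full block of p: the added one is a
      -- multiple of p, where `inv` is 0.
      inner : ∀ m → ∑ T (+ 1 + P * m) p-1 ≈ ∑ G (P * m) p [ P ^ M ]
      inner m = ≈-trans (∑-cong-≈ {f = T} {g = G} {c = + 1 + P * m} {d = P * m} p-1 λ i i< →
          ≈-trans (T≈G (+ 1 + P * m + + i) (unit-1+Pm+j m i<)) (≈-reflexive (cong G (lemma₁ (P * m) (+ i)))))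
        (≈-reflexive (sym (trans (cong (∑ G (P * m)) p≡suc-p-1) (trans (cong (_+_ (∑ G (P * m) p-1)) last≡0) (+-identityʳ _)))))
        where
        lemma₁ : ∀ a i → + 1 + a + i - + 1 ≡ a + i
        lemma₁ = solve-∀
        P∣last : P ∣ + 1 + (P * m + + p-1)
        P∣last = subst (P ∣_) (lemma₂ P m (+ p-1) (cong +_ p≡suc-p-1)) (∣m⇒∣m*n (m + + 1) ∣-refl)
          where
          lemma₂ : ∀ P m q → P ≡ + 1 + q → P * (m + + 1) ≡ + 1 + (P * m + q)
          lemma₂ P m q P≡ = trans (*-distribˡ-+ P m (+ 1)) (trans (cong (_+_ (P * m)) (trans (*-identityʳ P) P≡)) (lemma₃ (P * m) q))
            where
            lemma₃ : ∀ a q → a + (+ 1 + q) ≡ + 1 + (a + q)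
            lemma₃ = solve-∀
        last≡0 : G (P * m + + p-1) ≡ + 0
        last≡0 = trans (cong (λ z → κ * (εpow ε (+ 1 + (P * m + + p-1)) * (z * inv (+ 1 + (P * m + + p-1))) * F R (P * m + + p-1))) (inv-∣ P∣last))
          (trans (cong (λ z → κ * (z * F R (P * m + + p-1))) (*-zeroʳ (εpow ε (+ 1 + (P * m + + p-1))))) (*-zeroʳ κ))

    -- The floor congruence divides by x. For x = 0, however, k times the block term is 0, and the
    -- unit k cancels.
    block-vanishes : ∀ {q} r {b} (F : BlockFactor b) → BlockFactor.x F ≡ + 0 → ∀ {k} → Unit k → P ^ q ∣ scaledBlockTerm (P ^ r) k b
    block-vanishes {q} r F x≡0 {k} k-unit = unit-cancel-∣ q k-unit (subst (P ^ q ∣_)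
      (sym (trans (BlockFactor.k*block F r k) (cong (_* BlockFactor.f F r (k - + 1)) (trans (cong (P ^ r *_) x≡0) (*-zeroʳ (P ^ r)))))) x∣0)

  -- Three blocks already make each term divisible by P^(3(r+1)), and a block with x = 0 makes it
  -- divisible by every power; cancellation between terms is left to the case of two blocks with
  -- nonzero x.
  PrimeToPSum-short≈0 : Unit (+ 2) → Unit (+ 3) → ∀ ε → ε ≡ + 1 ⊎ ε ≡ - + 1 → ε ^ p ≡ ε → ∀ r bs → 2 ℕ.≤ length bs →
    All NonEmpty bs → All (λ xs → length xs ℕ.≤ 2) bs → ∀ c L →
    PrimeToPSum ε (suc r) bs (+ (p ℕ.^ r) * c) (L ℕ.* p ℕ.^ r) ≈ + 0 [ P ^ (3 ℕ.* suc r) ]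
  PrimeToPSum-short≈0 2-unit 3-unit ε ε≡±1 ε^p≡ε r bs@(_ ∷ _ ∷ _ ∷ _) _ nonEmpty _ c L =
    PrimeToPSum≈0 ε (suc r) bs (λ k k-unit → blocksProduct-unit-∣ {suc r} {k} {bs} 3 k-unit (s≤s (s≤s (s≤s z≤n))) nonEmpty) (+ (p ℕ.^ r) * c) (L ℕ.* p ℕ.^ r)
  PrimeToPSum-short≈0 2-unit 3-unit ε ε≡±1 ε^p≡ε r bs@(b₁ ∷ b₂ ∷ []) _ (ne₁ ∷ ne₂ ∷ []) (sh₁ ∷ sh₂ ∷ []) c L =
    cases (BlockFactor.x F₁ ≟ + 0) (BlockFactor.x F₂ ≟ + 0)
    where
    F₁ = blockFactor 2-unit b₁ ne₁ sh₁
    F₂ = blockFactor 2-unit b₂ ne₂ sh₂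
    q = P ^ (3 ℕ.* suc r)
    cases : Dec (BlockFactor.x F₁ ≡ + 0) → Dec (BlockFactor.x F₂ ≡ + 0) →
            PrimeToPSum ε (suc r) bs (+ (p ℕ.^ r) * c) (L ℕ.* p ℕ.^ r) ≈ + 0 [ q ]
    cases (yes x₁≡0) _ = PrimeToPSum≈0 ε (suc r) bs (λ k k-unit → ∣m⇒∣m*n (scaledBlockTerm (P ^ suc r) k b₂ * + 1)
      (block-vanishes {3 ℕ.* suc r} (suc r) F₁ x₁≡0 k-unit)) (+ (p ℕ.^ r) * c) (L ℕ.* p ℕ.^ r)
    cases (no _) (yes x₂≡0) = PrimeToPSum≈0 ε (suc r) bs (λ k k-unit → ∣n⇒∣m*n (scaledBlockTerm (P ^ suc r) k b₁) (∣m⇒∣m*n (+ 1)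
      (block-vanishes {3 ℕ.* suc r} (suc r) F₂ x₂≡0 k-unit))) (+ (p ℕ.^ r) * c) (L ℕ.* p ℕ.^ r)
    cases (no x₁≢0) (no x₂≢0) = two-blocks 2-unit 3-unit ε ε≡±1 ε^p≡ε r b₁ b₂ F₁ F₂ (≢-nonZero x₁≢0) (≢-nonZero x₂≢0) c L
  PrimeToPSum-short≈0 _ _ _ _ _ _ (_ ∷ []) (s≤s ())

-- Finiteness of the sum over k

private
  k≤y : ∀ {k y} → k < + 0 → ∣ y ∣ ℕ.< ∣ k ∣ → k ≤ y
  k≤y { -[1+ _ ]} {+ _}       _ _ = -≤+
  k≤y { -[1+ _ ]} { -[1+ _ ]} _ (s≤s i<j) = -≤- (ℕ.<⇒≤ i<j)
  k≤y {+ _} (+<+ ()) _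

  y<k : ∀ {k y} → + 0 ≤ k → ∣ y ∣ ℕ.< ∣ k ∣ → y < k
  y<k {+ _} {+ _}       _ i<j = +<+ i<j
  y<k {+ _} { -[1+ _ ]} _ _   = -<+

  0≤y-k : ∀ {k} y → k < + 0 → ∣ y ∣ ℕ.< ∣ k ∣ → + 0 ≤ y - k
  0≤y-k {k} y k<0 ∣y∣<∣k∣ = i≤j⇒0≤j-i {k} {y} (k≤y k<0 ∣y∣<∣k∣)

  y-k<0 : ∀ {k} y → + 0 ≤ k → ∣ y ∣ ℕ.< ∣ k ∣ → y - k < + 0
  y-k<0 {k} y 0≤k ∣y∣<∣k∣ = subst (y - k <_) (+-inverseʳ k) (+-monoˡ-< (- k) {y} {k} (y<k 0≤k ∣y∣<∣k∣))

-- The last factor has the nonnegative total as its top and the negative k as its bottom.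
multinomialGo-zero : ∀ {acc k} ys → k < + 0 → + 0 ≤ acc + k → All (+ 0 ≤_) ys → multinomialGo acc (ys ++ [ k ]) ≡ + 0
multinomialGo-zero {acc} {k} []       k<0 0≤ []         = trans (*-identityʳ _) (binomℤ-pos-neg (acc + k) k 0≤ k<0)
multinomialGo-zero {acc} {k} (y ∷ ys) k<0 0≤ (0≤y ∷ 0≤ys) = trans (cong (binomℤ (acc + y) y *_)
  (multinomialGo-zero {acc + y} ys k<0 (subst (+ 0 ≤_) (lemma acc y k) (+-mono-≤ 0≤ 0≤y)) 0≤ys)) (*-zeroʳ (binomℤ (acc + y) y))
  where
  lemma : ∀ a y k → a + k + y ≡ a + y + k
  lemma = solve-∀

EventuallyZero : (ℤ → ℤ) → Set
EventuallyZero t = Σ ℕ λ N → ∀ k → N ℕ.< ∣ k ∣ → t k ≡ + 0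

-- For large k > 0 the first two entries are negative. For k far below 0 all entries but k are
-- nonnegative, and the first two outweigh the single k, so the total is nonnegative.
long-blockTerm-vanishes : ∀ y₁ y₂ ys → EventuallyZero (λ k → blockTerm k (y₁ ∷ y₂ ∷ ys))
long-blockTerm-vanishes y₁ y₂ ys = bound (y₁ ∷ y₂ ∷ ys) , vanishes
  where
  bound : List ℤ → ℕ
  bound = foldr (λ y n → ∣ y ∣ ℕ.+ n) 0
  entries-nonneg : ∀ {k} ys → k < + 0 → bound ys ℕ.< ∣ k ∣ → All (+ 0 ≤_) (map (λ y → y - k) ys)
  entries-nonneg []       k<0 _ = []
  entries-nonneg (y ∷ ys) k<0 b = 0≤y-k y k<0 (ℕ.≤-<-trans (ℕ.m≤m+n ∣ y ∣ (bound ys)) b) ∷ entries-nonneg ys k<0 (ℕ.≤-<-trans (ℕ.m≤n+m (bound ys) ∣ y ∣) b)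
  vanishes : ∀ k → bound (y₁ ∷ y₂ ∷ ys) ℕ.< ∣ k ∣ → blockTerm k (y₁ ∷ y₂ ∷ ys) ≡ + 0
  vanishes k b with + 0 ≤? k
  ... | yes 0≤k = cong (_* multinomialGo (y₁ - k + (y₂ - k)) (map (λ y → y - k) ys ++ [ k ]))
    (trans (sym (binomℤ-+-sym (y₁ - k) (y₂ - k))) (binomℤ-neg-neg (y₁ - k) (y₂ - k)
      (y-k<0 y₁ 0≤k (ℕ.≤-<-trans (ℕ.m≤m+n ∣ y₁ ∣ _) b))
      (y-k<0 y₂ 0≤k (ℕ.≤-<-trans (ℕ.≤-trans (ℕ.m≤m+n ∣ y₂ ∣ (bound ys)) (ℕ.m≤n+m _ ∣ y₁ ∣)) b))))
  ... | no  0≰k = trans (cong (binomℤ (y₁ - k + (y₂ - k)) (y₂ - k) *_)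
      (multinomialGo-zero (map (λ y → y - k) ys) k<0
        (subst (+ 0 ≤_) (lemma y₁ y₂ k) (0≤y-k (y₁ + y₂) k<0 (ℕ.≤-<-trans (∣i+j∣≤∣i∣+∣j∣ y₁ y₂) (ℕ.≤-<-trans (ℕ.+-monoʳ-≤ ∣ y₁ ∣ (ℕ.m≤m+n ∣ y₂ ∣ (bound ys))) b))))
        (entries-nonneg ys k<0 (ℕ.≤-<-trans (ℕ.≤-trans (ℕ.m≤n+m (bound ys) ∣ y₂ ∣) (ℕ.m≤n+m _ ∣ y₁ ∣)) b))))
      (*-zeroʳ (binomℤ (y₁ - k + (y₂ - k)) (y₂ - k)))
    where
    k<0 = ≰⇒> 0≰k
    lemma : ∀ y z k → y + z - k ≡ y - k + (z - k) + k
    lemma = solve-∀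

nonneg-blockTerm-vanishes : ∀ n → EventuallyZero (λ k → blockTerm k (+ n ∷ []))
nonneg-blockTerm-vanishes n = n , λ k n<k → trans (*-identityʳ _) (trans (cong (λ z → binomℤ z k) (i-j+j≡i (+ n) k)) (vanishes k n<k))
  where
  vanishes : ∀ k → n ℕ.< ∣ k ∣ → binomℤ (+ n) k ≡ + 0
  vanishes (+ k)    n<k = cong +_ (k>n⇒nCk≡0 n<k)
  vanishes -[1+ k ] _   = refl

[m+k]Ck≢0 : ∀ m k → ¬ (m ℕ.+ k) C k ≡ 0
[m+k]Ck≢0 m zero    ()
[m+k]Ck≢0 m (suc k) eq = case-zero (ℕ.m*n≡0⇒m≡0∨n≡0 (suc (m ℕ.+ k)) (trans (sym ([1+k]*[1+n]C[1+k] (m ℕ.+ k) k))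
  (trans (cong (λ n → suc k ℕ.* (n C suc k)) (sym (ℕ.+-suc m k))) (trans (cong (suc k ℕ.*_) eq) (ℕ.*-zeroʳ (suc k))))))
  where
  case-zero : suc (m ℕ.+ k) ≡ 0 ⊎ (m ℕ.+ k) C k ≡ 0 → _
  case-zero (inj₂ z) = [m+k]Ck≢0 m k z

negative-blockTerm≢0 : ∀ m k → ¬ blockTerm (+ k) (-[1+ m ] ∷ []) ≡ + 0
negative-blockTerm≢0 m k eq with i*j≡0⇒i≡0∨j≡0 ((- + 1) ^ k) (trans (cong (λ z → binomℤ z (+ k)) (sym (i-j+j≡i -[1+ m ] (+ k)))) (trans (sym (*-identityʳ _)) eq))
... | inj₁ s≡0 = contradiction (trans (cong (_* (- + 1) ^ k) (sym s≡0)) (εpow-square { - + 1} refl (+ k))) λ ()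
... | inj₂ C≡0 = [m+k]Ck≢0 m k (+-injective C≡0)

-- All multiples c are required at once, because finiteness is given for n and needed for n
-- multiplied by powers of p.
Tame : List ℤ → Set
Tame xs = ∀ c → EventuallyZero (λ k → scaledBlockTerm (+ c) k xs)

Negative : List ℤ → Set
Negative xs = ∃ λ m → xs ≡ -[1+ m ] ∷ []

tame⊎negative : ∀ xs → NonEmpty xs → Tame xs ⊎ Negative xs
tame⊎negative (+ n ∷ [])        _ = inj₁ λ c → subst (λ y → EventuallyZero (λ k → blockTerm k (y ∷ []))) (pos-* c n) (nonneg-blockTerm-vanishes (c ℕ.* n))
tame⊎negative (-[1+ m ] ∷ [])   _ = inj₂ (m , refl)
tame⊎negative (x ∷ y ∷ xs)      _ = inj₁ λ c → long-blockTerm-vanishes (+ c * x) (+ c * y) (map (+ c *_) xs)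

-- One tame block makes the whole product vanish eventually. Otherwise every block is a single
-- negative entry, whose coefficient ±C(m + k, k) is nonzero for all k ≥ 0.
tame⇒vanishes : ∀ {bs} c → All NonEmpty bs → (∀ k → ¬ blocksProduct (+ 1) (+ k) bs ≡ + 0) ⊎ EventuallyZero (λ k → blocksProduct (+ c) k bs)
tame⇒vanishes c [] = inj₁ λ k ()
tame⇒vanishes {xs ∷ bs} c (ne ∷ nes) with tame⊎negative xs ne | tame⇒vanishes c nes
... | inj₁ tame | _ = inj₂ (proj₁ (tame c) , λ k N<k → cong (_* blocksProduct (+ c) k bs) (proj₂ (tame c) k N<k))
... | inj₂ _    | inj₂ (N , vanishes) = inj₂ (N , λ k N<k → trans (cong (scaledBlockTerm (+ c) k xs *_) (vanishes k N<k)) (*-zeroʳ (scaledBlockTerm (+ c) k xs)))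
... | inj₂ (m , refl) | inj₁ nonzero = inj₁ λ k eq → case-zero k (i*j≡0⇒i≡0∨j≡0 (scaledBlockTerm (+ 1) (+ k) xs) eq)
  where
  case-zero : ∀ k → scaledBlockTerm (+ 1) (+ k) (-[1+ m ] ∷ []) ≡ + 0 ⊎ blocksProduct (+ 1) (+ k) bs ≡ + 0 → _
  case-zero k (inj₁ z) = negative-blockTerm≢0 m k (trans (cong (λ y → blockTerm (+ k) (y ∷ [])) (sym (*-identityˡ -[1+ m ]))) z)
  case-zero k (inj₂ z) = nonzero k z

blocks-nonEmpty : ∀ λs (n : Vec ℤ (sum λs)) → All (λ l → 1 ℕ.≤ l) λs → All NonEmpty (blocks λs n)
blocks-nonEmpty []       n []         = []
blocks-nonEmpty (l ∷ ls) n (1≤l ∷ ps) = subst (1 ℕ.≤_) (sym (length-toList (take l n))) 1≤l ∷ blocks-nonEmpty ls (drop l n) ps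

blocks-short : ∀ λs (n : Vec ℤ (sum λs)) → All (λ l → l ℕ.≤ 2) λs → All (λ xs → length xs ℕ.≤ 2) (blocks λs n)
blocks-short []       n []         = []
blocks-short (l ∷ ls) n (l≤2 ∷ ps) = subst (ℕ._≤ 2) (sym (length-toList (take l n))) l≤2 ∷ blocks-short ls (drop l n) ps

length-blocks : ∀ λs (n : Vec ℤ (sum λs)) → length (blocks λs n) ≡ length λs
length-blocks []       n = refl
length-blocks (l ∷ ls) n = cong suc (length-blocks ls (drop l n))

blocks-scale : ∀ c λs (n : Vec ℤ (sum λs)) → blocks λs (scale c n) ≡ map (map (+ c *_)) (blocks λs n)
blocks-scale c []       n = refl
blocks-scale c (l ∷ ls) n = cong₂ _∷_ (trans (cong toList (take-map (+ c *_) l n)) (toList-map (+ c *_) (take l n)))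
  (trans (cong (blocks ls) (drop-map (+ c *_) l n)) (blocks-scale c ls (drop l n)))

term-scale : ∀ ε λs n c k → term ε λs (scale c n) k ≡ εpow ε k * blocksProduct (+ c) k (blocks λs n)
term-scale ε λs n c k = cong (λ ts → εpow ε k * foldr _*_ (+ 1) ts)
  (trans (cong (map (blockTerm k)) (blocks-scale c λs n)) (sym (map-∘ {g = blockTerm k} {f = map (+ c *_)} (blocks λs n))))

term-unscaled : ∀ ε λs n k → term ε λs n k ≡ εpow ε k * blocksProduct (+ 1) k (blocks λs n)
term-unscaled ε λs n k = cong (λ ts → εpow ε k * foldr _*_ (+ 1) ts) (map-cong (λ xs → cong (blockTerm k) (map-1* xs)) (blocks λs n))
  where
  map-1* : ∀ xs → xs ≡ map (+ 1 *_) xs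
  map-1* []       = refl
  map-1* (x ∷ xs) = cong₂ _∷_ (sym (*-identityˡ x)) (map-1* xs)

-- Finiteness for n excludes that all blocks are single negative entries, since the term at k = N +
-- 1 vanishes; the remaining alternative does not depend on the scaling.
finite-scale : ∀ {ε} → ε * ε ≡ + 1 → ∀ λs n → All (λ l → 1 ℕ.≤ l) λs → Finite ε λs n → ∀ c → Finite ε λs (scale c n)
finite-scale {ε} εε≡1 λs n 1≤λs (N , finite) c with tame⇒vanishes c (blocks-nonEmpty λs n 1≤λs)
... | inj₂ (N′ , vanishes) = N′ , λ k N′<k → trans (term-scale ε λs n c k) (trans (cong (εpow ε k *_) (vanishes k N′<k)) (*-zeroʳ (εpow ε k)))
... | inj₁ nonzero = contradiction product≡0 (nonzero (suc N))
  where
  k = + suc N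
  product = blocksProduct (+ 1) k (blocks λs n)
  product≡0 : product ≡ + 0
  product≡0 = trans (trans (sym (*-identityˡ product)) (trans (cong (_* product) (sym (εpow-square {ε} εε≡1 k))) (*-assoc (εpow ε k) (εpow ε k) product)))
    (trans (cong (εpow ε k *_) (trans (sym (term-unscaled ε λs n k)) (finite k (ℕ.n<1+n N)))) (*-zeroʳ (εpow ε k)))

-- Comparison of the sums

∑-upTo : ∀ t c n → foldr _+_ (+ 0) (map (λ i → t (c + + i)) (upTo n)) ≡ ∑ t c n
∑-upTo t c n = go (λ i → t (c + + i)) (λ i → i) c n (λ i → refl)
  where
  go : ∀ (h : ℕ → ℤ) (f : ℕ → ℕ) c n → (∀ i → h (f i) ≡ t (c + + i)) → foldr _+_ (+ 0) (map h (applyUpTo f n)) ≡ ∑ t c n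
  go h f c zero    h≡ = refl
  go h f c (suc n) h≡ = trans (cong₂ _+_ (trans (h≡ 0) (cong t (+-identityʳ c)))
    (go h (f ∘ suc) (+ 1 + c) n (λ i → trans (h≡ (suc i)) (cong t (lemma c (+ i)))))) (sym (∑-head t c n))
    where
    lemma : ∀ c i → c + (+ 1 + i) ≡ + 1 + c + i
    lemma = solve-∀

Asum≡∑ : ∀ ε λs n B → Asum ε λs n B ≡ ∑ (term ε λs n) (- + B) (suc (B ℕ.+ B))
Asum≡∑ ε λs n B = trans (cong (foldr _+_ (+ 0)) (map-cong (λ i → cong (term ε λs n) (+-comm (+ i) (- + B))) (upTo (suc (B ℕ.+ B)))))
  (∑-upTo (term ε λs n) (- + B) (suc (B ℕ.+ B)))

∑-extend : ∀ t N → (∀ k → N ℕ.< ∣ k ∣ → t k ≡ + 0) → ∀ d → ∑ t (- + (d ℕ.+ N)) (suc (d ℕ.+ N ℕ.+ (d ℕ.+ N))) ≡ ∑ t (- + N) (suc (N ℕ.+ N))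
∑-extend t N vanishes zero    = refl
∑-extend t N vanishes (suc d) = begin
  ∑ t (- + suc B) (suc (suc B ℕ.+ suc B))                                ≡⟨ cong (λ L → ∑ t (- + suc B) (suc (suc L))) (ℕ.+-suc B B) ⟩
  ∑ t (- + suc B) (suc (suc (suc (B ℕ.+ B))))                            ≡⟨ ∑-head t (- + suc B) (suc (suc (B ℕ.+ B))) ⟩
  t (- + suc B) + (∑ t (+ 1 + - + suc B) (suc (B ℕ.+ B)) + t (+ 1 + - + suc B + + suc (B ℕ.+ B)))
    ≡⟨ cong₂ (λ x y → x + (∑ t (+ 1 + - + suc B) (suc (B ℕ.+ B)) + y)) (vanishes _ N<B+1) (trans (cong t (lemma₂ (+ B))) (vanishes (+ suc B) N<B+1)) ⟩
  + 0 + (∑ t (+ 1 + - + suc B) (suc (B ℕ.+ B)) + + 0)                    ≡⟨ trans (+-identityˡ _) (+-identityʳ _) ⟩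
  ∑ t (+ 1 + - + suc B) (suc (B ℕ.+ B))                                  ≡⟨ cong (λ c → ∑ t c (suc (B ℕ.+ B))) (lemma₁ (+ B)) ⟩
  ∑ t (- + B) (suc (B ℕ.+ B))                                            ≡⟨ ∑-extend t N vanishes d ⟩
  ∑ t (- + N) (suc (N ℕ.+ N))                                            ∎
  where
  open ≡-Reasoning
  B = d ℕ.+ N
  N<B+1 : N ℕ.< suc B
  N<B+1 = s≤s (ℕ.m≤n+m N d)
  lemma₁ : ∀ B → + 1 + - (+ 1 + B) ≡ - B
  lemma₁ = solve-∀
  lemma₂ : ∀ B → + 1 + - (+ 1 + B) + (+ 1 + (B + B)) ≡ + 1 + B
  lemma₂ = solve-∀

-- The window [-B , B] has odd length; without its vanishing first term it is (-B , B], which splits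
-- into blocks of length p whenever p divides B.
∑-drop-first : ∀ t B → t (- + B) ≡ + 0 → ∑ t (- + B) (suc (B ℕ.+ B)) ≡ ∑ (λ x → t (+ 1 + x)) (- + B) (B ℕ.+ B)
∑-drop-first t B t≡0 = trans (∑-head t (- + B) (B ℕ.+ B)) (trans (cong (_+ ∑ t (+ 1 + - + B) (B ℕ.+ B)) t≡0) (trans (+-identityˡ _)
  (∑-cong {f = t} {g = λ x → t (+ 1 + x)} {c = + 1 + - + B} {d = - + B} (B ℕ.+ B) λ j _ → cong t (+-assoc (+ 1) (- + B) (+ j)))))

module Comparison (p : ℕ) (p-prime : Prime p) where

  open PrimeToPSum p p-prime public

  -- (-b p , b p] consists of the blocks P m + 1, ..., P m + P with -b ≤ m < b. Their last indices P
  -- (1 + m) correspond to the window (-b , b] of t′, which loses nothing because t′ vanishes beyond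
  -- N < b.
  compare-sums : ∀ {q} t t′ b → (∀ k → b ℕ.* p ℕ.≤ ∣ k ∣ → t k ≡ + 0) → ∀ N → N ℕ.< b → (∀ k → N ℕ.< ∣ k ∣ → t′ k ≡ + 0) →
    (∀ k → t (P * k) ≈ t′ k [ q ]) → ∑ (λ m → ∑ t (+ 1 + P * m) p-1) (- + b) (b ℕ.+ b) ≈ + 0 [ q ] →
    ∑ t (- + (b ℕ.* p)) (suc (b ℕ.* p ℕ.+ b ℕ.* p)) ≈ ∑ t′ (- + (b ℕ.* p)) (suc (b ℕ.* p ℕ.+ b ℕ.* p)) [ q ]
  compare-sums {q} t t′ b t-vanishes N N<b t′-vanishes t≈t′ prime-to-p≈0 =
    ≈-trans (≈-reflexive upper) (≈-trans (≈-+ prime-to-p≈0 (∑-cong-≈ {c = - + b} {d = - + b} (b ℕ.+ b) λ j _ → t≈t′ (+ 1 + (- + b + + j))))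
      (≈-reflexive (trans (+-identityˡ _) (sym lower))))
    where
    B = b ℕ.* p
    s : ℤ → ℤ
    s x = t (+ 1 + x)

    inner : ∀ m → ∑ s (P * m) p ≡ ∑ t (+ 1 + P * m) p-1 + t (P * (+ 1 + m))
    inner m = trans (cong (∑ s (P * m)) p≡suc-p-1) (cong₂ _+_
      (∑-cong {f = s} {g = t} {c = P * m} {d = + 1 + P * m} p-1 λ j _ → cong t (sym (+-assoc (+ 1) (P * m) (+ j))))
      (cong t (trans (lemma (P * m) (+ p-1)) (trans (cong (λ z → P * m + + z) (sym p≡suc-p-1)) (lemma′ P m)))))
      where
      lemma : ∀ a q → + 1 + (a + q) ≡ a + (+ 1 + q)
      lemma = solve-∀
      lemma′ : ∀ P m → P * m + P ≡ P * (+ 1 + m)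
      lemma′ = solve-∀

    upper : ∑ t (- + B) (suc (B ℕ.+ B)) ≡ ∑ (λ m → ∑ t (+ 1 + P * m) p-1) (- + b) (b ℕ.+ b) + ∑ (λ m → t (P * (+ 1 + m))) (- + b) (b ℕ.+ b)
    upper = begin
      ∑ t (- + B) (suc (B ℕ.+ B))                           ≡⟨ ∑-drop-first t B (t-vanishes (- + B) (ℕ.≤-reflexive (sym (∣-i∣≡∣i∣ (+ B))))) ⟩
      ∑ s (- + B) (B ℕ.+ B)                                 ≡⟨ cong₂ (∑ s) (trans (cong -_ (trans (pos-* b p) (*-comm (+ b) P))) (neg-distribʳ-* P (+ b))) (sym (ℕ.*-distribʳ-+ p b b)) ⟩
      ∑ s (P * - + b) ((b ℕ.+ b) ℕ.* p)                     ≡⟨ ∑-group s p (- + b) (b ℕ.+ b) ⟩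
      ∑ (λ m → ∑ s (P * m) p) (- + b) (b ℕ.+ b)             ≡⟨ ∑-cong {c = - + b} {d = - + b} (b ℕ.+ b) (λ j _ → inner (- + b + + j)) ⟩
      ∑ (λ m → ∑ t (+ 1 + P * m) p-1 + t (P * (+ 1 + m))) (- + b) (b ℕ.+ b) ≡⟨ ∑-+ (λ m → ∑ t (+ 1 + P * m) p-1) (λ m → t (P * (+ 1 + m))) (- + b) (b ℕ.+ b) ⟩
      ∑ (λ m → ∑ t (+ 1 + P * m) p-1) (- + b) (b ℕ.+ b) + ∑ (λ m → t (P * (+ 1 + m))) (- + b) (b ℕ.+ b) ∎
      where open ≡-Reasoning

    d = b ℕ.* p ℕ.∸ N
    N≤B : N ℕ.≤ B
    N≤B = ℕ.≤-trans (ℕ.<⇒≤ N<b) (ℕ.m≤m*n b p)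
    e = b ℕ.∸ N

    lower : ∑ t′ (- + B) (suc (B ℕ.+ B)) ≡ ∑ (λ m → t′ (+ 1 + m)) (- + b) (b ℕ.+ b)
    lower = begin
      ∑ t′ (- + B) (suc (B ℕ.+ B))                                  ≡⟨ cong (λ B → ∑ t′ (- + B) (suc (B ℕ.+ B))) (ℕ.m∸n+n≡m N≤B) ⟨
      ∑ t′ (- + (d ℕ.+ N)) (suc (d ℕ.+ N ℕ.+ (d ℕ.+ N)))            ≡⟨ ∑-extend t′ N t′-vanishes d ⟩
      ∑ t′ (- + N) (suc (N ℕ.+ N))                                  ≡⟨ ∑-extend t′ N t′-vanishes e ⟨
      ∑ t′ (- + (e ℕ.+ N)) (suc (e ℕ.+ N ℕ.+ (e ℕ.+ N)))            ≡⟨ cong (λ B → ∑ t′ (- + B) (suc (B ℕ.+ B))) (ℕ.m∸n+n≡m (ℕ.<⇒≤ N<b)) ⟩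
      ∑ t′ (- + b) (suc (b ℕ.+ b))                                  ≡⟨ ∑-drop-first t′ b (t′-vanishes (- + b) (subst (N ℕ.<_) (sym (∣-i∣≡∣i∣ (+ b))) N<b)) ⟩
      ∑ (λ m → t′ (+ 1 + m)) (- + b) (b ℕ.+ b)                      ∎
      where open ≡-Reasoning

module Assembly (p : ℕ) (p-prime : Prime p) where

  open Comparison p p-prime public

  <⇒∤ : ∀ {n} → 0 ℕ.< n → n ℕ.< p → ¬ P ∣ + n
  <⇒∤ 0<n n<p P∣n = ℕ.<⇒≱ n<p (ℕ.∣⇒≤ {{ℕ.>-nonZero 0<n}} (∣⇒∣ᵤ P∣n))

  [-1]^p≡-1 : 3 ℕ.≤ p → (- + 1) ^ p ≡ - + 1
  [-1]^p≡-1 3≤p with p % 2 | m%n<n p 2 | m≡m%n+[m/n]*n p 2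
  ... | 1 | _ | p≡ = trans (cong ((- + 1) ^_) (trans p≡ (lemma (p / 2)))) ([-1]^[m+n+n] 1 (p / 2))
    where
    lemma : ∀ h → 1 ℕ.+ h ℕ.* 2 ≡ 1 ℕ.+ h ℕ.+ h
    lemma = ℕ-Solver.solve-∀
  ... | suc (suc _) | s≤s (s≤s ()) | _
  ... | 0 | _ | p≡ with prime⇒irreducible p-prime (ℕ.divides (p / 2) p≡)
  ...   | inj₂ 2≡p = contradiction (subst (3 ℕ.≤_) (sym 2≡p) 3≤p) λ { (s≤s (s≤s ())) }

  -- Makes the signs of the matched indices p k and k agree.
  εpow-P : ∀ {ε} → ε ^ p ≡ ε → ∀ k → εpow ε (P * k) ≡ εpow ε k
  εpow-P {ε} ε^p≡ε k = trans (cong (ε ^_) (abs-* P k)) (trans (sym (^-*-assoc ε p ∣ k ∣)) (cong (_^ ∣ k ∣) ε^p≡ε))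

  supercongruence : ∀ {ε} → ε * ε ≡ + 1 → ε ^ p ≡ ε → ∀ λs n → All (λ l → 1 ℕ.≤ l) λs → Finite ε λs n → ∀ e r →
    (∀ k → blocksProduct (P ^ suc r) (P * k) (blocks λs n) ≈ blocksProduct (P ^ r) k (blocks λs n) [ P ^ e ]) →
    (∀ c L → PrimeToPSum ε (suc r) (blocks λs n) (+ (p ℕ.^ r) * c) (L ℕ.* p ℕ.^ r) ≈ + 0 [ P ^ e ]) →
    Σ ℕ λ B → VanishesBeyond ε λs (scale (p ℕ.^ suc r) n) B × VanishesBeyond ε λs (scale (p ℕ.^ r) n) B
      × (+ (p ℕ.^ e) Unsigned.∣ Asum ε λs (scale (p ℕ.^ suc r) n) B - Asum ε λs (scale (p ℕ.^ r) n) B)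
  supercongruence {ε} εε≡1 ε^p≡ε λs n 1≤λs finite e r multiple-of-p prime-to-p =
    b ℕ.* p , (λ k B<k → upper-vanishes k (ℕ.<⇒≤ B<k)) , (λ k B<k → lower-vanishes k (ℕ.<-trans N′<B B<k)) ,
    ∣⇒∣ᵤ (subst (_∣ Asum ε λs (scale (p ℕ.^ suc r) n) B - Asum ε λs (scale (p ℕ.^ r) n) B) (sym (pos-^ p e)) (≈⇒∣
      (≈-trans (≈-reflexive (Asum≡∑ ε λs (scale (p ℕ.^ suc r) n) B))
      (≈-trans (compare-sums t t′ b upper-vanishes N′ N′<b lower-vanishes t≈t′ t-prime-to-p)
      (≈-reflexive (sym (Asum≡∑ ε λs (scale (p ℕ.^ r) n) B)))))))
    where
    t  = term ε λs (scale (p ℕ.^ suc r) n)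
    t′ = term ε λs (scale (p ℕ.^ r) n)
    bs = blocks λs n
    upper-finite = finite-scale {ε} εε≡1 λs n 1≤λs finite (p ℕ.^ suc r)
    lower-finite = finite-scale {ε} εε≡1 λs n 1≤λs finite (p ℕ.^ r)
    N  = proj₁ upper-finite
    N′ = proj₁ lower-finite
    -- b₀ exceeds both bounds. The factor p^r in b makes the quotients m run through 2 b₀ full
    -- periods starting at -b₀ p^r, as `prime-to-p` expects; the factor p in B lets the window split
    -- into blocks. One B serves both sums.
    b₀ = suc (N ℕ.+ N′)
    b  = b₀ ℕ.* p ℕ.^ r
    B  = b ℕ.* p

    b₀≤b : b₀ ℕ.≤ b
    b₀≤b = ℕ.m≤m*n b₀ (p ℕ.^ r) {{ℕ.m^n≢0 p r}}
    N′<b : N′ ℕ.< b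
    N′<b = ℕ.≤-trans (s≤s (ℕ.m≤n+m N′ N)) b₀≤b
    N′<B : N′ ℕ.< B
    N′<B = ℕ.<-≤-trans N′<b (ℕ.m≤m*n b p)

    upper-vanishes : ∀ k → B ℕ.≤ ∣ k ∣ → t k ≡ + 0
    upper-vanishes k B≤k = proj₂ upper-finite k (ℕ.≤-trans (s≤s (ℕ.m≤m+n N N′)) (ℕ.≤-trans b₀≤b (ℕ.≤-trans (ℕ.m≤m*n b p) B≤k)))
    lower-vanishes : ∀ k → N′ ℕ.< ∣ k ∣ → t′ k ≡ + 0
    lower-vanishes = proj₂ lower-finite

    t≡ : ∀ r k → term ε λs (scale (p ℕ.^ r) n) k ≡ εTerm ε r bs k
    t≡ r k = trans (term-scale ε λs n (p ℕ.^ r) k) (cong (λ c → εpow ε k * blocksProduct c k bs) (pos-^ p r))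

    t≈t′ : ∀ k → t (P * k) ≈ t′ k [ P ^ e ]
    t≈t′ k = ≈-trans (≈-reflexive (trans (t≡ (suc r) (P * k)) (cong (_* blocksProduct (P ^ suc r) (P * k) bs) (εpow-P {ε} ε^p≡ε k))))
      (≈-trans (≈-*ˡ (εpow ε k) (multiple-of-p k)) (≈-reflexive (sym (t≡ r k))))

    t-prime-to-p : ∑ (λ m → ∑ t (+ 1 + P * m) p-1) (- + b) (b ℕ.+ b) ≈ + 0 [ P ^ e ]
    t-prime-to-p = ≈-trans (≈-reflexive (trans
        (∑-cong {c = - + b} {d = - + b} (b ℕ.+ b) λ j _ → ∑-cong {f = t} {g = εTerm ε (suc r) bs} {c = + 1 + P * (- + b + + j)} {d = + 1 + P * (- + b + + j)} p-1 λ i _ → t≡ (suc r) (+ 1 + P * (- + b + + j) + + i))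
        (cong₂ (PrimeToPSum ε (suc r) bs) start (sym (ℕ.*-distribʳ-+ (p ℕ.^ r) b₀ b₀)))))
      (prime-to-p (- + b₀) (b₀ ℕ.+ b₀))
      where
      start : - + b ≡ + (p ℕ.^ r) * - + b₀
      start = trans (cong -_ (trans (pos-* b₀ (p ℕ.^ r)) (*-comm (+ b₀) (+ (p ℕ.^ r))))) (neg-distribʳ-* (+ (p ℕ.^ r)) (+ b₀))

theorem3p2 : (ε : ℤ) → (ε ≡ + 1 ⊎ ε ≡ - + 1) →
    (λs : List ℕ) → All (λ l → 1 ℕ.≤ l) λs → (n : Vec ℤ (sum λs)) →
    Finite ε λs n →
    ((2 ℕ.≤ length λs) → (p r : ℕ) → Prime p → 1 ℕ.≤ r → (3 ℕ.≤ p ⊎ ε ≡ + 1) →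
    Σ ℕ (λ B → VanishesBeyond ε λs (scale (p ℕ.^ r) n) B
    × VanishesBeyond ε λs (scale (p ℕ.^ (r ℕ.∸ 1)) n) B
    × (+ (p ℕ.^ (2 ℕ.* r)) Unsigned.∣ (Asum ε λs (scale (p ℕ.^ r) n) B - Asum ε λs (scale (p ℕ.^ (r ℕ.∸ 1)) n) B))))
    ×
    ((2 ℕ.≤ length λs) → All (λ l → l ℕ.≤ 2) λs → (p r : ℕ) → Prime p → 1 ℕ.≤ r → 5 ℕ.≤ p →
    Σ ℕ (λ B → VanishesBeyond ε λs (scale (p ℕ.^ r) n) B
    × VanishesBeyond ε λs (scale (p ℕ.^ (r ℕ.∸ 1)) n) B
    × (+ (p ℕ.^ (3 ℕ.* r)) Unsigned.∣ (Asum ε λs (scale (p ℕ.^ r) n) B - Asum ε λs (scale (p ℕ.^ (r ℕ.∸ 1)) n) B))))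
theorem3p2 ε ε≡±1 λs 1≤λs n finite = square , cube
  where
  bs = blocks λs n
  nonEmpty = blocks-nonEmpty λs n 1≤λs

  εε≡1 : ε ≡ + 1 ⊎ ε ≡ - + 1 → ε * ε ≡ + 1
  εε≡1 (inj₁ refl) = refl
  εε≡1 (inj₂ refl) = refl

  2≤length : 2 ℕ.≤ length λs → 2 ℕ.≤ length bs
  2≤length = subst (2 ℕ.≤_) (sym (length-blocks λs n))

  -- The alternative p ≥ 3 or ε = 1 enters here: for p = 2 and ε = -1 the signs at 2k and k differ
  -- for odd k.
  ε^p≡ε : ∀ {p} → Prime p → 3 ℕ.≤ p ⊎ ε ≡ + 1 → ε ≡ + 1 ⊎ ε ≡ - + 1 → ε ^ p ≡ ε
  ε^p≡ε {p} _       _             (inj₁ refl) = ^-zeroˡ p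
  ε^p≡ε     p-prime (inj₁ 3≤p)    (inj₂ refl) = Assembly.[-1]^p≡-1 _ p-prime 3≤p
  ε^p≡ε     _       (inj₂ ())     (inj₂ refl)

  square : 2 ℕ.≤ length λs → (p r : ℕ) → Prime p → 1 ℕ.≤ r → 3 ℕ.≤ p ⊎ ε ≡ + 1 → _
  square 2≤ p (suc r) p-prime _ 3≤p⊎ε≡1 = A.supercongruence (εε≡1 ε≡±1) (ε^p≡ε p-prime 3≤p⊎ε≡1 ε≡±1) λs n 1≤λs finite (2 ℕ.* suc r) r
      (multiple-of-p p p-prime)
      (λ c L → A.PrimeToPSum≈0 ε (suc r) bs (λ k k-unit → A.blocksProduct-unit-∣ {suc r} {k} {bs} 2 k-unit (2≤length 2≤) nonEmpty) (+ (p ℕ.^ r) * c) (L ℕ.* p ℕ.^ r))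
    where
    module A = Assembly p p-prime
    multiple-of-p : ∀ p → Prime p → ∀ k → blocksProduct ((+ p) ^ suc r) (+ p * k) bs ≈ blocksProduct ((+ p) ^ r) k bs [ (+ p) ^ (2 ℕ.* suc r) ]
    multiple-of-p p p-prime k with p ℕ.≟ 2
    ... | yes refl = Two.blocksProduct-square₂ r k (2≤length 2≤) nonEmpty
    ... | no  p≢2  = blocksProduct-square {r} {k} {bs} σ (squareScaling (P∤⇒unit (<⇒∤ (s≤s z≤n) (ℕ.≤∧≢⇒< 2≤p (p≢2 ∘ sym)))) (Split.s σ)) (2≤length 2≤) nonEmpty
      where
      open Assembly p p-prime
      2≤p : 2 ℕ.≤ p
      2≤p = ℕ.nonTrivial⇒n>1 p {{prime⇒nonTrivial p-prime}}
      σ = split-at r k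

  cube : 2 ℕ.≤ length λs → All (λ l → l ℕ.≤ 2) λs → (p r : ℕ) → Prime p → 1 ℕ.≤ r → 5 ℕ.≤ p → _
  cube 2≤ short p (suc r) p-prime _ 5≤p = A.supercongruence (εε≡1 ε≡±1) ε^p λs n 1≤λs finite (3 ℕ.* suc r) r
      (λ k → A.blocksProduct-cube {r} k {bs} 2-unit 3-unit (2≤length 2≤) nonEmpty bs-short)
      (A.PrimeToPSum-short≈0 2-unit 3-unit ε ε≡±1 ε^p r bs (2≤length 2≤) nonEmpty bs-short)
    where
    module A = Assembly p p-prime
    bs-short = blocks-short λs n short
    3≤p : 3 ℕ.≤ p
    3≤p = ℕ.≤-trans (s≤s (s≤s (s≤s z≤n))) 5≤p
    2-unit = A.P∤⇒unit (A.<⇒∤ (s≤s z≤n) 3≤p)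
    3-unit = A.P∤⇒unit (A.<⇒∤ (s≤s z≤n) (ℕ.≤-trans (s≤s (s≤s (s≤s (s≤s z≤n)))) 5≤p))
    ε^p = ε^p≡ε p-prime (inj₁ 3≤p) ε≡±1
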